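{- A finite subset of $\mathbb{Z}^2$ is uniquely minimal if and only if it is congruent to either $B(2n,2n)$ or $B(n,n+1)$ for some $n\in\mathbb{N}$.
   Context: $X$ is the graph with vertex set $\mathbb{Z}^2$ in which $(x,y)$ and $(x',y')$ are adjacent iff $|x-x'|+|y-y'|=1$. For $A\subset\mathbb{Z}^2$, $\partial A=\{u\in\mathbb{Z}^2\setminus A:\ u \text{ adjacent to some } v\in A\}$. A finite set $A$ is minimal if $|\partial A|\le|\partial C|$ for all $C\subset\mathbb{Z}^2$ with $|C|=|A|$. Two sets are congruent if some graph automorphism of $X$ maps one onto the other. A set $A$ is uniquely minimal if it is minimal and every minimal set $C$ with $|C|=|A|$ is congruent to $A$. For $\alpha,\beta\in\mathbb{N}$, $B(\alpha,\beta)=\{(x,y)\in\mathbb{Z}^2: 0\le y-x\le\alpha,\ 0\le y+x\le\beta\}$.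
   Formalization: The finite subset is assumed nonempty: the empty set is trivially uniquely minimal (it is the only set of size 0) but is congruent to no B(2n,2n) or B(n,n+1), each of which contains the origin. -}

module Defs where

open import Data.Nat using (ℕ; _≤_; _+_; _*_)
open import Data.Integer as ℤ using (ℤ; +_; ∣_∣; _-_)
open import Data.Product using (_×_; _,_; Σ; ∃-syntax)
open import Data.Sum using (_⊎_)
open import Data.List using (List; length)
open import Data.List.Membership.Propositional using (_∈_; _∉_)
open import Data.List.Relation.Unary.Unique.Propositional using (Unique)
open import Function.Bundles using (_⇔_)
open import Relation.Binary.PropositionalEquality using (_≡_)

Pt : Set
Pt = ℤ × ℤ

Adj : Pt → Pt → Set
Adj (x , y) (x' , y') = ∣ x - x' ∣ + ∣ y - y' ∣ ≡ 1

record FinSet : Set where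
  constructor finset
  field
    elems  : List Pt
    unique : Unique elems
open FinSet public

_∈ₛ_ : Pt → FinSet → Set
p ∈ₛ A = p ∈ elems A

card : FinSet → ℕ
card A = length (elems A)

InBoundary : FinSet → Pt → Set
InBoundary A u = (u ∉ elems A) × (∃[ v ] (v ∈ elems A × Adj u v))

HasCard : (Pt → Set) → ℕ → Set
HasCard P n = Σ (List Pt) λ L → Unique L × length L ≡ n × (∀ u → (u ∈ L) ⇔ P u)

BoundaryLe : FinSet → FinSet → Set
BoundaryLe A C = ∀ m n → HasCard (InBoundary A) m → HasCard (InBoundary C) n → m ≤ n

Minimal : FinSet → Set
Minimal A = ∀ (C : FinSet) → card C ≡ card A → BoundaryLe A C

record Automorphism : Set where
  field
    fun     : Pt → Pt
    inv     : Pt → Pt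
    inv-fun : ∀ p → inv (fun p) ≡ p
    fun-inv : ∀ p → fun (inv p) ≡ p
    adj     : ∀ p q → Adj p q ⇔ Adj (fun p) (fun q)
open Automorphism public

-- S and T (subsets of ℤ², as predicates) are congruent: some automorphism
-- φ satisfies φ(S) = T, i.e. p ∈ S ⇔ φ p ∈ T for all p (φ bijective).
Congruent : (Pt → Set) → (Pt → Set) → Set
Congruent S T = Σ Automorphism λ φ → ∀ p → S p ⇔ T (fun φ p)

UniquelyMinimal : FinSet → Set
UniquelyMinimal A =
  Minimal A × (∀ (C : FinSet) → Minimal C → card C ≡ card A →
                 Congruent (_∈ₛ C) (_∈ₛ A))

InB : ℕ → ℕ → Pt → Set
InB α β (x , y) =
  (+ 0 ℤ.≤ y - x) × (y - x ℤ.≤ + α) × (+ 0 ℤ.≤ y ℤ.+ x) × (y ℤ.+ x ℤ.≤ + β)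

{-# OPTIONS --safe #-}

-- In the coordinates u = y − x, v = y + x the neighbours of a point are its four diagonal neighbours,
-- and a set A splits into two parity classes A₀, A₁.  If Aᵢ has aᵢ points, pᵢ values of u and qᵢ values
-- of v, then aᵢ ≤ pᵢqᵢ, and spreading Aᵢ by ±1 first in u and then in v shows that it has at least
-- aᵢ + pᵢ + qᵢ + 1 neighbours, which all lie in the other class or in ∂A.  With |∂A| = c + 2 this gives
-- p₀ + q₀ + p₁ + q₁ ≤ c and a₀ + p₀ + q₀ ≤ a₁ + c + 1, hence the isoperimetric inequality
-- 8|A| ≤ c² + 4.  If c² ≤ 8|A| + 1, then aᵢ = pᵢqᵢ, the values of u and v leave no gaps and the two
-- classes interleave, so that A is a box; for the sizes of B(2n,2n) and B(n,n+1) the box is determined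
-- up to congruence.  For every other size there are two minimal sets, strips of diagonal lines of equal
-- or alternating lengths with an incomplete last line, that differ in the number of points of degree
-- at most one.
module Submission where

open import Defs
open import Data.Bool as Bool using (Bool; true; false; not)
open import Data.Bool.Properties using (not-involutive; not-¬; ¬-not)
open import Data.Empty using (⊥)
open import Data.Integer as ℤ using (ℤ; +_; -[1+_]; 0ℤ; 1ℤ; -1ℤ)
import Data.Integer.Properties as ℤ
import Data.Integer.Tactic.RingSolver as ℤ-Ring
import Algebra.Properties.AbelianGroup ℤ.+-0-abelianGroup as ℤ-Group
open import Data.List using (List; []; _∷_; _++_; map; length; concat; filter; deduplicate; upTo; cartesianProduct)
open import Data.List.Extrema ℤ.≤-totalOrder using (argmax; argmax-sel; f[xs]≤f[argmax])
open import Data.List.Membership.Propositional using (_∈_; _∉_)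
open import Data.List.Membership.Propositional.Properties
open import Data.List.Properties using (length-map; length-++; length-upTo; map-∘)
open import Data.List.Relation.Binary.Subset.Propositional using (_⊆_)
open import Data.List.Relation.Unary.All as All using (All; []; _∷_)
open import Data.List.Relation.Unary.All.Properties using (¬Any⇒All¬; All¬⇒¬Any)
open import Data.List.Relation.Unary.AllPairs using ([]; _∷_)
open import Data.List.Relation.Unary.Any using (here; there)
open import Data.List.Relation.Unary.Unique.Propositional using (Unique)
import Data.List.Relation.Unary.Unique.Propositional.Properties as Unique
open import Data.Nat as ℕ using (ℕ; zero; suc; _+_; _*_; _≤_; _<_; z≤n; s≤s)
import Data.Nat.Properties as ℕ
import Data.Nat.Tactic.RingSolver as ℕ-Ring
open import Data.Product using (∃; ∃-syntax; _×_; _,_; proj₁; proj₂; swap)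
open import Data.Product.Properties using (≡-dec)
open import Data.Sum using (_⊎_; inj₁; inj₂)
open import Function using (_∘_)
open import Function.Bundles using (_⇔_; mk⇔; Equivalence)
open import Relation.Binary.Definitions using (DecidableEquality)
open import Relation.Binary.PropositionalEquality
open import Relation.Nullary using (¬_; yes; no; contradiction)

-- Write `σᵢ = pᵢ + qᵢ`. For two nonempty classes the sum of the two neighbour counts yields
-- `σ₀ + σ₁ ≤ c`, but with `4aᵢ ≤ σᵢ²` alone this would still permit one class to absorb almost
-- everything and give only `4|A| ≤ c²`. The count for the larger class alone, together with
-- `a₁ ≤ a₀`, prevents this: if `σ₀` and `σ₁` differ by three or more, then `8|A| + 4 ≤ c²`.
-- Otherwise `8|A| ≤ 2σ₀² + 2σ₁² = (σ₀ + σ₁)² + (σ₀ − σ₁)² ≤ c² + 4`, so the constant 4 is the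
-- square of the largest imbalance. The boxes sit at the two ends of the range that is then rigid:
-- `8|A| = c² + 4` for `B(2n,2n)` and `8|A| = c² − 1` for `B(n,n+1)` with `n ≥ 1`. Neither the size
-- nor the boundary of a box is counted directly. Only strips and zigzags are, and rigidity makes a
-- suitable one of them congruent to the box.

Z² : Set
Z² = ℤ × ℤ

_≟²_ : DecidableEquality Z²
_≟²_ = ≡-dec ℤ._≟_ ℤ._≟_

open import Data.List.Membership.DecPropositional ℤ._≟_ using () renaming (_∈?_ to _∈ℤ?_)
open import Data.List.Membership.DecPropositional _≟²_ using () renaming (_∈?_ to _∈²?_; _∉?_ to _∉²?_)
open import Data.List.Relation.Unary.Unique.DecPropositional.Properties ℤ._≟_ using () renaming (deduplicate-! to deduplicateℤ-!)
open import Data.List.Relation.Unary.Unique.DecPropositional.Properties _≟²_ using () renaming (deduplicate-! to deduplicate²-!)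

-- Counting with duplicate-free lists

module _ {A : Set} where

  remove-∈ : ∀ {x : A} {ys} → x ∈ ys →
    ∃[ zs ] (length ys ≡ suc (length zs) × (∀ {y} → y ∈ ys → y ≢ x → y ∈ zs))
  remove-∈ {ys = _ ∷ ys} (here refl) =
    ys , refl , λ { (here refl) y≢x → contradiction refl y≢x ; (there y∈) _ → y∈ }
  remove-∈ {ys = y₀ ∷ _} (there x∈) with remove-∈ x∈
  ... | zs , len , keep =
    y₀ ∷ zs , cong suc len , λ { (here refl) _ → here refl ; (there y∈) y≢x → there (keep y∈ y≢x) }

  length-mono-⊆ : ∀ {xs ys : List A} → Unique xs → xs ⊆ ys → length xs ≤ length ys
  length-mono-⊆ [] _ = z≤n
  length-mono-⊆ (x∉xs ∷ xs!) xs⊆ys with remove-∈ (xs⊆ys (here refl))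
  ... | zs , len , keep = subst (_ ≤_) (sym len)
    (s≤s (length-mono-⊆ xs! λ y∈ → keep (xs⊆ys (there y∈)) λ { refl → All¬⇒¬Any x∉xs y∈ }))

  ⊆-antisym-length : DecidableEquality A → ∀ {xs ys : List A} →
    Unique xs → xs ⊆ ys → length ys ≤ length xs → ys ⊆ xs
  ⊆-antisym-length _≟_ {xs} xs! xs⊆ys |ys|≤|xs| {y} y∈ys with y ∈? xs
    where open import Data.List.Membership.DecPropositional _≟_ using (_∈?_)
  ... | yes y∈xs = y∈xs
  ... | no y∉xs = contradiction
    (length-mono-⊆ (¬Any⇒All¬ xs y∉xs ∷ xs!) λ { (here refl) → y∈ys ; (there z∈) → xs⊆ys z∈ })
    (ℕ.<⇒≱ (s≤s |ys|≤|xs|))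

  -- Finite choice. Since `map f ys ≡ xs` holds on the nose and not only up to order, both the
  -- length and the uniqueness of `xs` pass to `ys`.
  choose : ∀ {B : Set} (f : B → A) {P : B → Set} {xs} →
    (∀ {x} → x ∈ xs → ∃[ y ] (f y ≡ x × P y)) → ∃[ ys ] (map f ys ≡ xs × All P ys)
  choose f {xs = []} _ = [] , refl , []
  choose f {xs = x ∷ xs} h with h (here refl) | choose f (h ∘ there)
  ... | y , refl , py | ys , refl , pys = y ∷ ys , refl , py ∷ pys


module _ {A : Set} where

  values : (A → ℤ) → List A → List ℤ
  values f xs = deduplicate ℤ._≟_ (map f xs)

  values-! : ∀ (f : A → ℤ) xs → Unique (values f xs)
  values-! f xs = deduplicateℤ-! (map f xs)

  ∈-values⁺ : ∀ (f : A → ℤ) {x xs} → x ∈ xs → f x ∈ values f xs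
  ∈-values⁺ f x∈ = ∈-deduplicate⁺ ℤ._≟_ (∈-map⁺ f x∈)

  ∈-values⁻ : ∀ (f : A → ℤ) {z} xs → z ∈ values f xs → ∃[ x ] (x ∈ xs × z ≡ f x)
  ∈-values⁻ f xs z∈ = ∈-map⁻ f (∈-deduplicate⁻ ℤ._≟_ (map f xs) z∈)

length-cartesianProduct : ∀ {A B : Set} (xs : List A) (ys : List B) →
  length (cartesianProduct xs ys) ≡ length xs * length ys
length-cartesianProduct [] ys = refl
length-cartesianProduct (x ∷ xs) ys = trans (length-++ (map (x ,_) ys))
  (cong₂ _+_ (length-map (x ,_) ys) (length-cartesianProduct xs ys))

fst-values snd-values : List Z² → List ℤ
fst-values = values proj₁
snd-values = values proj₂

length-≤-values : ∀ {S} → Unique S → length S ≤ length (fst-values S) * length (snd-values S)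
length-≤-values {S} S! = ℕ.≤-trans
  (length-mono-⊆ S! λ p∈ → ∈-cartesianProduct⁺ (∈-values⁺ proj₁ p∈) (∈-values⁺ proj₂ p∈))
  (ℕ.≤-reflexive (length-cartesianProduct (fst-values S) (snd-values S)))

-- The equality case of `length-≤-values`: `S` is contained in the product of its projections, and
-- equal size makes it the whole product.
values-full : ∀ {S} → Unique S → length (fst-values S) * length (snd-values S) ≤ length S →
  ∀ {u v} → u ∈ fst-values S → v ∈ snd-values S → (u , v) ∈ S
values-full {S} S! full u∈ v∈ = ⊆-antisym-length _≟²_ S!
  (λ p∈ → ∈-cartesianProduct⁺ (∈-values⁺ proj₁ p∈) (∈-values⁺ proj₂ p∈))
  (subst (_≤ length S) (sym (length-cartesianProduct (fst-values S) (snd-values S))) full)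
  (∈-cartesianProduct⁺ u∈ v∈)

-- Spreading in one coordinate and diagonal neighbourhoods

x<x+1 : ∀ x → x ℤ.< x ℤ.+ 1ℤ
x<x+1 x = subst (ℤ._< x ℤ.+ 1ℤ) (ℤ.+-identityʳ x) (ℤ.+-monoʳ-< x (ℤ.+<+ (s≤s z≤n)))

x-1<x : ∀ x → x ℤ.- 1ℤ ℤ.< x
x-1<x x = subst (x ℤ.- 1ℤ ℤ.<_) (ℤ.+-identityʳ x) (ℤ.+-monoʳ-< x ℤ.-<+)

x-1+1≡x : ∀ x → x ℤ.- 1ℤ ℤ.+ 1ℤ ≡ x
x-1+1≡x = ℤ-Ring.solve-∀

left right : Z² → Z²
left (u , v) = u ℤ.- 1ℤ , v
right (u , v) = u ℤ.+ 1ℤ , v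

-1-injective : ∀ {x y} → x ℤ.- 1ℤ ≡ y ℤ.- 1ℤ → x ≡ y
-1-injective {x} {y} eq = trans (sym (x-1+1≡x x)) (trans (cong (ℤ._+ 1ℤ) eq) (x-1+1≡x y))

left-injective : ∀ {p q} → left p ≡ left q → p ≡ q
left-injective eq = cong₂ _,_ (-1-injective (cong proj₁ eq)) (cong proj₂ eq)

-- Moves the first coordinate only; the second is reached by conjugating with `swap`, as in `nbhd`.
spread : List Z² → List Z²
spread S = deduplicate _≟²_ (map left S ++ map right S)

spread-! : ∀ S → Unique (spread S)
spread-! S = deduplicate²-! (map left S ++ map right S)

left∈spread : ∀ {p S} → p ∈ S → left p ∈ spread S
left∈spread p∈ = ∈-deduplicate⁺ _≟²_ (∈-++⁺ˡ (∈-map⁺ left p∈))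

right∈spread : ∀ {p S} → p ∈ S → right p ∈ spread S
right∈spread {S = S} p∈ = ∈-deduplicate⁺ _≟²_ (∈-++⁺ʳ (map left S) (∈-map⁺ right p∈))

∈-spread⁻ : ∀ {q} S → q ∈ spread S → ∃[ p ] (p ∈ S × (q ≡ left p ⊎ q ≡ right p))
∈-spread⁻ S q∈ with ∈-++⁻ (map left S) (∈-deduplicate⁻ _≟²_ (map left S ++ map right S) q∈)
... | inj₁ q∈ˡ = let p , p∈ , eq = ∈-map⁻ left q∈ˡ in p , p∈ , inj₁ eq
... | inj₂ q∈ʳ = let p , p∈ , eq = ∈-map⁻ right q∈ʳ in p , p∈ , inj₂ eq

greatest : ∀ {A : Set} (f : A → ℤ) {x xs} → x ∈ xs →
  ∃[ y ] (y ∈ xs × (∀ {z} → z ∈ xs → f z ℤ.≤ f y))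
greatest f {x} {xs} x∈ with argmax-sel f x xs
... | inj₁ eq = x , x∈ , λ z∈ → subst (λ t → _ ℤ.≤ f t) eq (All.lookup (f[xs]≤f[argmax] x xs) z∈)
... | inj₂ m∈ = argmax f x xs , m∈ , All.lookup (f[xs]≤f[argmax] x xs)

-- On every line, the point after the last one is new.
length-spread : ∀ {S} → Unique S → length S + length (snd-values S) ≤ length (spread S)
length-spread {S} S! with choose proj₂ {λ e → e ∈ spread S × e ∉ map left S} exit
  where
  exit : ∀ {v} → v ∈ snd-values S → ∃[ e ] (proj₂ e ≡ v × e ∈ spread S × e ∉ map left S)
  exit {v} v∈ with ∈-values⁻ proj₂ S v∈
  ... | p , p∈ , refl with greatest proj₁ (∈-filter⁺ (λ q → proj₂ q ℤ.≟ v) p∈ refl)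
  ... | q , q∈ , q-max with ∈-filter⁻ (λ q → proj₂ q ℤ.≟ v) {xs = S} q∈
  ... | q∈S , refl = right q , refl , right∈spread q∈S , λ r∈ → new (∈-map⁻ left r∈)
    where
    new : ∃[ r ] (r ∈ S × right q ≡ left r) → ⊥
    new (r , r∈ , eq) = ℤ.<⇒≱ (ℤ.<-trans (x<x+1 _) (subst (ℤ._< proj₁ r) (sym (cong proj₁ eq)) (x-1<x _)))
      (q-max (∈-filter⁺ (λ q → proj₂ q ℤ.≟ v) r∈ (sym (cong proj₂ eq))))
... | E , mapE , E-new = begin
  length S + length (snd-values S)            ≡⟨ cong₂ _+_ (sym (length-map left S)) (trans (cong length (sym mapE)) (length-map proj₂ E)) ⟩
  length (map left S) + length E              ≡⟨ length-++ (map left S) ⟨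
  length (map left S ++ E)                      ≤⟨ length-mono-⊆ extended-! sub ⟩
  length (spread S)                             ∎
  where
  open ℕ.≤-Reasoning
  extended-! : Unique (map left S ++ E)
  extended-! = Unique.++⁺ (Unique.map⁺ left-injective S!)
    (Unique.map⁻ (subst Unique (sym mapE) (values-! proj₂ S)))
    λ (x∈ , x∈E) → proj₂ (All.lookup E-new x∈E) x∈
  sub : map left S ++ E ⊆ spread S
  sub x∈ with ∈-++⁻ (map left S) x∈
  ... | inj₁ x∈ˡ = let p , p∈ , eq = ∈-map⁻ left x∈ˡ in subst (_∈ spread S) (sym eq) (left∈spread p∈)
  ... | inj₂ x∈E = proj₁ (All.lookup E-new x∈E)

-- All values shifted by -1 occur in the spread. An `e` with `e − 1` a value is reached from the
-- other side, and it is new because `e + 1` is not a value. Such an `e` exists above the greatest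
-- value and above each gap.
length-fst-spread-++ : ∀ {S E} → Unique E →
  (∀ {e} → e ∈ E → e ℤ.- 1ℤ ∈ fst-values S × e ℤ.+ 1ℤ ∉ fst-values S) →
  length (fst-values S) + length E ≤ length (fst-values (spread S))
length-fst-spread-++ {S} {E} E! E-exit = begin
  length U + length E             ≡⟨ cong (_+ length E) (length-map pred U) ⟨
  length (map pred U) + length E  ≡⟨ length-++ (map pred U) ⟨
  length (map pred U ++ E)          ≤⟨ length-mono-⊆ extended-! sub ⟩
  length (fst-values (spread S))    ∎
  where
  open ℕ.≤-Reasoning
  U = fst-values S
  pred : ℤ → ℤ
  pred u = u ℤ.- 1ℤ
  extended-! : Unique (map pred U ++ E)
  extended-! = Unique.++⁺ (Unique.map⁺ -1-injective (values-! proj₁ S)) E! disjoint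
    where
    disjoint : ∀ {x} → ¬ (x ∈ map pred U × x ∈ E)
    disjoint (x∈ , x∈E) with ∈-map⁻ pred x∈
    ... | u , u∈ , refl = proj₂ (E-exit x∈E) (subst (_∈ U) (sym (x-1+1≡x u)) u∈)
  sub : map pred U ++ E ⊆ fst-values (spread S)
  sub x∈ with ∈-++⁻ (map pred U) x∈
  sub x∈ | inj₁ x∈ˡ with ∈-map⁻ pred x∈ˡ
  ... | u , u∈ , refl with ∈-values⁻ proj₁ S u∈
  ... | p , p∈ , refl = ∈-values⁺ proj₁ (left∈spread p∈)
  sub {x} x∈ | inj₂ x∈E with ∈-values⁻ proj₁ S (proj₁ (E-exit x∈E))
  ... | p , p∈ , eq = subst (_∈ fst-values (spread S)) (trans (cong (ℤ._+ 1ℤ) (sym eq)) (x-1+1≡x x))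
    (∈-values⁺ proj₁ (right∈spread p∈))

x+1-1≡x : ∀ x → x ℤ.+ 1ℤ ℤ.- 1ℤ ≡ x
x+1-1≡x = ℤ-Ring.solve-∀

greatest-exit : ∀ {U x} → x ∈ U →
  ∃[ m ] (m ∈ U × (∀ {z} → z ∈ U → z ℤ.≤ m) × m ℤ.+ 1ℤ ℤ.+ 1ℤ ∉ U)
greatest-exit x∈ with greatest (λ z → z) x∈
... | m , m∈ , max = m , m∈ , max , λ m+2∈ →
  ℤ.<⇒≱ (ℤ.<-trans (x<x+1 m) (x<x+1 (m ℤ.+ 1ℤ))) (max m+2∈)

length-fst-spread : ∀ {p S} → p ∈ S → suc (length (fst-values S)) ≤ length (fst-values (spread S))
length-fst-spread {S = S} p∈ with greatest-exit (∈-values⁺ proj₁ p∈)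
... | m , m∈ , _ , m+2∉ = subst (_≤ length (fst-values (spread S))) (ℕ.+-comm _ 1)
  (length-fst-spread-++ {E = m ℤ.+ 1ℤ ∷ []} ([] ∷ [])
    λ { (here refl) → subst (_∈ fst-values S) (sym (x+1-1≡x m)) m∈ , m+2∉ })

-- The gap after `x` gives a second exit besides the one above the greatest value `m`; the two
-- differ because `x < y ≤ m`.
length-fst-spread-gap : ∀ {S x y} → x ∈ fst-values S → y ∈ fst-values S → x ℤ.< y →
  x ℤ.+ 1ℤ ℤ.+ 1ℤ ∉ fst-values S → 2 + length (fst-values S) ≤ length (fst-values (spread S))
length-fst-spread-gap {S} {x} x∈ y∈ x<y x+2∉ with greatest-exit x∈
... | m , m∈ , max , m+2∉ = subst (_≤ length (fst-values (spread S))) (ℕ.+-comm _ 2)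
  (length-fst-spread-++ {E = x ℤ.+ 1ℤ ∷ m ℤ.+ 1ℤ ∷ []} ((distinct ∷ []) ∷ [] ∷ [])
    λ { (here refl) → subst (_∈ fst-values S) (sym (x+1-1≡x x)) x∈ , x+2∉
      ; (there (here refl)) → subst (_∈ fst-values S) (sym (x+1-1≡x m)) m∈ , m+2∉ })
  where
  distinct : x ℤ.+ 1ℤ ≢ m ℤ.+ 1ℤ
  distinct eq = ℤ.<⇒≢ (ℤ.<-≤-trans x<y (max y∈))
    (trans (sym (x+1-1≡x x)) (trans (cong (ℤ._- 1ℤ) eq) (x+1-1≡x m)))

Step : ℤ → ℤ → Set
Step u u' = u' ≡ u ℤ.- 1ℤ ⊎ u' ≡ u ℤ.+ 1ℤ

Diagonal : Z² → Z² → Set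
Diagonal (u , v) (u' , v') = Step u u' × Step v v'

nbhd : List Z² → List Z²
nbhd S = map swap (spread (map swap (spread S)))

swap-injective : ∀ {p q : Z²} → swap p ≡ swap q → p ≡ q
swap-injective eq = cong swap eq

nbhd-! : ∀ S → Unique (nbhd S)
nbhd-! S = Unique.map⁺ swap-injective (spread-! (map swap (spread S)))

∈-nbhd⁻ : ∀ {q} S → q ∈ nbhd S → ∃[ p ] (p ∈ S × Diagonal p q)
∈-nbhd⁻ S q∈ with ∈-map⁻ swap q∈
... | r , r∈ , refl with ∈-spread⁻ (map swap (spread S)) r∈
... | s , s∈ , r-s with ∈-map⁻ swap s∈
... | t , t∈ , refl with ∈-spread⁻ S t∈
... | p , p∈ , t-p = p , p∈ , steps {p} t-p r-s
  where
  steps : ∀ {p t r} → t ≡ left p ⊎ t ≡ right p → r ≡ left (swap t) ⊎ r ≡ right (swap t) →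
    Diagonal p (swap r)
  steps (inj₁ refl) (inj₁ refl) = inj₁ refl , inj₁ refl
  steps (inj₁ refl) (inj₂ refl) = inj₁ refl , inj₂ refl
  steps (inj₂ refl) (inj₁ refl) = inj₂ refl , inj₁ refl
  steps (inj₂ refl) (inj₂ refl) = inj₂ refl , inj₂ refl

values-map : ∀ {A B : Set} (f : B → ℤ) (g : A → B) xs → values f (map g xs) ≡ values (f ∘ g) xs
values-map f g xs = cong (deduplicate ℤ._≟_) (sym (map-∘ xs))

-- Each spread gains one point per line. The second one acts on `spread S`, so its lines are the
-- first coordinates of `spread S` rather than of `S`; this is the source of the extra `1` in
-- `nbhd-lower-bound` and of the sensitivity to gaps.
length-nbhd : ∀ {S} → Unique S →
  length S + length (snd-values S) + length (fst-values (spread S)) ≤ length (nbhd S)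
length-nbhd {S} S! = begin
  length S + length (snd-values S) + length (fst-values S')  ≤⟨ ℕ.+-monoˡ-≤ _ (length-spread S!) ⟩
  length S' + length (fst-values S')                           ≡⟨ cong₂ _+_ (length-map swap S') (cong length (values-map proj₂ swap S')) ⟨
  length (map swap S') + length (snd-values (map swap S'))     ≤⟨ length-spread (Unique.map⁺ swap-injective (spread-! S)) ⟩
  length (spread (map swap S'))                                  ≡⟨ length-map swap (spread (map swap S')) ⟨
  length (nbhd S)                                                ∎
  where
  open ℕ.≤-Reasoning
  S' = spread S

DiagonalClosed : List Z² → List Z² → Set
DiagonalClosed S T = ∀ {p q} → p ∈ S → Diagonal p q → q ∈ T

nbhd⊆ : ∀ {S T} → DiagonalClosed S T → nbhd S ⊆ T
nbhd⊆ {S} closed q∈ = let p , p∈ , p-q = ∈-nbhd⁻ S q∈ in closed p∈ p-q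

nbhd-lower-bound : ∀ {S p} → Unique S → p ∈ S →
  length S + (length (fst-values S) + length (snd-values S)) + 1 ≤ length (nbhd S)
nbhd-lower-bound {S} S! p∈ = begin
  length S + (length (fst-values S) + length (snd-values S)) + 1  ≡⟨ reorder (length S) _ (length (snd-values S)) ⟩
  length S + length (snd-values S) + suc (length (fst-values S))    ≤⟨ ℕ.+-monoʳ-≤ _ (length-fst-spread p∈) ⟩
  length S + length (snd-values S) + length (fst-values (spread S)) ≤⟨ length-nbhd S! ⟩
  length (nbhd S)                                                       ∎
  where
  open ℕ.≤-Reasoning
  reorder : ∀ a p q → a + (p + q) + 1 ≡ a + q + suc p
  reorder = ℕ-Ring.solve-∀

-- The step is two because the values of one parity class all have the same parity.
Gapless : List ℤ → Set
Gapless U = ∀ {x y} → x ∈ U → y ∈ U → x ℤ.< y → x ℤ.+ 1ℤ ℤ.+ 1ℤ ∈ U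

-- The inequality opposite to `nbhd-lower-bound`, for a `T` that contains the neighbourhood of `S`:
-- it leaves no room for gaps or for points of `T` outside `nbhd S`.
Tight : List Z² → List Z² → Set
Tight S T = length T ≤ length S + (length (fst-values S) + length (snd-values S)) + 1

tight-fst-gapless : ∀ {S T} → Unique S → DiagonalClosed S T → Tight S T → Gapless (fst-values S)
tight-fst-gapless {S} {T} S! closed tight {x} x∈ y∈ x<y with (x ℤ.+ 1ℤ ℤ.+ 1ℤ) ∈ℤ? fst-values S
... | yes x+2∈ = x+2∈
... | no x+2∉ = contradiction tight (ℕ.<⇒≱ (begin-strict
  length S + (length (fst-values S) + length (snd-values S)) + 1     <⟨ ℕ.n<1+n _ ⟩
  suc (length S + (length (fst-values S) + length (snd-values S)) + 1) ≡⟨ reorder (length S) _ (length (snd-values S)) ⟩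
  length S + length (snd-values S) + (2 + length (fst-values S))     ≤⟨ ℕ.+-monoʳ-≤ _ (length-fst-spread-gap x∈ y∈ x<y x+2∉) ⟩
  length S + length (snd-values S) + length (fst-values (spread S))    ≤⟨ length-nbhd S! ⟩
  length (nbhd S)                                                          ≤⟨ length-mono-⊆ (nbhd-! S) (nbhd⊆ closed) ⟩
  length T                                                                 ∎))
  where
  open ℕ.≤-Reasoning
  reorder : ∀ a p q → suc (a + (p + q) + 1) ≡ a + q + (2 + p)
  reorder = ℕ-Ring.solve-∀

-- The count in `length-nbhd` treats the two coordinates unequally, but `DiagonalClosed` and `Tight`
-- are symmetric, so the swapped sets satisfy the same hypotheses.
tight-snd-gapless : ∀ {S T} → Unique S → DiagonalClosed S T → Tight S T → Gapless (snd-values S)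
tight-snd-gapless {S} {T} S! closed tight =
  subst Gapless (values-map proj₁ swap S)
    (tight-fst-gapless {map swap S} {map swap T} (Unique.map⁺ swap-injective S!) closed' tight')
  where
  closed' : DiagonalClosed (map swap S) (map swap T)
  closed' p∈ (su , sv) with ∈-map⁻ swap p∈
  ... | p , p∈S , refl = ∈-map⁺ swap (closed p∈S (sv , su))
  tight' : Tight (map swap S) (map swap T)
  tight' rewrite length-map swap S | length-map swap T | values-map proj₁ swap S | values-map proj₂ swap S
    | ℕ.+-comm (length (snd-values S)) (length (fst-values S)) = tight

-- Lower bound and tightness together force `T` to be `nbhd S`. With `S` one class and `T`
-- containing the other, every point of the other class gets a neighbour in `S`.
tight-near : ∀ {S T r} → Unique S → r ∈ S → DiagonalClosed S T → Tight S T →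
  ∀ {q} → q ∈ T → ∃[ p ] (p ∈ S × Diagonal p q)
tight-near {S} S! r∈ closed tight q∈ = ∈-nbhd⁻ S
  (⊆-antisym-length _≟²_ (nbhd-! S) (nbhd⊆ closed) (ℕ.≤-trans tight (nbhd-lower-bound S! r∈)) q∈)

-- Parity and intervals of integers

-- The half `h` is kept because `Box-corner` builds its translation from it.
data Parity (z : ℤ) : Bool → Set where
  even : ∀ h → z ≡ h ℤ.+ h → Parity z true
  odd  : ∀ h → z ≡ h ℤ.+ h ℤ.+ 1ℤ → Parity z false

parity-suc : ∀ {z e} → Parity z e → Parity (z ℤ.+ 1ℤ) (not e)
parity-suc (even h refl) = odd h refl
parity-suc (odd h refl) = even (h ℤ.+ 1ℤ) (eq h)
  where
  eq : ∀ h → h ℤ.+ h ℤ.+ 1ℤ ℤ.+ 1ℤ ≡ h ℤ.+ 1ℤ ℤ.+ (h ℤ.+ 1ℤ)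
  eq = ℤ-Ring.solve-∀

parity-pred : ∀ {z e} → Parity z e → Parity (z ℤ.- 1ℤ) (not e)
parity-pred (even h refl) = odd (h ℤ.- 1ℤ) (eq h)
  where
  eq : ∀ h → h ℤ.+ h ℤ.- 1ℤ ≡ h ℤ.- 1ℤ ℤ.+ (h ℤ.- 1ℤ) ℤ.+ 1ℤ
  eq = ℤ-Ring.solve-∀
parity-pred (odd h refl) = even h (x+1-1≡x (h ℤ.+ h))

parity-neg : ∀ {z e} → Parity z e → Parity (ℤ.- z) e
parity-neg (even h refl) = even (ℤ.- h) (eq h)
  where
  eq : ∀ h → ℤ.- (h ℤ.+ h) ≡ ℤ.- h ℤ.+ ℤ.- h
  eq = ℤ-Ring.solve-∀
parity-neg (odd h refl) = odd (ℤ.- h ℤ.- 1ℤ) (eq h)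
  where
  eq : ∀ h → ℤ.- (h ℤ.+ h ℤ.+ 1ℤ) ≡ ℤ.- h ℤ.- 1ℤ ℤ.+ (ℤ.- h ℤ.- 1ℤ) ℤ.+ 1ℤ
  eq = ℤ-Ring.solve-∀

parity-+double : ∀ {z e} x → Parity z e → Parity (z ℤ.+ (x ℤ.+ x)) e
parity-+double x (even h refl) = even (h ℤ.+ x) (eq h x)
  where
  eq : ∀ h x → h ℤ.+ h ℤ.+ (x ℤ.+ x) ≡ h ℤ.+ x ℤ.+ (h ℤ.+ x)
  eq = ℤ-Ring.solve-∀
parity-+double x (odd h refl) = odd (h ℤ.+ x) (eq h x)
  where
  eq : ∀ h x → h ℤ.+ h ℤ.+ 1ℤ ℤ.+ (x ℤ.+ x) ≡ h ℤ.+ x ℤ.+ (h ℤ.+ x) ℤ.+ 1ℤ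
  eq = ℤ-Ring.solve-∀

parityℕ : ∀ n → ∃ (Parity (+ n))
parityℕ zero = true , even (+ 0) refl
parityℕ (suc n) = let e , pn = parityℕ n in
  not e , subst (λ z → Parity z (not e)) (cong +_ (ℕ.+-comm n 1)) (parity-suc pn)

parity? : ∀ z → ∃ (Parity z)
parity? (+ n) = parityℕ n
parity? -[1+ n ] = let e , pn = parityℕ (suc n) in e , parity-neg pn

double≢1 : ∀ h → h ℤ.+ h ≢ 1ℤ
double≢1 (+ zero) ()
double≢1 (+ suc n) eq with trans (sym (ℕ.+-suc n n)) (ℕ.suc-injective (ℤ.+-injective eq))
... | ()
double≢1 -[1+ n ] ()

even≢odd : ∀ {h k} → h ℤ.+ h ≢ k ℤ.+ k ℤ.+ 1ℤ
even≢odd {h} {k} eq = double≢1 (h ℤ.- k) (trans (e₁ h k) (trans (cong (ℤ._- (k ℤ.+ k)) eq) (e₂ k)))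
  where
  e₁ : ∀ h k → h ℤ.- k ℤ.+ (h ℤ.- k) ≡ h ℤ.+ h ℤ.- (k ℤ.+ k)
  e₁ = ℤ-Ring.solve-∀
  e₂ : ∀ k → k ℤ.+ k ℤ.+ 1ℤ ℤ.- (k ℤ.+ k) ≡ 1ℤ
  e₂ = ℤ-Ring.solve-∀

parity-unique : ∀ {z e e'} → Parity z e → Parity z e' → e ≡ e'
parity-unique (even _ _) (even _ _) = refl
parity-unique (odd _ _) (odd _ _) = refl
parity-unique (even h eq) (odd k eq') = contradiction (trans (sym eq) eq') (even≢odd {h} {k})
parity-unique (odd k eq') (even h eq) = contradiction (trans (sym eq) eq') (even≢odd {h} {k})

par : ℤ → Bool
par z = proj₁ (parity? z)

par-parity : ∀ z → Parity z (par z)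
par-parity z = proj₂ (parity? z)

par-suc : ∀ z → par (z ℤ.+ 1ℤ) ≡ not (par z)
par-suc z = parity-unique (par-parity (z ℤ.+ 1ℤ)) (parity-suc (par-parity z))

par-pred : ∀ z → par (z ℤ.- 1ℤ) ≡ not (par z)
par-pred z = parity-unique (par-parity (z ℤ.- 1ℤ)) (parity-pred (par-parity z))

par-+double : ∀ z x → par (z ℤ.+ (x ℤ.+ x)) ≡ par z
par-+double z x = parity-unique (par-parity (z ℤ.+ (x ℤ.+ x))) (parity-+double x (par-parity z))

par-neg : ∀ z → par (ℤ.- z) ≡ par z
par-neg z = parity-unique (par-parity (ℤ.- z)) (parity-neg (par-parity z))

+-≤ : ∀ {x y} → x ℤ.≤ y → ∃[ i ] y ≡ x ℤ.+ + i
+-≤ {x} {y} x≤y with y ℤ.- x in eq | ℤ.i≤j⇒0≤j-i x≤y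
... | + i | _ = i , trans (e x y) (cong (λ t → x ℤ.+ t) eq)
  where
  e : ∀ x y → y ≡ x ℤ.+ (y ℤ.- x)
  e = ℤ-Ring.solve-∀

Interval : ℤ → ℕ → ℤ → Set
Interval m w z = m ℤ.≤ z × z ℤ.≤ m ℤ.+ + w

smallest : ∀ {U x} → x ∈ U → ∃[ y ] (y ∈ U × (∀ {z} → z ∈ U → y ℤ.≤ z))
smallest x∈ with greatest ℤ.-_ x∈
... | y , y∈ , max = y , y∈ , λ z∈ → ℤ.neg-cancel-≤ (max z∈)

<⇒+1≤ : ∀ {x y} → x ℤ.< y → x ℤ.+ 1ℤ ℤ.≤ y
<⇒+1≤ {x} {y} x<y = subst (ℤ._≤ y) (ℤ.+-comm 1ℤ x) (ℤ.i<j⇒suc[i]≤j x<y)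

-- Steps of one lead from the smallest element to the greatest without leaving `W`. Comparison with
-- the explicit list from `m` to `m + w` gives the length, which later ties the side of a box to the
-- number of values.
interval : ∀ {W x} → Unique W → x ∈ W →
  (∀ {x y} → x ∈ W → y ∈ W → x ℤ.< y → x ℤ.+ 1ℤ ∈ W) →
  ∃[ m ] ∃[ w ] (length W ≡ suc w × m ∈ W × (∀ z → z ∈ W ⇔ Interval m w z))
interval {W} W! x∈ step with smallest x∈ | greatest (λ z → z) x∈
... | m , m∈ , min | M , M∈ , max with +-≤ (min M∈)
... | w , refl = m , w , |W| , m∈ , λ z → mk⇔ (λ z∈ → min z∈ , max z∈) (λ (m≤z , z≤M) → fill m≤z z≤M)
  where
  chain : ∀ i → m ℤ.+ + i ℤ.≤ m ℤ.+ + w → m ℤ.+ + i ∈ W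
  chain zero _ = subst (_∈ W) (sym (ℤ.+-identityʳ m)) m∈
  chain (suc i) le = subst (_∈ W) eq (step (chain i (ℤ.<⇒≤ lt)) M∈ lt)
    where
    eq : m ℤ.+ + i ℤ.+ 1ℤ ≡ m ℤ.+ + suc i
    eq = trans (ℤ.+-assoc m (+ i) 1ℤ) (cong (λ k → m ℤ.+ + k) (ℕ.+-comm i 1))
    lt : m ℤ.+ + i ℤ.< m ℤ.+ + w
    lt = ℤ.<-≤-trans (ℤ.+-monoʳ-< m (ℤ.+<+ (ℕ.n<1+n i))) le
  fill : ∀ {z} → m ℤ.≤ z → z ℤ.≤ m ℤ.+ + w → z ∈ W
  fill m≤z z≤M with +-≤ m≤z
  ... | i , refl = chain i z≤M
  L : List ℤ
  L = map (λ i → m ℤ.+ + i) (upTo (suc w))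
  |L| : length L ≡ suc w
  |L| = trans (length-map _ (upTo (suc w))) (length-upTo (suc w))
  L! : Unique L
  L! = Unique.map⁺ (λ {i} {j} eq → ℤ.+-injective (ℤ-Group.∙-cancelˡ m (+ i) (+ j) eq)) (Unique.upTo⁺ (suc w))
  L⊆W : L ⊆ W
  L⊆W z∈ with ∈-map⁻ _ z∈
  ... | i , i∈ , refl = chain i (ℤ.+-monoʳ-≤ m (ℤ.+≤+ (ℕ.≤-pred (∈-upTo⁻ i∈))))
  W⊆L : W ⊆ L
  W⊆L z∈ with +-≤ (min z∈) | max z∈
  ... | i , refl | le = ∈-map⁺ _ (∈-upTo⁺ (s≤s (ℕ.≮⇒≥ λ w<i → ℤ.<⇒≱ (ℤ.+-monoʳ-< m (ℤ.+<+ w<i)) le)))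
  |W| : length W ≡ suc w
  |W| = trans (ℕ.≤-antisym (length-mono-⊆ W! W⊆L) (length-mono-⊆ L! L⊆W)) |L|

-- Arithmetic of the isoperimetric inequality

-- d = |x − y|, without truncated subtraction
Diff : ℕ → ℕ → ℕ → Set
Diff x y d = x ≡ y + d ⊎ y ≡ x + d

diff : ∀ x y → ∃ (Diff x y)
diff x y with ℕ.≤-total x y
... | inj₁ x≤y = let d , eq = ℕ.m≤n⇒∃[o]m+o≡n x≤y in d , inj₂ (sym eq)
... | inj₂ y≤x = let d , eq = ℕ.m≤n⇒∃[o]m+o≡n y≤x in d , inj₁ (sym eq)

diff-product : ∀ {x y d} → Diff x y d → (x + y) * (x + y) ≡ 4 * (x * y) + d * d
diff-product {y = y} {d} (inj₁ refl) = eq y d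
  where
  eq : ∀ y d → (y + d + y) * (y + d + y) ≡ 4 * ((y + d) * y) + d * d
  eq = ℕ-Ring.solve-∀
diff-product {x} {d = d} (inj₂ refl) = eq x d
  where
  eq : ∀ x d → (x + (x + d)) * (x + (x + d)) ≡ 4 * (x * (x + d)) + d * d
  eq = ℕ-Ring.solve-∀

diff-squares : ∀ {x y d} → Diff x y d → (x + y) * (x + y) + d * d ≡ 2 * (x * x) + 2 * (y * y)
diff-squares {y = y} {d} (inj₁ refl) = eq y d
  where
  eq : ∀ y d → (y + d + y) * (y + d + y) + d * d ≡ 2 * ((y + d) * (y + d)) + 2 * (y * y)
  eq = ℕ-Ring.solve-∀
diff-squares {x} {d = d} (inj₂ refl) = eq x d
  where
  eq : ∀ x d → (x + (x + d)) * (x + (x + d)) + d * d ≡ 2 * (x * x) + 2 * ((x + d) * (x + d))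
  eq = ℕ-Ring.solve-∀

-- The inequality of arithmetic and geometric means, with `d²` as the defect.
product-bound : ∀ {a} p q → a ≤ p * q → 4 * a ≤ (p + q) * (p + q)
product-bound {a} p q a≤pq = begin
  4 * a                           ≤⟨ ℕ.*-monoʳ-≤ 4 a≤pq ⟩
  4 * (p * q)                     ≤⟨ ℕ.m≤m+n _ _ ⟩
  4 * (p * q) + d * d             ≡⟨ diff-product p-q ⟨
  (p + q) * (p + q)               ∎
  where
  open ℕ.≤-Reasoning
  d = proj₁ (diff p q)
  p-q = proj₂ (diff p q)

square-mono : ∀ {m n} → m ≤ n → m * m ≤ n * n
square-mono m≤n = ℕ.*-mono-≤ m≤n m≤n

module _ {σ₀ σ₁ a₀ a₁ c : ℕ} (4a₀≤ : 4 * a₀ ≤ σ₀ * σ₀) (4a₁≤ : 4 * a₁ ≤ σ₁ * σ₁)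
  (σ≤c : σ₀ + σ₁ ≤ c) where

  -- Let the sums differ by at least three. If `σ₁` is the larger one, then `a₁ ≤ a₀ ≤ σ₀² / 4`
  -- while `c ≥ 2σ₀ + 3`. If `σ₀` is the larger one, the first hypothesis gives
  -- `a₀ ≤ a₁ + σ₁ + e + 1` with `e = c − σ₀ − σ₁`, and `a₁ ≤ σ₁² / 4` finishes. Here `1 ≤ σ₁`
  -- matters: `σ₀ = c = 3`, `a₀ = 1`, `σ₁ = a₁ = 0` is a counterexample without it.
  balanced-or-small : a₀ + σ₀ ≤ a₁ + c + 1 → a₁ ≤ a₀ → 1 ≤ σ₁ →
    8 * (a₀ + a₁) + 4 ≤ c * c ⊎ ∃[ δ ] (δ ≤ 2 × Diff σ₀ σ₁ δ)
  balanced-or-small a₀+σ₀≤ a₁≤a₀ 1≤σ₁ with diff σ₀ σ₁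
  ... | δ , σ₀-σ₁ with δ ℕ.≤? 2
  ... | yes δ≤2 = inj₂ (δ , δ≤2 , σ₀-σ₁)
  ... | no δ≰2 with ℕ.m≤n⇒∃[o]m+o≡n (ℕ.≰⇒> δ≰2) | ℕ.m≤n⇒∃[o]m+o≡n σ≤c
  balanced-or-small a₀+σ₀≤ a₁≤a₀ 1≤σ₁ | δ , inj₂ refl | no _ | f , refl | e , refl = inj₁ (begin
    8 * (a₀ + a₁) + 4     ≤⟨ ℕ.+-monoˡ-≤ 4 (ℕ.*-monoʳ-≤ 8 (ℕ.+-monoʳ-≤ a₀ a₁≤a₀)) ⟩
    8 * (a₀ + a₀) + 4     ≡⟨ e₁ a₀ ⟩
    4 * (4 * a₀) + 4      ≤⟨ ℕ.+-monoˡ-≤ 4 (ℕ.*-monoʳ-≤ 4 4a₀≤) ⟩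
    4 * (σ₀ * σ₀) + 4     ≤⟨ ℕ.m≤m+n _ _ ⟩
    4 * (σ₀ * σ₀) + 4 + (4 * σ₀ * (3 + (f + e)) + 5 + 6 * (f + e) + (f + e) * (f + e)) ≡⟨ e₂ σ₀ f e ⟩
    (σ₀ + (σ₀ + (3 + f)) + e) * (σ₀ + (σ₀ + (3 + f)) + e) ∎)
    where
    open ℕ.≤-Reasoning
    e₁ : ∀ a → 8 * (a + a) + 4 ≡ 4 * (4 * a) + 4
    e₁ = ℕ-Ring.solve-∀
    e₂ : ∀ s f e → 4 * (s * s) + 4 + (4 * s * (3 + (f + e)) + 5 + 6 * (f + e) + (f + e) * (f + e))
      ≡ (s + (s + (3 + f)) + e) * (s + (s + (3 + f)) + e)
    e₂ = ℕ-Ring.solve-∀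
  balanced-or-small a₀+σ₀≤ a₁≤a₀ 1≤σ₁ | δ , inj₁ refl | no _ | f , refl | e , refl
    with ℕ.m≤n⇒∃[o]m+o≡n 1≤σ₁
  ... | s , refl = inj₁ (begin
    8 * (a₀ + a₁) + 4                             ≤⟨ ℕ.+-monoˡ-≤ 4 (ℕ.*-monoʳ-≤ 8 (ℕ.+-monoˡ-≤ a₁ a₀≤)) ⟩
    8 * (a₁ + (1 + s) + e + 1 + a₁) + 4           ≡⟨ e₁ a₁ s e ⟩
    4 * (4 * a₁) + (8 * s + 8 * e + 20)           ≤⟨ ℕ.+-monoˡ-≤ _ (ℕ.*-monoʳ-≤ 4 4a₁≤) ⟩
    4 * ((1 + s) * (1 + s)) + (8 * s + 8 * e + 20) ≤⟨ ℕ.m≤m+n _ _ ⟩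
    4 * ((1 + s) * (1 + s)) + (8 * s + 8 * e + 20)
      + (4 * s + 1 + 2 * e + 10 * f + 4 * s * (f + e) + (f + e) * (f + e)) ≡⟨ e₂ s f e ⟩
    (1 + s + (3 + f) + (1 + s) + e) * (1 + s + (3 + f) + (1 + s) + e) ∎)
    where
    open ℕ.≤-Reasoning
    e₁ : ∀ a s e → 8 * (a + (1 + s) + e + 1 + a) + 4 ≡ 4 * (4 * a) + (8 * s + 8 * e + 20)
    e₁ = ℕ-Ring.solve-∀
    e₂ : ∀ s f e → 4 * ((1 + s) * (1 + s)) + (8 * s + 8 * e + 20)
      + (4 * s + 1 + 2 * e + 10 * f + 4 * s * (f + e) + (f + e) * (f + e))
      ≡ (1 + s + (3 + f) + (1 + s) + e) * (1 + s + (3 + f) + (1 + s) + e)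
    e₂ = ℕ-Ring.solve-∀
    e₃ : ∀ a s f e → a + ((1 + s) + (3 + f) + (1 + s) + e) + 1 ≡ a + (1 + s) + e + 1 + ((1 + s) + (3 + f))
    e₃ = ℕ-Ring.solve-∀
    a₀≤ : a₀ ≤ a₁ + (1 + s) + e + 1
    a₀≤ = ℕ.+-cancelʳ-≤ ((1 + s) + (3 + f)) a₀ _ (ℕ.≤-trans a₀+σ₀≤ (ℕ.≤-reflexive (e₃ a₁ s f e)))

  two-class-bound : a₀ + σ₀ ≤ a₁ + c + 1 → a₁ ≤ a₀ → 1 ≤ σ₁ → 8 * (a₀ + a₁) ≤ c * c + 4
  two-class-bound h₁ h₂ h₃ with balanced-or-small h₁ h₂ h₃
  ... | inj₁ small = ℕ.≤-trans (ℕ.m≤m+n _ 4) (ℕ.≤-trans small (ℕ.m≤m+n _ 4))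
  ... | inj₂ (δ , δ≤2 , σ₀-σ₁) = begin
    8 * (a₀ + a₁)                           ≡⟨ e a₀ a₁ ⟩
    2 * (4 * a₀) + 2 * (4 * a₁)             ≤⟨ ℕ.+-mono-≤ (ℕ.*-monoʳ-≤ 2 4a₀≤) (ℕ.*-monoʳ-≤ 2 4a₁≤) ⟩
    2 * (σ₀ * σ₀) + 2 * (σ₁ * σ₁)           ≡⟨ diff-squares σ₀-σ₁ ⟨
    (σ₀ + σ₁) * (σ₀ + σ₁) + δ * δ           ≤⟨ ℕ.+-mono-≤ (square-mono σ≤c) (square-mono δ≤2) ⟩
    c * c + 4                               ∎
    where
    open ℕ.≤-Reasoning
    e : ∀ a b → 8 * (a + b) ≡ 2 * (4 * a) + 2 * (4 * b)
    e = ℕ-Ring.solve-∀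

-- With an empty class only one count is available, but it makes `c` grow linearly in `n`: for
-- `n ≥ 3` the hypothesis `12 ≤ σ²` forces `σ ≥ 4`, hence `c ≥ n + 3`. The sharper second bound
-- fails for `n = 1` with `c = 2` and for `n = 2` with `c = 4`.
one-class-bound : ∀ {n σ c} → 1 ≤ n → 4 * n ≤ σ * σ → n + σ ≤ c + 1 →
  8 * n ≤ c * c + 4 × (3 ≤ n → 8 * n + 2 ≤ c * c)
one-class-bound {suc zero} {zero} _ () _
one-class-bound {suc zero} {suc zero} _ (s≤s ()) _
one-class-bound {suc zero} {suc (suc σ)} {c} _ _ h =
  ℕ.+-monoˡ-≤ 4 (square-mono {2} (ℕ.≤-trans (s≤s (s≤s z≤n)) 2+σ≤c)) , λ { (s≤s ()) }
  where
  2+σ≤c : 2 + σ ≤ c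
  2+σ≤c = ℕ.+-cancelʳ-≤ 1 _ c (ℕ.≤-trans (ℕ.≤-reflexive (ℕ.+-comm _ 1)) h)
one-class-bound {suc (suc zero)} {zero} _ () _
one-class-bound {suc (suc zero)} {suc zero} _ (s≤s ()) _
one-class-bound {suc (suc zero)} {suc (suc zero)} _ (s≤s (s≤s (s≤s (s≤s ())))) _
one-class-bound {suc (suc zero)} {suc (suc (suc σ))} {c} _ _ h =
  ℕ.≤-trans (square-mono {4} (ℕ.≤-trans (ℕ.m≤m+n 4 σ) 4+σ≤c)) (ℕ.m≤m+n _ 4) , λ { (s≤s (s≤s ())) }
  where
  4+σ≤c : 4 + σ ≤ c
  4+σ≤c = ℕ.+-cancelʳ-≤ 1 _ c (ℕ.≤-trans (ℕ.≤-reflexive (ℕ.+-comm _ 1)) h)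
one-class-bound {suc (suc (suc k))} {σ} {c} _ 4n≤ h =
  ℕ.≤-trans (ℕ.m≤m+n _ 2) (ℕ.≤-trans main (ℕ.m≤m+n _ 4)) , λ _ → main
  where
  4≤σ : 4 ≤ σ
  4≤σ = ℕ.≮⇒≥ λ σ<4 → ℕ.<⇒≱ (ℕ.≤-trans (s≤s (square-mono (ℕ.≤-pred σ<4))) (s≤s (s≤s (s≤s (s≤s (s≤s (s≤s (s≤s (s≤s (s≤s (s≤s z≤n)))))))))))
    (ℕ.≤-trans (ℕ.*-monoʳ-≤ 4 (s≤s (s≤s (s≤s (z≤n {k}))))) 4n≤)
  6+k≤c : 6 + k ≤ c
  6+k≤c = ℕ.+-cancelʳ-≤ 1 _ c (begin
    6 + k + 1     ≡⟨ e k ⟩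
    3 + k + 4     ≤⟨ ℕ.+-monoʳ-≤ (3 + k) 4≤σ ⟩
    3 + k + σ     ≤⟨ h ⟩
    c + 1         ∎)
    where
    open ℕ.≤-Reasoning
    e : ∀ k → 6 + k + 1 ≡ 3 + k + 4
    e = ℕ-Ring.solve-∀
  main : 8 * (3 + k) + 2 ≤ c * c
  main = begin
    8 * (3 + k) + 2                            ≤⟨ ℕ.m≤m+n _ _ ⟩
    8 * (3 + k) + 2 + (10 + 4 * k + k * k)     ≡⟨ e k ⟩
    (6 + k) * (6 + k)                          ≤⟨ square-mono 6+k≤c ⟩
    c * c                                      ∎
    where
    open ℕ.≤-Reasoning
    e : ∀ k → 8 * (3 + k) + 2 + (10 + 4 * k + k * k) ≡ (6 + k) * (6 + k)
    e = ℕ-Ring.solve-∀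

-- All slack is gone except three imbalances: `δ` between the two classes and `d₀`, `d₁` between the
-- two sides of each. The field `square` ties them to the size.
record Extremal (p₀ q₀ p₁ q₁ a₀ a₁ c : ℕ) : Set where
  field
    {δ d₀ d₁} : ℕ
    sum   : (p₀ + q₀) + (p₁ + q₁) ≡ c
    full₀ : p₀ * q₀ ≡ a₀
    full₁ : p₁ * q₁ ≡ a₁
    δ≤2   : δ ≤ 2
    diffσ : Diff (p₀ + q₀) (p₁ + q₁) δ
    diff₀ : Diff p₀ q₀ d₀
    diff₁ : Diff p₁ q₁ d₁
    d₀≤1  : d₀ ≤ 1
    d₁≤1  : d₁ ≤ 1
    square : c * c + δ * δ ≡ 8 * (a₀ + a₁) + 2 * (d₀ * d₀ + d₁ * d₁)

2d²≤5⇒d≤1 : ∀ {d} → 2 * (d * d) ≤ 5 → d ≤ 1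
2d²≤5⇒d≤1 {d} h = ℕ.≮⇒≥ λ 2≤d →
  ℕ.<⇒≱ (s≤s (s≤s (s≤s (s≤s (s≤s (s≤s z≤n)))))) (ℕ.≤-trans (ℕ.*-monoʳ-≤ 2 (square-mono 2≤d)) h)

8ε≤5⇒ε≡0 : ∀ {ε} → 8 * ε ≤ 5 → ε ≡ 0
8ε≤5⇒ε≡0 {zero} _ = refl
8ε≤5⇒ε≡0 {suc ε} h = contradiction (ℕ.≤-trans (ℕ.*-monoʳ-≤ 8 (s≤s (z≤n {ε}))) h) λ { (s≤s (s≤s (s≤s (s≤s (s≤s ()))))) }

-- With `s = σ₀ + σ₁`, `c = s + e` and `εᵢ = pᵢqᵢ − aᵢ`, the balance is exactly `s² + δ² = 8n + X`,
-- where `X` collects `8εᵢ` and `2dᵢ²`. Hence `c² ≤ 8n + 1` leaves a total excess `e(2s + e) + X` of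
-- at most `δ² + 1 ≤ 5`, too little for any `εᵢ ≥ 1` or `dᵢ ≥ 2`.
extremal : ∀ {p₀ q₀ p₁ q₁ a₀ a₁ c} → a₀ ≤ p₀ * q₀ → a₁ ≤ p₁ * q₁ → (p₀ + q₀) + (p₁ + q₁) ≤ c →
  a₀ + (p₀ + q₀) ≤ a₁ + c + 1 → a₁ ≤ a₀ → 1 ≤ p₁ + q₁ →
  5 ≤ c → c * c ≤ 8 * (a₀ + a₁) + 1 → Extremal p₀ q₀ p₁ q₁ a₀ a₁ c
extremal {p₀} {q₀} {p₁} {q₁} {a₀} {a₁} {c} a₀≤ a₁≤ s≤c h₁ h₂ h₃ 5≤c c²≤
  with balanced-or-small (product-bound p₀ q₀ a₀≤) (product-bound p₁ q₁ a₁≤) s≤c h₁ h₂ h₃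
... | inj₁ small = contradiction (ℕ.+-cancelˡ-≤ (8 * (a₀ + a₁)) 4 1 (ℕ.≤-trans small c²≤)) λ { (s≤s ()) }
... | inj₂ (δ , δ≤2 , σ₀-σ₁)
  with ℕ.m≤n⇒∃[o]m+o≡n a₀≤ | ℕ.m≤n⇒∃[o]m+o≡n a₁≤ | ℕ.m≤n⇒∃[o]m+o≡n s≤c | diff p₀ q₀ | diff p₁ q₁
... | ε₀ , pq₀ | ε₁ , pq₁ | e , refl | d₀ , p₀-q₀ | d₁ , p₁-q₁ = result e refl
  where
  s = (p₀ + q₀) + (p₁ + q₁)
  n = a₀ + a₁
  X = 8 * ε₀ + 8 * ε₁ + (2 * (d₀ * d₀) + 2 * (d₁ * d₁))
  open ℕ.≤-Reasoning
  squares : s * s + δ * δ ≡ 8 * n + X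
  squares = begin-equality
    s * s + δ * δ                                                        ≡⟨ diff-squares σ₀-σ₁ ⟩
    2 * ((p₀ + q₀) * (p₀ + q₀)) + 2 * ((p₁ + q₁) * (p₁ + q₁))            ≡⟨ cong₂ (λ x y → 2 * x + 2 * y) (diff-product p₀-q₀) (diff-product p₁-q₁) ⟩
    2 * (4 * (p₀ * q₀) + d₀ * d₀) + 2 * (4 * (p₁ * q₁) + d₁ * d₁)        ≡⟨ cong₂ (λ x y → 2 * (4 * x + d₀ * d₀) + 2 * (4 * y + d₁ * d₁)) pq₀ pq₁ ⟨
    2 * (4 * (a₀ + ε₀) + d₀ * d₀) + 2 * (4 * (a₁ + ε₁) + d₁ * d₁)        ≡⟨ eq a₀ ε₀ (d₀ * d₀) a₁ ε₁ (d₁ * d₁) ⟩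
    8 * n + X                                                            ∎
    where
    eq : ∀ a ε d a' ε' d' → 2 * (4 * (a + ε) + d) + 2 * (4 * (a' + ε') + d')
      ≡ 8 * (a + a') + (8 * ε + 8 * ε' + (2 * d + 2 * d'))
    eq = ℕ-Ring.solve-∀
  excess : e * (s + (s + e)) + X ≤ 5
  excess = ℕ.+-cancelˡ-≤ (s * s) _ _ (begin
    s * s + (e * (s + (s + e)) + X)     ≡⟨ e₁ s e X ⟩
    (s + e) * (s + e) + X               ≤⟨ ℕ.+-monoˡ-≤ X c²≤ ⟩
    8 * n + 1 + X                       ≡⟨ e₂ (8 * n) X ⟩
    8 * n + X + 1                       ≡⟨ cong (_+ 1) squares ⟨
    s * s + δ * δ + 1                   ≤⟨ ℕ.+-monoˡ-≤ 1 (ℕ.+-monoʳ-≤ (s * s) (square-mono δ≤2)) ⟩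
    s * s + 4 + 1                       ≡⟨ ℕ.+-assoc (s * s) 4 1 ⟩
    s * s + 5                           ∎)
    where
    e₁ : ∀ s e X → s * s + (e * (s + (s + e)) + X) ≡ (s + e) * (s + e) + X
    e₁ = ℕ-Ring.solve-∀
    e₂ : ∀ n X → n + 1 + X ≡ n + X + 1
    e₂ = ℕ-Ring.solve-∀
  result : ∀ e' → e ≡ e' → Extremal p₀ q₀ p₁ q₁ a₀ a₁ (s + e)
  -- A positive `e` alone costs at least `s + c ≥ 1 + 5`, more than the excess of 5; this is where
  -- `5 ≤ c` enters.
  result (suc e') refl = contradiction (ℕ.≤-trans (ℕ.m≤m+n _ X) excess) (ℕ.<⇒≱ (begin
    1 + 5                               ≤⟨ ℕ.+-mono-≤ (ℕ.≤-trans h₃ (ℕ.m≤n+m _ (p₀ + q₀))) 5≤c ⟩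
    s + (s + e)                         ≤⟨ ℕ.m≤m+n _ _ ⟩
    s + (s + e) + e' * (s + (s + e))    ∎))
  result zero refl = record
    { sum = sym (ℕ.+-identityʳ s)
    ; full₀ = trans (sym pq₀) (trans (cong (λ t → a₀ + t) ε₀≡0) (ℕ.+-identityʳ a₀))
    ; full₁ = trans (sym pq₁) (trans (cong (λ t → a₁ + t) ε₁≡0) (ℕ.+-identityʳ a₁))
    ; δ≤2 = δ≤2 ; diffσ = σ₀-σ₁ ; diff₀ = p₀-q₀ ; diff₁ = p₁-q₁
    ; d₀≤1 = 2d²≤5⇒d≤1 (ℕ.≤-trans (ℕ.m≤m+n _ _) d≤5)
    ; d₁≤1 = 2d²≤5⇒d≤1 (ℕ.≤-trans (ℕ.m≤n+m _ (2 * (d₀ * d₀))) d≤5)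
    ; square = begin-equality
        (s + 0) * (s + 0) + δ * δ  ≡⟨ cong (λ t → t * t + δ * δ) (ℕ.+-identityʳ s) ⟩
        s * s + δ * δ              ≡⟨ squares ⟩
        8 * n + X                  ≡⟨ cong (λ t → 8 * n + t) (cong₂ (λ x y → 8 * x + 8 * y + (2 * (d₀ * d₀) + 2 * (d₁ * d₁))) ε₀≡0 ε₁≡0) ⟩
        8 * n + (2 * (d₀ * d₀) + 2 * (d₁ * d₁)) ≡⟨ cong (λ t → 8 * n + t) (ℕ.*-distribˡ-+ 2 (d₀ * d₀) (d₁ * d₁)) ⟨
        8 * n + 2 * (d₀ * d₀ + d₁ * d₁) ∎
    }
    where
    ε₀≡0 : ε₀ ≡ 0
    ε₀≡0 = 8ε≤5⇒ε≡0 (ℕ.≤-trans (ℕ.≤-trans (ℕ.m≤m+n _ _) (ℕ.m≤m+n _ _)) excess)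
    ε₁≡0 : ε₁ ≡ 0
    ε₁≡0 = 8ε≤5⇒ε≡0 (ℕ.≤-trans (ℕ.≤-trans (ℕ.m≤n+m _ (8 * ε₀)) (ℕ.m≤m+n _ _)) excess)
    d≤5 : 2 * (d₀ * d₀) + 2 * (d₁ * d₁) ≤ 5
    d≤5 = ℕ.≤-trans (ℕ.m≤n+m _ (8 * ε₀ + 8 * ε₁)) excess

-- Now `δ² = 4 + 2(d₀² + d₁²)` with `δ ≤ 2`, so both classes are squares and their sides differ by
-- one; `a₁ ≤ a₀` decides which one is larger.
extremal-equality : ∀ {p₀ q₀ p₁ q₁ a₀ a₁ c} → Extremal p₀ q₀ p₁ q₁ a₀ a₁ c → a₁ ≤ a₀ →
  8 * (a₀ + a₁) ≡ c * c + 4 → p₀ ≡ q₀ × p₁ ≡ q₁ × p₀ ≡ suc p₁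
extremal-equality {p₀} {q₀} {p₁} {q₁} {a₀} {a₁} {c} ext a₁≤a₀ 8n≡ = go δ≤2 refl diff₀ diff₁ diffσ d₀≡0 d₁≡0
  where
  open Extremal ext
  open ℕ.≤-Reasoning
  δ² : δ * δ ≡ 4 + 2 * (d₀ * d₀ + d₁ * d₁)
  δ² = ℕ.+-cancelˡ-≡ (c * c) _ _ (trans square (trans (cong (_+ 2 * (d₀ * d₀ + d₁ * d₁)) 8n≡) (ℕ.+-assoc (c * c) 4 _)))
  zero-square : ∀ {d} → d * d ≤ 0 → d ≡ 0
  zero-square {zero} _ = refl
  d²≤0 : 2 * (d₀ * d₀ + d₁ * d₁) ≤ 0
  d²≤0 = ℕ.+-cancelˡ-≤ 4 _ _ (ℕ.≤-trans (ℕ.≤-reflexive (sym δ²)) (square-mono δ≤2))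
  d²+d²≤0 : d₀ * d₀ + d₁ * d₁ ≤ 0
  d²+d²≤0 = ℕ.≤-trans (ℕ.m≤m+n _ _) d²≤0
  d₀≡0 : d₀ ≡ 0
  d₀≡0 = zero-square (ℕ.≤-trans (ℕ.m≤m+n _ _) d²+d²≤0)
  d₁≡0 : d₁ ≡ 0
  d₁≡0 = zero-square (ℕ.≤-trans (ℕ.m≤n+m _ (d₀ * d₀)) d²+d²≤0)
  diff-0 : ∀ {x y d} → Diff x y d → d ≡ 0 → x ≡ y
  diff-0 {y = y} (inj₁ refl) refl = ℕ.+-identityʳ y
  diff-0 {x} (inj₂ refl) refl = sym (ℕ.+-identityʳ x)
  halve : ∀ {x y} → x + x ≡ y + y + 2 → x ≡ suc y
  halve {x} {y} eq = ℕ.*-cancelˡ-≡ x (suc y) 2 (trans (e₁ x) (trans eq (e₂ y)))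
    where
    e₁ : ∀ x → 2 * x ≡ x + x
    e₁ = ℕ-Ring.solve-∀
    e₂ : ∀ y → y + y + 2 ≡ 2 * suc y
    e₂ = ℕ-Ring.solve-∀
  go : ∀ {δ'} → δ' ≤ 2 → δ ≡ δ' → Diff p₀ q₀ d₀ → Diff p₁ q₁ d₁ → Diff (p₀ + q₀) (p₁ + q₁) δ' →
    d₀ ≡ 0 → d₁ ≡ 0 → p₀ ≡ q₀ × p₁ ≡ q₁ × p₀ ≡ suc p₁
  go {zero} _ eq _ _ _ _ _ = contradiction (trans (cong (λ t → t * t) (sym eq)) δ²) λ ()
  go {suc zero} _ eq _ _ _ _ _ = contradiction (trans (cong (λ t → t * t) (sym eq)) δ²) λ ()
  go {suc (suc (suc _))} (s≤s (s≤s ()))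
  go {suc (suc zero)} _ eq D₀ D₁ Dσ z₀ z₁ with diff-0 D₀ z₀ | diff-0 D₁ z₁
  go {suc (suc zero)} _ eq D₀ D₁ (inj₁ σ) z₀ z₁ | refl | refl = refl , refl , halve σ
  go {suc (suc zero)} _ eq D₀ D₁ (inj₂ σ) z₀ z₁ | refl | refl = contradiction a₁≤a₀ (ℕ.<⇒≱
    (subst₂ _<_ full₀ full₁ (subst (λ t → p₀ * p₀ < t * t) (sym (halve {p₁} {p₀} σ)) (ℕ.*-mono-< (ℕ.n<1+n p₀) (ℕ.n<1+n p₀)))))

diff-≤ : ∀ {x y d} → Diff x y d → d ≤ 1 → x ≤ y + 1 × y ≤ x + 1
diff-≤ {y = y} (inj₁ refl) d≤1 = ℕ.+-monoʳ-≤ y d≤1 , ℕ.≤-trans (ℕ.m≤m+n y _) (ℕ.m≤m+n _ 1)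
diff-≤ {x} (inj₂ refl) d≤1 = ℕ.≤-trans (ℕ.m≤m+n x _) (ℕ.m≤m+n _ 1) , ℕ.+-monoʳ-≤ x d≤1

-- The difference `P − Q` is odd and at most two, hence one.
split-odd-sum : ∀ {P Q K} → P ≤ Q + 2 → P + Q ≡ 2 * K + 3 → Q ≤ P → P ≡ K + 2 × Q ≡ K + 1
split-odd-sum {Q = Q} {K} P≤ sum Q≤P with ℕ.m≤n⇒∃[o]m+o≡n Q≤P
... | zero , refl = contradiction (trans (e₁ Q) (trans sum (e₂ K))) (ℕ.even≢odd Q (suc K))
  where
  e₁ : ∀ Q → 2 * Q ≡ Q + 0 + Q
  e₁ = ℕ-Ring.solve-∀
  e₂ : ∀ K → 2 * K + 3 ≡ suc (2 * suc K)
  e₂ = ℕ-Ring.solve-∀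
... | suc zero , refl = trans (cong (_+ 1) Q≡) (ℕ.+-assoc K 1 1) , Q≡
  where
  e₁ : ∀ Q → 2 * Q + 1 ≡ Q + 1 + Q
  e₁ = ℕ-Ring.solve-∀
  e₂ : ∀ K → 2 * K + 3 ≡ 2 * (K + 1) + 1
  e₂ = ℕ-Ring.solve-∀
  Q≡ : Q ≡ K + 1
  Q≡ = ℕ.*-cancelˡ-≡ Q (K + 1) 2 (ℕ.+-cancelʳ-≡ 1 _ _ (trans (e₁ Q) (trans sum (e₂ K))))
... | suc (suc zero) , refl = contradiction (trans (e₁ Q) (trans sum (e₂ K))) (ℕ.even≢odd (suc Q) (suc K))
  where
  e₁ : ∀ Q → 2 * suc Q ≡ Q + 2 + Q
  e₁ = ℕ-Ring.solve-∀
  e₂ : ∀ K → 2 * K + 3 ≡ suc (2 * suc K)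
  e₂ = ℕ-Ring.solve-∀
... | suc (suc (suc d)) , refl = contradiction (ℕ.+-cancelˡ-≤ Q _ _ P≤) λ { (s≤s (s≤s ())) }

-- Within each class the sides differ by at most one, so the totals `p₀ + p₁` and `q₀ + q₁` differ
-- by at most two, and their sum is odd.
extremal-odd : ∀ {p₀ q₀ p₁ q₁ a₀ a₁ K} → Extremal p₀ q₀ p₁ q₁ a₀ a₁ (2 * K + 3) →
  (p₀ + p₁ ≡ K + 1 × q₀ + q₁ ≡ K + 2) ⊎ (p₀ + p₁ ≡ K + 2 × q₀ + q₁ ≡ K + 1)
extremal-odd {p₀} {q₀} {p₁} {q₁} {K = K} ext = split (ℕ.≤-total (p₀ + p₁) (q₀ + q₁))
  where
  open Extremal ext
  D₀ : p₀ ≤ q₀ + 1 × q₀ ≤ p₀ + 1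
  D₀ = diff-≤ diff₀ d₀≤1
  D₁ : p₁ ≤ q₁ + 1 × q₁ ≤ p₁ + 1
  D₁ = diff-≤ diff₁ d₁≤1
  total : p₀ + p₁ + (q₀ + q₁) ≡ 2 * K + 3
  total = trans (e p₀ p₁ q₀ q₁) sum
    where
    e : ∀ p p' q q' → p + p' + (q + q') ≡ p + q + (p' + q')
    e = ℕ-Ring.solve-∀
  add : ∀ {x y x' y'} → x ≤ y + 1 → x' ≤ y' + 1 → x + x' ≤ y + y' + 2
  add {y = y} {y' = y'} h h' = ℕ.≤-trans (ℕ.+-mono-≤ h h') (ℕ.≤-reflexive (e y y'))
    where
    e : ∀ y y' → y + 1 + (y' + 1) ≡ y + y' + 2
    e = ℕ-Ring.solve-∀
  split : p₀ + p₁ ≤ q₀ + q₁ ⊎ q₀ + q₁ ≤ p₀ + p₁ → _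
  split (inj₁ P≤Q) =
    let Q≡ , P≡ = split-odd-sum (add (proj₂ D₀) (proj₂ D₁)) (trans (ℕ.+-comm (q₀ + q₁) _) total) P≤Q
    in inj₁ (P≡ , Q≡)
  split (inj₂ Q≤P) = inj₂ (split-odd-sum (add (proj₁ D₀) (proj₁ D₁)) total Q≤P)

-- The coordinates u = y − x, v = y + x turn neighbours into diagonal neighbours.
ψ : Pt → Z²
ψ (x , y) = y ℤ.- x , y ℤ.+ x

double-injective : ∀ {h k} → h ℤ.+ h ≡ k ℤ.+ k → h ≡ k
double-injective {h} {k} eq = ℤ.*-cancelˡ-≡ (+ 2) h k (trans (e h) (trans eq (sym (e k))))
  where
  e : ∀ h → + 2 ℤ.* h ≡ h ℤ.+ h
  e = ℤ-Ring.solve-∀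

ψ-injective : ∀ {p q} → ψ p ≡ ψ q → p ≡ q
ψ-injective {x , y} {x' , y'} eq = cong₂ _,_
  (double-injective (trans (sym (e₁ x y)) (trans (cong₂ ℤ._-_ v≡ u≡) (e₁ x' y'))))
  (double-injective (trans (sym (e₂ x y)) (trans (cong₂ ℤ._+_ v≡ u≡) (e₂ x' y'))))
  where
  u≡ = cong proj₁ eq
  v≡ = cong proj₂ eq
  e₁ : ∀ x y → y ℤ.+ x ℤ.- (y ℤ.- x) ≡ x ℤ.+ x
  e₁ = ℤ-Ring.solve-∀
  e₂ : ∀ x y → y ℤ.+ x ℤ.+ (y ℤ.- x) ≡ y ℤ.+ y
  e₂ = ℤ-Ring.solve-∀

-- The two coordinates differ by `2x`. Therefore the parity of the first one alone can define the
-- classes.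
par-ψ : ∀ p → par (proj₁ (ψ p)) ≡ par (proj₂ (ψ p))
par-ψ (x , y) = trans (sym (par-+double (y ℤ.- x) x)) (cong par (e x y))
  where
  e : ∀ x y → y ℤ.- x ℤ.+ (x ℤ.+ x) ≡ y ℤ.+ x
  e = ℤ-Ring.solve-∀

Adj⇒Diagonal : ∀ p q → Adj p q → Diagonal (ψ p) (ψ q)
Adj⇒Diagonal (x , y) (x' , y') p~q = go (x ℤ.- x') (y ℤ.- y') refl refl p~q
  where
  back : ∀ {a b d} → a ℤ.- b ≡ d → b ≡ a ℤ.- d
  back {a} {b} refl = e a b
    where
    e : ∀ a b → b ≡ a ℤ.- (a ℤ.- b)
    e = ℤ-Ring.solve-∀
  go : ∀ dx dy → x ℤ.- x' ≡ dx → y ℤ.- y' ≡ dy → ℤ.∣ dx ∣ + ℤ.∣ dy ∣ ≡ 1 →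
    Diagonal (ψ (x , y)) (ψ (x' , y'))
  go (+ 0) (+ 1) ex ey _ rewrite back {x} ex | back {y} ey = inj₁ (e x y) , inj₁ (e' x y)
    where
    e : ∀ x y → y ℤ.- + 1 ℤ.- (x ℤ.- + 0) ≡ y ℤ.- x ℤ.- 1ℤ
    e = ℤ-Ring.solve-∀
    e' : ∀ x y → y ℤ.- + 1 ℤ.+ (x ℤ.- + 0) ≡ y ℤ.+ x ℤ.- 1ℤ
    e' = ℤ-Ring.solve-∀
  go (+ 0) -[1+ 0 ] ex ey _ rewrite back {x} ex | back {y} ey = inj₂ (e x y) , inj₂ (e' x y)
    where
    e : ∀ x y → y ℤ.- -[1+ 0 ] ℤ.- (x ℤ.- + 0) ≡ y ℤ.- x ℤ.+ 1ℤ
    e = ℤ-Ring.solve-∀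
    e' : ∀ x y → y ℤ.- -[1+ 0 ] ℤ.+ (x ℤ.- + 0) ≡ y ℤ.+ x ℤ.+ 1ℤ
    e' = ℤ-Ring.solve-∀
  go (+ 1) (+ 0) ex ey _ rewrite back {x} ex | back {y} ey = inj₂ (e x y) , inj₁ (e' x y)
    where
    e : ∀ x y → y ℤ.- + 0 ℤ.- (x ℤ.- + 1) ≡ y ℤ.- x ℤ.+ 1ℤ
    e = ℤ-Ring.solve-∀
    e' : ∀ x y → y ℤ.- + 0 ℤ.+ (x ℤ.- + 1) ≡ y ℤ.+ x ℤ.- 1ℤ
    e' = ℤ-Ring.solve-∀
  go -[1+ 0 ] (+ 0) ex ey _ rewrite back {x} ex | back {y} ey = inj₁ (e x y) , inj₂ (e' x y)
    where
    e : ∀ x y → y ℤ.- + 0 ℤ.- (x ℤ.- -[1+ 0 ]) ≡ y ℤ.- x ℤ.- 1ℤ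
    e = ℤ-Ring.solve-∀
    e' : ∀ x y → y ℤ.- + 0 ℤ.+ (x ℤ.- -[1+ 0 ]) ≡ y ℤ.+ x ℤ.+ 1ℤ
    e' = ℤ-Ring.solve-∀
  go (+ 0) (+ 0) _ _ ()
  go (+ 0) (+ suc (suc _)) _ _ ()
  go (+ 0) -[1+ suc _ ] _ _ ()
  go (+ 1) (+ suc _) _ _ ()
  go (+ 1) -[1+ _ ] _ _ ()
  go (+ suc (suc _)) _ _ _ ()
  go -[1+ 0 ] (+ suc _) _ _ ()
  go -[1+ 0 ] -[1+ _ ] _ _ ()
  go -[1+ suc _ ] _ _ _ ()

x-x≡0 : ∀ x → x ℤ.- x ≡ 0ℤ
x-x≡0 = ℤ-Ring.solve-∀
x-[x+1]≡-1 : ∀ x → x ℤ.- (x ℤ.+ 1ℤ) ≡ -1ℤ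
x-[x+1]≡-1 = ℤ-Ring.solve-∀
x-[x-1]≡1 : ∀ x → x ℤ.- (x ℤ.- 1ℤ) ≡ 1ℤ
x-[x-1]≡1 = ℤ-Ring.solve-∀

Diagonal⇒Adj : ∀ p {w} → Diagonal (ψ p) w → ∃[ q ] (ψ q ≡ w × Adj p q)
Diagonal⇒Adj (x , y) (inj₁ refl , inj₁ refl) = (x , y ℤ.- 1ℤ) , cong₂ _,_ (e x y) (e' x y) , p~q
  where
  e : ∀ x y → y ℤ.- 1ℤ ℤ.- x ≡ y ℤ.- x ℤ.- 1ℤ
  e = ℤ-Ring.solve-∀
  e' : ∀ x y → y ℤ.- 1ℤ ℤ.+ x ≡ y ℤ.+ x ℤ.- 1ℤ
  e' = ℤ-Ring.solve-∀
  p~q : Adj (x , y) (x , y ℤ.- 1ℤ)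
  p~q rewrite x-x≡0 x | x-[x-1]≡1 y = refl
Diagonal⇒Adj (x , y) (inj₂ refl , inj₂ refl) = (x , y ℤ.+ 1ℤ) , cong₂ _,_ (e x y) (e' x y) , p~q
  where
  e : ∀ x y → y ℤ.+ 1ℤ ℤ.- x ≡ y ℤ.- x ℤ.+ 1ℤ
  e = ℤ-Ring.solve-∀
  e' : ∀ x y → y ℤ.+ 1ℤ ℤ.+ x ≡ y ℤ.+ x ℤ.+ 1ℤ
  e' = ℤ-Ring.solve-∀
  p~q : Adj (x , y) (x , y ℤ.+ 1ℤ)
  p~q rewrite x-x≡0 x | x-[x+1]≡-1 y = refl
Diagonal⇒Adj (x , y) (inj₁ refl , inj₂ refl) = (x ℤ.+ 1ℤ , y) , cong₂ _,_ (e x y) (e' x y) , p~q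
  where
  e : ∀ x y → y ℤ.- (x ℤ.+ 1ℤ) ≡ y ℤ.- x ℤ.- 1ℤ
  e = ℤ-Ring.solve-∀
  e' : ∀ x y → y ℤ.+ (x ℤ.+ 1ℤ) ≡ y ℤ.+ x ℤ.+ 1ℤ
  e' = ℤ-Ring.solve-∀
  p~q : Adj (x , y) (x ℤ.+ 1ℤ , y)
  p~q rewrite x-x≡0 y | x-[x+1]≡-1 x = refl
Diagonal⇒Adj (x , y) (inj₂ refl , inj₁ refl) = (x ℤ.- 1ℤ , y) , cong₂ _,_ (e x y) (e' x y) , p~q
  where
  e : ∀ x y → y ℤ.- (x ℤ.- 1ℤ) ≡ y ℤ.- x ℤ.+ 1ℤ
  e = ℤ-Ring.solve-∀
  e' : ∀ x y → y ℤ.+ (x ℤ.- 1ℤ) ≡ y ℤ.+ x ℤ.- 1ℤ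
  e' = ℤ-Ring.solve-∀
  p~q : Adj (x , y) (x ℤ.- 1ℤ , y)
  p~q rewrite x-x≡0 y | x-[x-1]≡1 x = refl

Adj-sym : ∀ p q → Adj p q → Adj q p
Adj-sym (x , y) (x' , y') p~q = trans (cong₂ _+_ (ℤ.∣i-j∣≡∣j-i∣ x' x) (ℤ.∣i-j∣≡∣j-i∣ y' y)) p~q

class : Bool → List Z² → List Z²
class e = filter (λ q → par (proj₁ q) Bool.≟ e)

∈-class⁺ : ∀ {e q X} → q ∈ X → par (proj₁ q) ≡ e → q ∈ class e X
∈-class⁺ {e} = ∈-filter⁺ (λ q → par (proj₁ q) Bool.≟ e)

∈-class⁻ : ∀ {e q} X → q ∈ class e X → q ∈ X × par (proj₁ q) ≡ e
∈-class⁻ {e} X = ∈-filter⁻ (λ q → par (proj₁ q) Bool.≟ e) {xs = X}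

length-class : ∀ {e e'} → e' ≡ not e → ∀ X → length (class e X) + length (class e' X) ≡ length X
length-class refl [] = refl
length-class {e} refl (q ∷ X) with par (proj₁ q)
length-class {true} refl (q ∷ X) | true = cong suc (length-class refl X)
length-class {false} refl (q ∷ X) | true = trans (ℕ.+-suc _ _) (cong suc (length-class refl X))
length-class {true} refl (q ∷ X) | false = trans (ℕ.+-suc _ _) (cong suc (length-class refl X))
length-class {false} refl (q ∷ X) | false = cong suc (length-class refl X)

Step-par : ∀ {u u'} → Step u u' → par u' ≡ not (par u)
Step-par {u} (inj₁ refl) = par-pred u
Step-par {u} (inj₂ refl) = par-suc u

-- The two parity classes of a set

module Classes (A L : List Pt) (A! : Unique A) (closed : ∀ {p q} → p ∈ A → Adj p q → q ∈ A ⊎ q ∈ L) where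

  S T : Bool → List Z²
  S e = class e (map ψ A)
  T e = class e (map ψ A) ++ class e (map ψ L)

  a b p q : Bool → ℕ
  a e = length (S e)
  b e = length (class e (map ψ L))
  p e = length (fst-values (S e))
  q e = length (snd-values (S e))

  S! : ∀ e → Unique (S e)
  S! e = Unique.filter⁺ (λ q → par (proj₁ q) Bool.≟ e) (Unique.map⁺ ψ-injective A!)

  ∈S⇒∈A : ∀ {e z} → z ∈ S e → ∃[ r ] (r ∈ A × z ≡ ψ r)
  ∈S⇒∈A z∈ = ∈-map⁻ ψ (proj₁ (∈-class⁻ (map ψ A) z∈))

  par-fst : ∀ {e u} → u ∈ fst-values (S e) → par u ≡ e
  par-fst {e} u∈ with ∈-values⁻ proj₁ (S e) u∈
  ... | z , z∈ , refl = proj₂ (∈-class⁻ (map ψ A) z∈)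

  par-snd : ∀ {e v} → v ∈ snd-values (S e) → par v ≡ e
  par-snd {e} v∈ with ∈-values⁻ proj₂ (S e) v∈
  ... | z , z∈ , refl with ∈S⇒∈A z∈
  ... | r , r∈ , refl = trans (sym (par-ψ r)) (proj₂ (∈-class⁻ (map ψ A) z∈))

  S-closed : ∀ {e e'} → e' ≡ not e → DiagonalClosed (S e) (T e')
  S-closed {e} refl {z} {w} z∈ z-w with ∈S⇒∈A z∈
  ... | r , r∈ , refl with Diagonal⇒Adj r z-w
  ... | r' , refl , r~r' with closed r∈ r~r' | trans (Step-par {proj₁ (ψ r)} (proj₁ z-w)) (cong not (proj₂ (∈-class⁻ (map ψ A) z∈)))
  ... | inj₁ r'∈A | par≡ = ∈-++⁺ˡ (∈-class⁺ (∈-map⁺ ψ r'∈A) par≡)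
  ... | inj₂ r'∈L | par≡ = ∈-++⁺ʳ (S (not e)) (∈-class⁺ (∈-map⁺ ψ r'∈L) par≡)

  a+a : ∀ {e e'} → e' ≡ not e → a e + a e' ≡ length A
  a+a e'≡ = trans (length-class e'≡ (map ψ A)) (length-map ψ A)

  b+b : ∀ {e e'} → e' ≡ not e → b e + b e' ≡ length L
  b+b e'≡ = trans (length-class e'≡ (map ψ L)) (length-map ψ L)

  length-T : ∀ e → length (T e) ≡ a e + b e
  length-T e = length-++ (S e)

  nonempty : ∀ {e} → 1 ≤ a e → ∃[ z ] z ∈ S e
  nonempty {e} 1≤a with S e
  nonempty () | []
  ... | z ∷ _ = z , here refl

  -- A diagonal step changes the parity, so the neighbours of one class lie in the other class of
  -- `A` or in the part of `L` with that parity, which `b e'` counts.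
  isoperimetry : ∀ {e e'} → e' ≡ not e → 1 ≤ a e → a e + (p e + q e) + 1 ≤ a e' + b e'
  isoperimetry {e} {e'} e'≡ 1≤a = begin
    a e + (p e + q e) + 1 ≤⟨ nbhd-lower-bound (S! e) (proj₂ (nonempty 1≤a)) ⟩
    length (nbhd (S e))         ≤⟨ length-mono-⊆ (nbhd-! (S e)) (nbhd⊆ (S-closed e'≡)) ⟩
    length (T e')               ≡⟨ length-T e' ⟩
    a e' + b e'               ∎
    where open ℕ.≤-Reasoning

  a≤pq : ∀ e → a e ≤ p e * q e
  a≤pq e = length-≤-values (S! e)

  larger : ∃[ e ] ∃[ e' ] (e' ≡ not e × a e' ≤ a e)
  larger with ℕ.≤-total (a true) (a false)
  ... | inj₁ le = false , true , refl , le
  ... | inj₂ le = true , false , refl , le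

  module Bounded {c : ℕ} (|L|≤ : length L ≤ c + 2) where

    -- All of `L` is charged to the neighbours of a single class. This is wasteful, but it holds
    -- even if the other class is empty.
    one-sided : ∀ {e e'} → e' ≡ not e → 1 ≤ a e → a e + (p e + q e) ≤ a e' + c + 1
    one-sided {e} {e'} e'≡ 1≤a = ℕ.+-cancelʳ-≤ 1 _ _ (begin
      a e + (p e + q e) + 1   ≤⟨ isoperimetry e'≡ 1≤a ⟩
      a e' + b e'                 ≤⟨ ℕ.+-monoʳ-≤ (a e') (ℕ.≤-trans (ℕ.m≤n+m (b e') (b e)) (ℕ.≤-trans (ℕ.≤-reflexive (b+b e'≡)) |L|≤)) ⟩
      a e' + (c + 2)            ≡⟨ e₁ (a e') c ⟩
      a e' + c + 1 + 1        ∎)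
      where
      open ℕ.≤-Reasoning
      e₁ : ∀ a c → a + (c + 2) ≡ a + c + 1 + 1
      e₁ = ℕ-Ring.solve-∀

    -- The `2` in `c + 2` pays for the two units that `isoperimetry` gains, one for each class.
    two-sided : ∀ {e e'} → e' ≡ not e → 1 ≤ a e → 1 ≤ a e' → p e + q e + (p e' + q e') ≤ c
    two-sided {e} {e'} refl 1≤a 1≤a' = ℕ.+-cancelʳ-≤ 2 _ _ (ℕ.+-cancelˡ-≤ (a e + a e') _ _ (begin
      a e + a e' + (p e + q e + (p e' + q e') + 2)              ≡⟨ e₁ (a e) (a e') (p e + q e) (p e' + q e') ⟩
      a e + (p e + q e) + 1 + (a e' + (p e' + q e') + 1)      ≤⟨ ℕ.+-mono-≤ (isoperimetry refl 1≤a) (isoperimetry (sym (not-involutive e)) 1≤a') ⟩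
      a e' + b e' + (a e + b e)                                       ≡⟨ e₂ (a e) (a e') (b e) (b e') ⟩
      a e + a e' + (b e + b e')                                       ≤⟨ ℕ.+-monoʳ-≤ (a e + a e') (ℕ.≤-trans (ℕ.≤-reflexive (b+b refl)) |L|≤) ⟩
      a e + a e' + (c + 2)                                            ∎))
      where
      open ℕ.≤-Reasoning
      e₁ : ∀ a a' s s' → a + a' + (s + s' + 2) ≡ a + s + 1 + (a' + s' + 1)
      e₁ = ℕ-Ring.solve-∀
      e₂ : ∀ a a' b b' → a' + b' + (a + b) ≡ a + a' + (b + b')
      e₂ = ℕ-Ring.solve-∀

    1≤p+q : ∀ {e} → 1 ≤ a e → 1 ≤ p e + q e
    1≤p+q {e} 1≤a = ℕ.≤-trans (∈-length (∈-values⁺ proj₁ (proj₂ (nonempty {e} 1≤a)))) (ℕ.m≤m+n _ _)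

    one-class : ∀ {e e'} → e' ≡ not e → 1 ≤ length A → a e' ≡ 0 →
      8 * length A ≤ c * c + 4 × (3 ≤ length A → 8 * length A + 2 ≤ c * c)
    one-class {e} {e'} e'≡ 1≤ a'≡0 with trans (sym (a+a e'≡)) (trans (cong (λ t → a e + t) a'≡0) (ℕ.+-identityʳ (a e)))
    ... | |A|≡ rewrite |A|≡ = one-class-bound 1≤ (product-bound (p e) (q e) (a≤pq e))
      (subst (λ t → a e + (p e + q e) ≤ t + c + 1) a'≡0 (one-sided e'≡ 1≤))

    lower-bound : 1 ≤ length A → 8 * length A ≤ c * c + 4
    lower-bound 1≤ with larger
    ... | e , e' , e'≡ , a'≤a with a e' ℕ.≟ 0
    ... | yes a'≡0 = proj₁ (one-class e'≡ 1≤ a'≡0)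
    ... | no a'≢0 = subst (λ n → 8 * n ≤ c * c + 4) (a+a e'≡)
      (two-class-bound (product-bound (p e) (q e) (a≤pq e)) (product-bound (p e') (q e') (a≤pq e'))
        (two-sided e'≡ 1≤a 1≤a') (one-sided e'≡ 1≤a) a'≤a (1≤p+q 1≤a'))
      where
      1≤a' = ℕ.n≢0⇒n>0 a'≢0
      1≤a = ℕ.≤-trans 1≤a' a'≤a

    record ExtremalClasses : Set where
      field
        {e e'} : Bool
        e'≡    : e' ≡ not e
        a'≤a   : a e' ≤ a e
        1≤a    : 1 ≤ a e
        1≤a'   : 1 ≤ a e'
        ext    : Extremal (p e) (q e) (p e') (q e') (a e) (a e') c

    extremal-classes : 3 ≤ length A → 5 ≤ c → c * c ≤ 8 * length A + 1 → ExtremalClasses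
    extremal-classes 3≤ 5≤c c²≤ with larger
    ... | e , e' , e'≡ , a'≤a with a e' ℕ.≟ 0
    -- An empty class would give `8n + 2 ≤ c² ≤ 8n + 1`.
    ... | yes a'≡0 = contradiction
      (ℕ.+-cancelˡ-≤ (8 * length A) 2 1 (ℕ.≤-trans (proj₂ (one-class e'≡ (ℕ.≤-trans (s≤s z≤n) 3≤) a'≡0) 3≤) c²≤))
      λ { (s≤s ()) }
    ... | no a'≢0 = record
      { e'≡ = e'≡ ; a'≤a = a'≤a ; 1≤a = 1≤a ; 1≤a' = 1≤a'
      ; ext = extremal (a≤pq e) (a≤pq e') (two-sided e'≡ 1≤a 1≤a') (one-sided e'≡ 1≤a) a'≤a (1≤p+q 1≤a') 5≤c
          (subst (λ n → c * c ≤ 8 * n + 1) (sym (a+a e'≡)) c²≤)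
      }
      where
      1≤a' = ℕ.n≢0⇒n>0 a'≢0
      1≤a = ℕ.≤-trans 1≤a' a'≤a

    -- If the sides add up to `c`, the sum of the two isoperimetric inequalities is an equality, and
    -- so is each of them.
    tight : ∀ {e e'} → e' ≡ not e → 1 ≤ a e' → p e + q e + (p e' + q e') ≡ c → Tight (S e) (T e')
    tight {e} {e'} refl 1≤a' s≡c = ℕ.+-cancelʳ-≤ (a e' + (p e' + q e') + 1) _ _ (begin
      length (T e') + (a e' + (p e' + q e') + 1)     ≤⟨ ℕ.+-monoʳ-≤ (length (T e')) (isoperimetry (sym (not-involutive e)) 1≤a') ⟩
      length (T e') + (a e + b e)                        ≡⟨ cong (_+ (a e + b e)) (length-T e') ⟩
      a e' + b e' + (a e + b e)                        ≡⟨ e₁ (a e) (a e') (b e) (b e') ⟩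
      a e + a e' + (b e + b e')                        ≤⟨ ℕ.+-monoʳ-≤ (a e + a e') (ℕ.≤-trans (ℕ.≤-reflexive (b+b refl)) |L|≤) ⟩
      a e + a e' + (c + 2)                             ≡⟨ cong (λ t → a e + a e' + (t + 2)) s≡c ⟨
      a e + a e' + (p e + q e + (p e' + q e') + 2) ≡⟨ e₂ (a e) (a e') (p e + q e) (p e' + q e') ⟩
      a e + (p e + q e) + 1 + (a e' + (p e' + q e') + 1) ∎)
      where
      open ℕ.≤-Reasoning
      e₁ : ∀ a a' b b' → a' + b' + (a + b) ≡ a + a' + (b + b')
      e₁ = ℕ-Ring.solve-∀
      e₂ : ∀ a a' s s' → a + a' + (s + s' + 2) ≡ a + s + 1 + (a' + s' + 1)
      e₂ = ℕ-Ring.solve-∀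

-- Joining the two classes to a box

record Interleaved (e : Bool) (U U' : List ℤ) : Set where
  field
    U!       : Unique U
    parity   : ∀ {x} → x ∈ U → par x ≡ e
    gapless  : Gapless U
    near     : ∀ {x} → x ∈ U → ∃[ x' ] (x' ∈ U' × Step x' x)

-- The neighbour of `x` in `U'` is `x + 1`, as wanted, or `x − 1`. In the latter case gaplessness of
-- `U'` leads on to `x + 1`, provided that `U'` has an element beyond `x`. If the later element `y`
-- lies in `U`, its neighbour in `U'` is beyond `x`, since parity excludes that it equals `x`.
interleaved-step : ∀ {e e' U U'} → e' ≡ not e → Interleaved e U U' → Interleaved e' U' U →
  ∀ {x y} → x ∈ U → y ∈ U ++ U' → x ℤ.< y → x ℤ.+ 1ℤ ∈ U'
interleaved-step {e} {e'} {U} {U'} e'≡ I I' {x} {y} x∈ y∈ x<y with later (∈-++⁻ U y∈)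
  where
  open Interleaved
  later : y ∈ U ⊎ y ∈ U' → ∃[ y' ] (y' ∈ U' × x ℤ.< y')
  later (inj₂ y∈U') = y , y∈U' , x<y
  later (inj₁ y∈U) with near I y∈U
  ... | y' , y'∈ , inj₁ refl = y' , y'∈ , ℤ.<-trans x<y (x-1<x y')
  ... | y' , y'∈ , inj₂ refl = y' , y'∈ , ℤ.≤∧≢⇒< (ℤ.≮⇒≥ λ y'<x → ℤ.<⇒≱ x<y (<⇒+1≤ y'<x))
    λ { refl → not-¬ (trans (sym (parity I' y'∈)) (parity I x∈)) e'≡ }
... | y' , y'∈ , x<y' with Interleaved.near I x∈
... | x' , x'∈ , inj₁ refl = subst (_∈ U') (sym (x-1+1≡x x')) x'∈
... | x' , x'∈ , inj₂ refl = Interleaved.gapless I' x'∈ y'∈ (ℤ.<-trans (x<x+1 x') x<y')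

-- The field `first` fixes the parity of the lower end when `U` has one more element; for the
-- squares this shows that the corner of the box is a lattice point.
record Consecutive (e : Bool) (U U' : List ℤ) : Set where
  field
    m     : ℤ
    w     : ℕ
    size  : length U + length U' ≡ suc w
    range : ∀ z → z ∈ U ++ U' ⇔ Interval m w z
    first : length U ≡ suc (length U') → par m ≡ e

consecutive : ∀ {e e' U U' x} → e' ≡ not e → Interleaved e U U' → Interleaved e' U' U → x ∈ U →
  Consecutive e U U'
consecutive {e} {e'} {U} {U'} e'≡ I I' x∈ with interval W! (∈-++⁺ˡ x∈) step
  where
  open Interleaved
  W! : Unique (U ++ U')
  W! = Unique.++⁺ (U! I) (U! I') λ (z∈ , z∈') →
    not-¬ (trans (sym (parity I' z∈')) (parity I z∈)) e'≡
  flip : ∀ {z} → z ∈ U ++ U' → z ∈ U' ++ U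
  flip z∈ with ∈-++⁻ U z∈
  ... | inj₁ z∈U = ∈-++⁺ʳ U' z∈U
  ... | inj₂ z∈U' = ∈-++⁺ˡ z∈U'
  step : ∀ {x y} → x ∈ U ++ U' → y ∈ U ++ U' → x ℤ.< y → x ℤ.+ 1ℤ ∈ U ++ U'
  step x∈ y∈ x<y with ∈-++⁻ U x∈
  ... | inj₁ x∈U = ∈-++⁺ʳ U (interleaved-step e'≡ I I' x∈U y∈ x<y)
  ... | inj₂ x∈U' = ∈-++⁺ˡ (interleaved-step (trans (sym (not-involutive e)) (cong not (sym e'≡))) I' I x∈U' (flip y∈) x<y)
... | m , w , |W|≡ , m∈ , range = record
  { m = m ; w = w ; size = trans (sym (length-++ U)) |W|≡ ; range = range ; first = first (∈-++⁻ U m∈) }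
  where
  open Interleaved
  first : m ∈ U ⊎ m ∈ U' → length U ≡ suc (length U') → par m ≡ e
  first (inj₁ m∈U) _ = parity I m∈U
  first (inj₂ m∈U') |U|≡ = contradiction (length-mono-⊆ (Unique.map⁺ -1-injective (U! I)) pred⊆)
    (ℕ.<⇒≱ (ℕ.≤-reflexive (sym (trans (length-map _ U) |U|≡))))
    where
    pred⊆ : map (λ z → z ℤ.- 1ℤ) U ⊆ U'
    pred⊆ z∈ with ∈-map⁻ _ z∈
    ... | z , z∈U , refl with Equivalence.to (range z) (∈-++⁺ˡ z∈U)
    ... | m≤z , z≤M with ∈-++⁻ U (Equivalence.from (range (z ℤ.- 1ℤ))
          (subst (m ℤ.≤_) (ℤ.+-comm (ℤ.- 1ℤ) z) (ℤ.i<j⇒i≤pred[j] m<z) , ℤ.≤-trans (ℤ.<⇒≤ (x-1<x z)) z≤M))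
      where
      m<z : m ℤ.< z
      m<z = ℤ.≤∧≢⇒< m≤z λ { refl → not-¬ (trans (sym (parity I' m∈U')) (parity I z∈U)) e'≡ }
    ... | inj₂ z-1∈ = z-1∈
    ... | inj₁ z-1∈ = contradiction (trans (sym (par-pred z)) (trans (parity I z-1∈) (sym (parity I z∈U))))
          λ not≡ → not-¬ refl (sym not≡)

-- The corner `(m , m')` may have coordinates of different parity, in which case no lattice point
-- maps to it.
Box : ℤ → ℕ → ℤ → ℕ → Pt → Set
Box m α m' β (x , y) = Interval m α (y ℤ.- x) × Interval m' β (y ℤ.+ x)

record ExtremalBox (A : List Pt) (c : ℕ) : Set where
  field
    {p₀ q₀ p₁ q₁ a₀ a₁ α β} : ℕ
    {m m'} : ℤ
    {e}    : Bool
    size   : a₀ + a₁ ≡ length A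
    a₁≤a₀  : a₁ ≤ a₀
    ext    : Extremal p₀ q₀ p₁ q₁ a₀ a₁ c
    box    : ∀ r → r ∈ A ⇔ Box m α m' β r
    p+p    : p₀ + p₁ ≡ suc α
    q+q    : q₀ + q₁ ≡ suc β
    par-m  : p₀ ≡ suc p₁ → par m ≡ e
    par-m' : q₀ ≡ suc q₁ → par m' ≡ e

module _ {A L : List Pt} (A! : Unique A) (closed : ∀ {p q} → p ∈ A → Adj p q → q ∈ A ⊎ q ∈ L) where
  private module C = Classes A L A! closed
  open C using (S; T; a; p; q)

  -- The field `near` uses tightness of the opposite class: `T d` contains `S d` and consists of
  -- neighbours of `S d'`.
  interleaved-fst : ∀ d d' → d' ≡ not d → 1 ≤ a d' → Tight (S d) (T d') → Tight (S d') (T d) →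
    Interleaved d (fst-values (S d)) (fst-values (S d'))
  interleaved-fst d d' d'≡ 1≤ tt tt' = record
    { U! = values-! proj₁ (S d) ; parity = C.par-fst {d}
    ; gapless = tight-fst-gapless (C.S! d) (C.S-closed d'≡) tt ; near = near }
    where
    near : ∀ {x} → x ∈ fst-values (S d) → ∃[ x' ] (x' ∈ fst-values (S d') × Step x' x)
    near x∈ =
      let z , z∈ , x≡ = ∈-values⁻ proj₁ (S d) x∈
          z' , z'∈ , z'-z = tight-near (C.S! d') (proj₂ (C.nonempty {d'} 1≤))
            (C.S-closed (trans (sym (not-involutive d)) (cong not (sym d'≡)))) tt' (∈-++⁺ˡ z∈)
      in proj₁ z' , ∈-values⁺ proj₁ z'∈ , subst (Step (proj₁ z')) (sym x≡) (proj₁ z'-z)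

  interleaved-snd : ∀ d d' → d' ≡ not d → 1 ≤ a d' → Tight (S d) (T d') → Tight (S d') (T d) →
    Interleaved d (snd-values (S d)) (snd-values (S d'))
  interleaved-snd d d' d'≡ 1≤ tt tt' = record
    { U! = values-! proj₂ (S d) ; parity = C.par-snd {d}
    ; gapless = tight-snd-gapless (C.S! d) (C.S-closed d'≡) tt ; near = near }
    where
    near : ∀ {x} → x ∈ snd-values (S d) → ∃[ x' ] (x' ∈ snd-values (S d') × Step x' x)
    near x∈ =
      let z , z∈ , x≡ = ∈-values⁻ proj₂ (S d) x∈
          z' , z'∈ , z'-z = tight-near (C.S! d') (proj₂ (C.nonempty {d'} 1≤))
            (C.S-closed (trans (sym (not-involutive d)) (cong not (sym d'≡)))) tt' (∈-++⁺ˡ z∈)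
      in proj₂ z' , ∈-values⁺ proj₂ z'∈ , subst (Step (proj₂ z')) (sym x≡) (proj₂ z'-z)

  ∈S⇒r∈A : ∀ d r → ψ r ∈ S d → r ∈ A
  ∈S⇒r∈A d r ψr∈ = let r' , r'∈ , eq = C.∈S⇒∈A {d} ψr∈ in subst (_∈ A) (sym (ψ-injective eq)) r'∈

  class-cases : ∀ {e e'} → e' ≡ not e → ∀ {z} → z ∈ map ψ A → z ∈ S e ⊎ z ∈ S e'
  class-cases {e} e'≡ {z} z∈ with par (proj₁ z) Bool.≟ e
  ... | yes par≡ = inj₁ (∈-class⁺ z∈ par≡)
  ... | no par≢ = inj₂ (∈-class⁺ z∈ (trans (¬-not par≢) (sym e'≡)))

  module _ {e e' : Bool} (e'≡ : e' ≡ not e)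
    (CU : Consecutive e (fst-values (S e)) (fst-values (S e')))
    (CV : Consecutive e (snd-values (S e)) (snd-values (S e'))) where

    private
      module CU = Consecutive CU
      module CV = Consecutive CV

    ∈A⇒Box : ∀ r → r ∈ A → Box CU.m CU.w CV.m CV.w r
    ∈A⇒Box r r∈ = go (class-cases e'≡ (∈-map⁺ ψ r∈))
      where
      go : ψ r ∈ S e ⊎ ψ r ∈ S e' → Box CU.m CU.w CV.m CV.w r
      go (inj₁ z∈) = Equivalence.to (CU.range _) (∈-++⁺ˡ (∈-values⁺ proj₁ z∈)) ,
                     Equivalence.to (CV.range _) (∈-++⁺ˡ (∈-values⁺ proj₂ z∈))
      go (inj₂ z∈) = Equivalence.to (CU.range _) (∈-++⁺ʳ (fst-values (S e)) (∈-values⁺ proj₁ z∈)) ,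
                     Equivalence.to (CV.range _) (∈-++⁺ʳ (snd-values (S e)) (∈-values⁺ proj₂ z∈))

    -- When both coordinates are values of the same class, fullness puts the point into that class.
    -- Coordinates from different classes have different parities, which `par-ψ` excludes.
    Box⇒∈A : p e * q e ≡ a e → p e' * q e' ≡ a e' → ∀ r → Box CU.m CU.w CV.m CV.w r → r ∈ A
    Box⇒∈A full full' r (in-u , in-v) =
      go (∈-++⁻ (fst-values (S e)) (Equivalence.from (CU.range (proj₁ (ψ r))) in-u))
         (∈-++⁻ (snd-values (S e)) (Equivalence.from (CV.range (proj₂ (ψ r))) in-v))
      where
      e≢e' : e ≢ e'
      e≢e' eq = not-¬ (sym eq) e'≡
      go : proj₁ (ψ r) ∈ fst-values (S e) ⊎ proj₁ (ψ r) ∈ fst-values (S e') →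
           proj₂ (ψ r) ∈ snd-values (S e) ⊎ proj₂ (ψ r) ∈ snd-values (S e') → r ∈ A
      go (inj₁ u∈) (inj₁ v∈) = ∈S⇒r∈A e r (values-full (C.S! e) (ℕ.≤-reflexive full) u∈ v∈)
      go (inj₂ u∈) (inj₂ v∈) = ∈S⇒r∈A e' r (values-full (C.S! e') (ℕ.≤-reflexive full') u∈ v∈)
      go (inj₁ u∈) (inj₂ v∈) = contradiction
        (trans (sym (C.par-fst {e} u∈)) (trans (par-ψ r) (C.par-snd {e'} v∈))) e≢e'
      go (inj₂ u∈) (inj₁ v∈) = contradiction
        (trans (sym (C.par-snd {e} v∈)) (trans (sym (par-ψ r)) (C.par-fst {e'} u∈))) e≢e'

  extremal-box-classes : ∀ {c} (|L|≤ : length L ≤ c + 2) → C.Bounded.ExtremalClasses |L|≤ → ExtremalBox A c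
  extremal-box-classes {c} |L|≤ ec =
    result (consecutive e'≡ (interleaved-fst e e' e'≡ 1≤a' t t') (interleaved-fst e' e e≡ 1≤a t' t)
             (∈-values⁺ proj₁ (proj₂ (C.nonempty {e} 1≤a))))
           (consecutive e'≡ (interleaved-snd e e' e'≡ 1≤a' t t') (interleaved-snd e' e e≡ 1≤a t' t)
             (∈-values⁺ proj₂ (proj₂ (C.nonempty {e} 1≤a))))
    where
    open C.Bounded |L|≤
    open ExtremalClasses ec
    e≡ : e ≡ not e'
    e≡ = trans (sym (not-involutive e)) (cong not (sym e'≡))
    t : Tight (S e) (T e')
    t = tight e'≡ 1≤a' (Extremal.sum ext)
    t' : Tight (S e') (T e)
    t' = tight e≡ 1≤a (trans (ℕ.+-comm (p e' + q e') _) (Extremal.sum ext))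
    result : Consecutive e (fst-values (S e)) (fst-values (S e')) →
             Consecutive e (snd-values (S e)) (snd-values (S e')) → ExtremalBox A c
    result CU CV = record
      { size = C.a+a e'≡ ; a₁≤a₀ = a'≤a ; ext = ext
      ; box = λ r → mk⇔ (∈A⇒Box e'≡ CU CV r) (Box⇒∈A e'≡ CU CV (Extremal.full₀ ext) (Extremal.full₁ ext) r)
      ; p+p = CU.size ; q+q = CV.size ; par-m = CU.first ; par-m' = CV.first }
      where
      module CU = Consecutive CU
      module CV = Consecutive CV

  extremal-box : ∀ {c} → length L ≤ c + 2 → 3 ≤ length A → 5 ≤ c → c * c ≤ 8 * length A + 1 → ExtremalBox A c
  extremal-box |L|≤ 3≤ 5≤c c²≤ = extremal-box-classes |L|≤ (C.Bounded.extremal-classes |L|≤ 3≤ 5≤c c²≤)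

-- Automorphisms and congruence

≡⇒Adj⇔ : ∀ {a b : ℕ} → a ≡ b → (a ≡ 1) ⇔ (b ≡ 1)
≡⇒Adj⇔ refl = mk⇔ (λ h → h) (λ h → h)

identity : Automorphism
identity = record
  { fun = λ p → p ; inv = λ p → p ; inv-fun = λ _ → refl ; fun-inv = λ _ → refl ; adj = λ _ _ → ≡⇒Adj⇔ refl }

inverse : Automorphism → Automorphism
inverse φ = record
  { fun = inv φ ; inv = fun φ ; inv-fun = fun-inv φ ; fun-inv = inv-fun φ
  ; adj = λ p q → mk⇔
      (λ h → Equivalence.from (adj φ (inv φ p) (inv φ q)) (subst₂ Adj (sym (fun-inv φ p)) (sym (fun-inv φ q)) h))
      (λ h → subst₂ Adj (fun-inv φ p) (fun-inv φ q) (Equivalence.to (adj φ (inv φ p) (inv φ q)) h)) }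

compose : Automorphism → Automorphism → Automorphism
compose φ χ = record
  { fun = fun χ ∘ fun φ ; inv = inv φ ∘ inv χ
  ; inv-fun = λ p → trans (cong (inv φ) (inv-fun χ (fun φ p))) (inv-fun φ p)
  ; fun-inv = λ p → trans (cong (fun χ) (fun-inv φ (inv χ p))) (fun-inv χ p)
  ; adj = λ p q → mk⇔
      (Equivalence.to (adj χ (fun φ p) (fun φ q)) ∘ Equivalence.to (adj φ p q))
      (Equivalence.from (adj φ p q) ∘ Equivalence.from (adj χ (fun φ p) (fun φ q))) }

translation : ℤ → ℤ → Automorphism
translation a b = record
  { fun = λ (x , y) → x ℤ.+ a , y ℤ.+ b
  ; inv = λ (x , y) → x ℤ.- a , y ℤ.- b
  ; inv-fun = λ (x , y) → cong₂ _,_ (e₁ x a) (e₁ y b)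
  ; fun-inv = λ (x , y) → cong₂ _,_ (e₂ x a) (e₂ y b)
  ; adj = λ (x , y) (x' , y') → ≡⇒Adj⇔ (cong₂ (λ s t → ℤ.∣ s ∣ + ℤ.∣ t ∣) (e₃ x x' a) (e₃ y y' b)) }
  where
  e₁ : ∀ x a → x ℤ.+ a ℤ.- a ≡ x
  e₁ = ℤ-Ring.solve-∀
  e₂ : ∀ x a → x ℤ.- a ℤ.+ a ≡ x
  e₂ = ℤ-Ring.solve-∀
  e₃ : ∀ x x' a → x ℤ.- x' ≡ x ℤ.+ a ℤ.- (x' ℤ.+ a)
  e₃ = ℤ-Ring.solve-∀

transposition : Automorphism
transposition = record
  { fun = swap ; inv = swap ; inv-fun = λ _ → refl ; fun-inv = λ _ → refl
  ; adj = λ (x , y) (x' , y') → ≡⇒Adj⇔ (ℕ.+-comm ℤ.∣ x ℤ.- x' ∣ ℤ.∣ y ℤ.- y' ∣) }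

reflection : Automorphism
reflection = record
  { fun = λ (x , y) → ℤ.- x , y ; inv = λ (x , y) → ℤ.- x , y
  ; inv-fun = λ (x , y) → cong (_, y) (ℤ.neg-involutive x)
  ; fun-inv = λ (x , y) → cong (_, y) (ℤ.neg-involutive x)
  ; adj = λ (x , y) (x' , y') → ≡⇒Adj⇔ (cong (_+ ℤ.∣ y ℤ.- y' ∣)
      (trans (ℤ.∣i-j∣≡∣j-i∣ x x') (cong ℤ.∣_∣ (e x x')))) }
  where
  e : ∀ x x' → x' ℤ.- x ≡ ℤ.- x ℤ.- ℤ.- x'
  e = ℤ-Ring.solve-∀

Congruent-reflexive : ∀ S T → (∀ p → S p ⇔ T p) → Congruent S T
Congruent-reflexive _ _ S⇔T = identity , S⇔T

Congruent-sym : ∀ S T → Congruent S T → Congruent T S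
Congruent-sym S T (φ , S⇔T) = inverse φ , λ p → mk⇔
  (λ t → Equivalence.from (S⇔T (inv φ p)) (subst T (sym (fun-inv φ p)) t))
  (λ s → subst T (fun-inv φ p) (Equivalence.to (S⇔T (inv φ p)) s))

Congruent-trans : ∀ S T R → Congruent S T → Congruent T R → Congruent S R
Congruent-trans _ _ _ (φ , S⇔T) (χ , T⇔R) = compose φ χ , λ p → mk⇔
  (Equivalence.to (T⇔R (fun φ p)) ∘ Equivalence.to (S⇔T p))
  (Equivalence.from (S⇔T p) ∘ Equivalence.from (T⇔R (fun φ p)))

Interval-shift : ∀ {m w z d} → Interval m w z → Interval (m ℤ.+ d) w (z ℤ.+ d)
Interval-shift {m} {w} {z} {d} (lo , hi) =
  ℤ.+-monoˡ-≤ d lo , ℤ.≤-trans (ℤ.+-monoˡ-≤ d hi) (ℤ.≤-reflexive (e m d (+ w)))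
  where
  e : ∀ m d w → m ℤ.+ w ℤ.+ d ≡ m ℤ.+ d ℤ.+ w
  e = ℤ-Ring.solve-∀

Interval-neg : ∀ {m w z} → Interval m w z → Interval (ℤ.- (m ℤ.+ + w)) w (ℤ.- z)
Interval-neg {m} {w} (lo , hi) = ℤ.neg-mono-≤ hi , ℤ.≤-trans (ℤ.neg-mono-≤ lo) (ℤ.≤-reflexive (e m (+ w)))
  where
  e : ∀ m w → ℤ.- m ≡ ℤ.- (m ℤ.+ w) ℤ.+ w
  e = ℤ-Ring.solve-∀

Box-translate : ∀ {m m' α β} a b → b ℤ.- a ≡ ℤ.- m → b ℤ.+ a ≡ ℤ.- m' → Congruent (Box m α m' β) (InB α β)
Box-translate {m} {m'} {α} {β} a b ea eb = translation a b , λ (x , y) → mk⇔ (to x y) (from x y)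
  where
  eu : ∀ x y → y ℤ.- x ℤ.+ (b ℤ.- a) ≡ y ℤ.+ b ℤ.- (x ℤ.+ a)
  eu x y = e x y a b
    where
    e : ∀ x y a b → y ℤ.- x ℤ.+ (b ℤ.- a) ≡ y ℤ.+ b ℤ.- (x ℤ.+ a)
    e = ℤ-Ring.solve-∀
  ev : ∀ x y → y ℤ.+ x ℤ.+ (b ℤ.+ a) ≡ y ℤ.+ b ℤ.+ (x ℤ.+ a)
  ev x y = e x y a b
    where
    e : ∀ x y a b → y ℤ.+ x ℤ.+ (b ℤ.+ a) ≡ y ℤ.+ b ℤ.+ (x ℤ.+ a)
    e = ℤ-Ring.solve-∀
  shift : ∀ {m w z d z'} → d ≡ ℤ.- m → z ℤ.+ d ≡ z' → Interval m w z → Interval 0ℤ w z'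
  shift {m} {w} {z} refl refl i = subst (λ t → Interval t w (z ℤ.+ ℤ.- m)) (ℤ.+-inverseʳ m) (Interval-shift i)
  unshift : ∀ {m w z d z'} → d ≡ ℤ.- m → z ℤ.+ d ≡ z' → Interval 0ℤ w z' → Interval m w z
  unshift {m} {w} {z} refl refl i = subst₂ (λ s t → Interval s w t) (ℤ.+-identityˡ m) (e z m) (Interval-shift {d = m} i)
    where
    e : ∀ z m → z ℤ.+ ℤ.- m ℤ.+ m ≡ z
    e = ℤ-Ring.solve-∀
  to : ∀ x y → Box m α m' β (x , y) → InB α β (x ℤ.+ a , y ℤ.+ b)
  to x y (iu , iv) = let lo , hi = shift ea (eu x y) iu ; lo' , hi' = shift eb (ev x y) iv in lo , hi , lo' , hi'
  from : ∀ x y → InB α β (x ℤ.+ a , y ℤ.+ b) → Box m α m' β (x , y)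
  from x y (lo , hi , lo' , hi') = unshift ea (eu x y) (lo , hi) , unshift eb (ev x y) (lo' , hi')

-- Equal parities make `(m , m')` the image of a lattice point, and the translation takes that point
-- to the origin.
Box-corner : ∀ {m m' α β} → par m ≡ par m' → Congruent (Box m α m' β) (InB α β)
Box-corner {m} {m'} {α} {β} eq = go (par-parity m) (subst (Parity m') (sym eq) (par-parity m'))
  where
  go : ∀ {e} → Parity m e → Parity m' e → Congruent (Box m α m' β) (InB α β)
  go (even h refl) (even k refl) = Box-translate (h ℤ.- k) (ℤ.- (h ℤ.+ k)) (e₁ h k) (e₂ h k)
    where
    e₁ : ∀ h k → ℤ.- (h ℤ.+ k) ℤ.- (h ℤ.- k) ≡ ℤ.- (h ℤ.+ h)
    e₁ = ℤ-Ring.solve-∀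
    e₂ : ∀ h k → ℤ.- (h ℤ.+ k) ℤ.+ (h ℤ.- k) ≡ ℤ.- (k ℤ.+ k)
    e₂ = ℤ-Ring.solve-∀
  go (odd h refl) (odd k refl) = Box-translate (h ℤ.- k) (ℤ.- (h ℤ.+ k ℤ.+ 1ℤ)) (e₁ h k) (e₂ h k)
    where
    e₁ : ∀ h k → ℤ.- (h ℤ.+ k ℤ.+ 1ℤ) ℤ.- (h ℤ.- k) ≡ ℤ.- (h ℤ.+ h ℤ.+ 1ℤ)
    e₁ = ℤ-Ring.solve-∀
    e₂ : ∀ h k → ℤ.- (h ℤ.+ k ℤ.+ 1ℤ) ℤ.+ (h ℤ.- k) ≡ ℤ.- (k ℤ.+ k ℤ.+ 1ℤ)
    e₂ = ℤ-Ring.solve-∀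

Box-swap : ∀ {m m' α β} → Congruent (Box m α m' β) (Box m' β m α)
Box-swap {m} {m'} {α} {β} = reflection , λ (x , y) → mk⇔
  (λ (iu , iv) → subst (Interval m' β) (e x y) iv , iu)
  (λ (iv , iu) → iu , subst (Interval m' β) (sym (e x y)) iv)
  where
  e : ∀ x y → y ℤ.+ x ≡ y ℤ.- ℤ.- x
  e = ℤ-Ring.solve-∀

-- Exchanging `x` and `y` negates `u`, so the upper end of its interval becomes the lower one. For
-- odd `α` this changes the parity of the corner coordinate.
Box-flip : ∀ {m m' α β} → Congruent (Box m α m' β) (Box (ℤ.- (m ℤ.+ + α)) α m' β)
Box-flip {m} {m'} {α} {β} = transposition , λ (x , y) → mk⇔
  (λ (iu , iv) → subst (Interval _ α) (e x y) (Interval-neg iu) , subst (Interval m' β) (ℤ.+-comm y x) iv)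
  (λ (iu , iv) → subst₂ (λ s t → Interval s α t) (e₂ m (+ α)) (e y x) (Interval-neg iu) ,
                 subst (Interval m' β) (ℤ.+-comm x y) iv)
  where
  e : ∀ x y → ℤ.- (y ℤ.- x) ≡ x ℤ.- y
  e = ℤ-Ring.solve-∀
  e₂ : ∀ m w → ℤ.- (ℤ.- (m ℤ.+ w) ℤ.+ w) ≡ m
  e₂ = ℤ-Ring.solve-∀

par-+suc : ∀ n z → par (z ℤ.+ + suc n) ≡ not (par (z ℤ.+ + n))
par-+suc n z = trans (cong par (trans (cong (λ k → z ℤ.+ + k) (ℕ.+-comm 1 n)) (sym (ℤ.+-assoc z (+ n) 1ℤ))))
  (par-suc (z ℤ.+ + n))

par-+ℕ : ∀ n → (∀ z → par (z ℤ.+ + n) ≡ par z) ⊎ (∀ z → par (z ℤ.+ + n) ≡ not (par z))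
par-+ℕ zero = inj₁ λ z → cong par (ℤ.+-identityʳ z)
par-+ℕ (suc n) with par-+ℕ n
... | inj₁ h = inj₂ λ z → trans (par-+suc n z) (cong not (h z))
... | inj₂ h = inj₁ λ z → trans (par-+suc n z) (trans (cong not (h z)) (not-involutive (par z)))

-- One of the two sides has odd length, so flipping it brings a lattice point to the corner.
Box-odd : ∀ {m m'} K → Congruent (Box m K m' (K + 1)) (InB K (K + 1))
Box-odd {m} {m'} K with par m Bool.≟ par m'
... | yes eq = Box-corner eq
... | no neq with par-+ℕ K
... | inj₂ K-odd = Congruent-trans _ (Box (ℤ.- (m ℤ.+ + K)) K m' (K + 1)) (InB K (K + 1)) (Box-flip {m} {m'} {K} {K + 1})
  (Box-corner (trans (par-neg (m ℤ.+ + K)) (trans (K-odd m) (sym (¬-not (neq ∘ sym))))))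
... | inj₁ K-even =
  Congruent-trans _ (Box m' (K + 1) m K) (InB K (K + 1)) (Box-swap {m} {m'} {K} {K + 1})
  (Congruent-trans _ (Box n (K + 1) m K) (InB K (K + 1)) (Box-flip {m'} {m} {K + 1} {K})
  (Congruent-trans _ (Box m K n (K + 1)) (InB K (K + 1)) (Box-swap {n} {m} {K + 1} {K})
  (Box-corner (sym (trans (par-neg (m' ℤ.+ + (K + 1)))
    (trans (cong par (sym (ℤ.+-assoc m' (+ K) 1ℤ)))
    (trans (par-suc (m' ℤ.+ + K)) (trans (cong not (K-even m')) (sym (¬-not neq))))))))))
  where
  n = ℤ.- (m' ℤ.+ + (K + 1))

singleton-congruent : ∀ r → Congruent (_∈ r ∷ []) (InB 0 0)
singleton-congruent r = Congruent-trans _ (Box (proj₁ (ψ r)) 0 (proj₂ (ψ r)) 0) (InB 0 0) (Congruent-reflexive _ _ box) (Box-corner (par-ψ r))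
  where
  in-point : ∀ {z} → Interval z 0 z
  in-point {z} = ℤ.≤-refl , ℤ.≤-reflexive (sym (ℤ.+-identityʳ z))
  point : ∀ {m z} → Interval m 0 z → z ≡ m
  point {m} (lo , hi) = ℤ.≤-antisym (subst (_ ℤ.≤_) (ℤ.+-identityʳ m) hi) lo
  box : ∀ p → p ∈ r ∷ [] ⇔ Box (proj₁ (ψ r)) 0 (proj₂ (ψ r)) 0 p
  box p = mk⇔ (λ { (here refl) → in-point , in-point })
    (λ (iu , iv) → here (ψ-injective (cong₂ _,_ (point iu) (point iv))))

-- On the line `y − x = 0` the sum `y + x` is even and never equals 1. Thus `B(0,1)` is a single
-- point and belongs to the squares.
InB-0-1⇔InB-0-0 : ∀ p → InB 0 1 p ⇔ InB 0 0 p
InB-0-1⇔InB-0-0 (x , y) = mk⇔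
  (λ (a , b , c , d) → a , b , c , sharpen a b d)
  (λ (a , b , c , d) → a , b , c , ℤ.≤-trans d (ℤ.+≤+ z≤n))
  where
  sharpen : 0ℤ ℤ.≤ y ℤ.- x → y ℤ.- x ℤ.≤ 0ℤ → y ℤ.+ x ℤ.≤ 1ℤ → y ℤ.+ x ℤ.≤ 0ℤ
  sharpen a b d = ℤ.i<j⇒i≤pred[j] (ℤ.≤∧≢⇒< d λ y+x≡1 → double≢1 x (trans (e x y)
    (trans (cong₂ ℤ._-_ y+x≡1 (ℤ.≤-antisym b a)) refl)))
    where
    e : ∀ x y → x ℤ.+ x ≡ y ℤ.+ x ℤ.- (y ℤ.- x)
    e = ℤ-Ring.solve-∀

-- Boundaries of finite sets

neighbours : Pt → List Pt
neighbours p = proj₁ (Diagonal⇒Adj p (inj₁ refl , inj₁ refl)) ∷ proj₁ (Diagonal⇒Adj p (inj₁ refl , inj₂ refl))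
  ∷ proj₁ (Diagonal⇒Adj p (inj₂ refl , inj₁ refl)) ∷ proj₁ (Diagonal⇒Adj p (inj₂ refl , inj₂ refl)) ∷ []

∈-neighbours⁻ : ∀ p {q} → q ∈ neighbours p → Adj p q
∈-neighbours⁻ p (here refl) = proj₂ (proj₂ (Diagonal⇒Adj p (inj₁ refl , inj₁ refl)))
∈-neighbours⁻ p (there (here refl)) = proj₂ (proj₂ (Diagonal⇒Adj p (inj₁ refl , inj₂ refl)))
∈-neighbours⁻ p (there (there (here refl))) = proj₂ (proj₂ (Diagonal⇒Adj p (inj₂ refl , inj₁ refl)))
∈-neighbours⁻ p (there (there (there (here refl)))) = proj₂ (proj₂ (Diagonal⇒Adj p (inj₂ refl , inj₂ refl)))

∈-neighbours⁺ : ∀ p {q} → Adj p q → q ∈ neighbours p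
∈-neighbours⁺ p {q} p~q =
  let d = Adj⇒Diagonal p q p~q in
  subst (_∈ neighbours p) (ψ-injective (proj₁ (proj₂ (Diagonal⇒Adj p d)))) (listed d)
  where
  listed : ∀ {w} (d : Diagonal (ψ p) w) → proj₁ (Diagonal⇒Adj p d) ∈ neighbours p
  listed (inj₁ refl , inj₁ refl) = here refl
  listed (inj₁ refl , inj₂ refl) = there (here refl)
  listed (inj₂ refl , inj₁ refl) = there (there (here refl))
  listed (inj₂ refl , inj₂ refl) = there (there (there (here refl)))

-- `BoundaryLe` compares only witnessed sizes of boundaries. A witness for every finite set is what
-- allows minimality to be applied.
boundary : ∀ C → ∃[ n ] HasCard (InBoundary C) n
boundary C = _ , L , deduplicate²-! outer , refl , λ u → mk⇔ (to u) (from u)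
  where
  around outer L : List Pt
  around = concat (map neighbours (elems C))
  outer = filter (_∉²? elems C) around
  L = deduplicate _≟²_ outer
  to : ∀ u → u ∈ L → InBoundary C u
  to u u∈ with ∈-filter⁻ (_∉²? elems C) {xs = around} (∈-deduplicate⁻ _≟²_ outer u∈)
  ... | u∈around , u∉C with ∈-concat⁻′ (map neighbours (elems C)) u∈around
  ... | ns , u∈ns , ns∈ with ∈-map⁻ neighbours ns∈
  ... | v , v∈ , refl = u∉C , v , v∈ , Adj-sym v u (∈-neighbours⁻ v u∈ns)
  from : ∀ u → InBoundary C u → u ∈ L
  from u (u∉C , v , v∈ , u~v) = ∈-deduplicate⁺ _≟²_ (∈-filter⁺ (_∉²? elems C)
    (∈-concat⁺′ (∈-neighbours⁺ v (Adj-sym u v u~v)) (∈-map⁺ neighbours v∈)) u∉C)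

module _ {C : FinSet} {b : ℕ} (∂C : HasCard (InBoundary C) b) where
  private
    L : List Pt
    L = proj₁ ∂C
    |L|≡ : length L ≡ b
    |L|≡ = proj₁ (proj₂ (proj₂ ∂C))
    L⇔∂C : ∀ u → (u ∈ L) ⇔ InBoundary C u
    L⇔∂C = proj₂ (proj₂ (proj₂ ∂C))

  closed : ∀ {p q} → p ∈ elems C → Adj p q → q ∈ elems C ⊎ q ∈ L
  closed {p} {q} p∈ p~q with q ∈²? elems C
  ... | yes q∈ = inj₁ q∈
  ... | no q∉ = inj₂ (Equivalence.from (L⇔∂C q) (q∉ , p , p∈ , Adj-sym p q p~q))

  boundary-lower-bound : ∀ {c} → 1 ≤ card C → b ≤ c + 2 → 8 * card C ≤ c * c + 4
  boundary-lower-bound 1≤ b≤ =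
    Classes.Bounded.lower-bound (elems C) L (unique C) closed (subst (_≤ _) (sym |L|≡) b≤) 1≤

  boundary-extremal-box : ∀ {c} → b ≤ c + 2 → 3 ≤ card C → 5 ≤ c → c * c ≤ 8 * card C + 1 →
    ExtremalBox (elems C) c
  boundary-extremal-box b≤ = extremal-box (unique C) closed (subst (_≤ _) (sym |L|≡) b≤)

-- The larger class has one value more in both directions, so both corner coordinates have its
-- parity and no flip is required.
square-congruent : ∀ {A k} → ExtremalBox A (4 * k + 2) →
  8 * length A ≡ (4 * k + 2) * (4 * k + 2) + 4 →
  Congruent (_∈ A) (InB (2 * k) (2 * k))
square-congruent {A} {k} eb 8n≡ with extremal-equality ext a₁≤a₀ (trans (cong (8 *_) size) 8n≡)
  where open ExtremalBox eb
... | p₀≡q₀ , p₁≡q₁ , p₀≡ =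
  Congruent-trans _ (Box m α m' β) (InB (2 * k) (2 * k)) (Congruent-reflexive _ _ box)
    (subst₂ (λ s t → Congruent (Box m α m' β) (InB s t)) (ℕ.suc-injective (trans (sym p+p) p₀+p₁))
      (ℕ.suc-injective (trans (sym q+q) (trans (sym (cong₂ _+_ p₀≡q₀ p₁≡q₁)) p₀+p₁)))
      (Box-corner (trans (par-m p₀≡) (sym (par-m' (trans (sym p₀≡q₀) (trans p₀≡ (cong suc p₁≡q₁))))))))
  where
  open ExtremalBox eb
  open ≡-Reasoning
  e₁ : ∀ p p' → 2 * (p + p') ≡ p + p + (p' + p')
  e₁ = ℕ-Ring.solve-∀
  e₂ : ∀ k → 4 * k + 2 ≡ 2 * suc (2 * k)
  e₂ = ℕ-Ring.solve-∀
  p₀+p₁ : p₀ + p₁ ≡ suc (2 * k)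
  p₀+p₁ = ℕ.*-cancelˡ-≡ _ _ 2 (begin
    2 * (p₀ + p₁)                  ≡⟨ e₁ p₀ p₁ ⟩
    p₀ + p₀ + (p₁ + p₁)          ≡⟨ cong₂ (λ s t → p₀ + s + (p₁ + t)) p₀≡q₀ p₁≡q₁ ⟩
    p₀ + q₀ + (p₁ + q₁)          ≡⟨ Extremal.sum ext ⟩
    4 * k + 2                      ≡⟨ e₂ k ⟩
    2 * suc (2 * k)                ∎)

rectangle-congruent : ∀ {A K} → ExtremalBox A (2 * K + 3) → Congruent (_∈ A) (InB K (K + 1))
rectangle-congruent {A} {K} eb = go (extremal-odd ext)
  where
  open ExtremalBox eb
  side : ∀ {s i j} → s ≡ K + suc i → s ≡ suc j → j ≡ K + i
  side {i = i} s≡ s≡' = ℕ.suc-injective (trans (sym s≡') (trans s≡ (ℕ.+-suc K i)))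
  A≅box : ∀ {α' β'} → α ≡ α' → β ≡ β' → Congruent (_∈ A) (Box m α' m' β')
  A≅box refl refl = Congruent-reflexive _ _ box
  go : (p₀ + p₁ ≡ K + 1 × q₀ + q₁ ≡ K + 2) ⊎ (p₀ + p₁ ≡ K + 2 × q₀ + q₁ ≡ K + 1) →
    Congruent (_∈ A) (InB K (K + 1))
  go (inj₁ (s≡ , t≡)) = Congruent-trans _ (Box m K m' (K + 1)) (InB K (K + 1))
    (A≅box (trans (side s≡ p+p) (ℕ.+-identityʳ K)) (side t≡ q+q)) (Box-odd {m} {m'} K)
  go (inj₂ (s≡ , t≡)) = Congruent-trans _ (Box m (K + 1) m' K) (InB K (K + 1))
    (A≅box (side s≡ p+p) (trans (side t≡ q+q) (ℕ.+-identityʳ K)))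
    (Congruent-trans _ (Box m' K m (K + 1)) (InB K (K + 1)) (Box-swap {m} {m'} {K + 1} {K}) (Box-odd {m'} {m} K))

-- Lattice points listed by diagonal lines

odd₀₁ : ℕ → ℕ
odd₀₁ 0 = 0
odd₀₁ 1 = 1
odd₀₁ (suc (suc u)) = odd₀₁ u

odd₀₁-cases : ∀ u → odd₀₁ u ≡ 0 × odd₀₁ (suc u) ≡ 1 ⊎ odd₀₁ u ≡ 1 × odd₀₁ (suc u) ≡ 0
odd₀₁-cases 0 = inj₁ (refl , refl)
odd₀₁-cases 1 = inj₂ (refl , refl)
odd₀₁-cases (suc (suc u)) = odd₀₁-cases u

odd₀₁-*2 : ∀ r → odd₀₁ (r * 2) ≡ 0
odd₀₁-*2 zero = refl
odd₀₁-*2 (suc r) = odd₀₁-*2 r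

odd₀₁-1+*2 : ∀ r → odd₀₁ (suc (r * 2)) ≡ 1
odd₀₁-1+*2 zero = refl
odd₀₁-1+*2 (suc r) = odd₀₁-1+*2 r

-- The i-th point of the line y − x = u in the half-plane y + x ≥ 0; see ψ-pt.
pt : ℕ → ℕ → Pt
pt 0 i = + i , + i
pt 1 i = + i , + suc i
pt (suc (suc u)) i = proj₁ (pt u i) ℤ.- 1ℤ , proj₂ (pt u i) ℤ.+ 1ℤ

ψ-pt : ∀ u i → ψ (pt u i) ≡ (+ u , + (i + i + odd₀₁ u))
ψ-pt 0 i = cong₂ _,_ (x-x≡0 (+ i)) (cong +_ (sym (ℕ.+-identityʳ (i + i))))
ψ-pt 1 i = cong₂ _,_ (e (+ i)) (cong +_ (ℕ.+-comm 1 (i + i)))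
  where
  e : ∀ x → 1ℤ ℤ.+ x ℤ.- x ≡ 1ℤ
  e = ℤ-Ring.solve-∀
ψ-pt (suc (suc u)) i = cong₂ _,_
  (trans (e₁ (proj₁ (pt u i)) (proj₂ (pt u i))) (cong (λ z → + 2 ℤ.+ z) (cong proj₁ (ψ-pt u i))))
  (trans (e₂ (proj₁ (pt u i)) (proj₂ (pt u i))) (cong proj₂ (ψ-pt u i)))
  where
  e₁ : ∀ x y → y ℤ.+ 1ℤ ℤ.- (x ℤ.- 1ℤ) ≡ + 2 ℤ.+ (y ℤ.- x)
  e₁ = ℤ-Ring.solve-∀
  e₂ : ∀ x y → y ℤ.+ 1ℤ ℤ.+ (x ℤ.- 1ℤ) ≡ y ℤ.+ x
  e₂ = ℤ-Ring.solve-∀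

double-injectiveℕ : ∀ {i j} → i + i ≡ j + j → i ≡ j
double-injectiveℕ {i} {j} eq = ℕ.*-cancelˡ-≡ i j 2 (trans (e i) (trans eq (sym (e j))))
  where
  e : ∀ i → 2 * i ≡ i + i
  e = ℕ-Ring.solve-∀

pt-injective : ∀ {u i u' i'} → pt u i ≡ pt u' i' → u ≡ u' × i ≡ i'
pt-injective {u} {i} {u'} {i'} eq = go (ℤ.+-injective (cong proj₁ ψ≡)) (ℤ.+-injective (cong proj₂ ψ≡))
  where
  ψ≡ : (+ u , + (i + i + odd₀₁ u)) ≡ (+ u' , + (i' + i' + odd₀₁ u'))
  ψ≡ = trans (sym (ψ-pt u i)) (trans (cong ψ eq) (ψ-pt u' i'))
  go : u ≡ u' → i + i + odd₀₁ u ≡ i' + i' + odd₀₁ u' → u ≡ u' × i ≡ i'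
  go refl eq = refl , double-injectiveℕ (ℕ.+-cancelʳ-≡ (odd₀₁ u) _ _ eq)

Stepℕ : ℕ → ℕ → Set
Stepℕ a b = a ≡ b + 1 ⊎ b ≡ a + 1

Stepℕ⇒Step : ∀ {a b} → Stepℕ a b → Step (+ a) (+ b)
Stepℕ⇒Step {b = b} (inj₁ refl) = inj₁ (sym (x+1-1≡x (+ b)))
Stepℕ⇒Step (inj₂ refl) = inj₂ refl

Step⇒Stepℕ : ∀ {a b} → Step (+ a) (+ b) → Stepℕ a b
Step⇒Stepℕ {a} {b} (inj₁ eq) = inj₁ (ℤ.+-injective (trans (sym (x-1+1≡x (+ a))) (cong (ℤ._+ 1ℤ) (sym eq))))
Step⇒Stepℕ (inj₂ eq) = inj₂ (ℤ.+-injective eq)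

Diagonal⇒Adj′ : ∀ p q → Diagonal (ψ p) (ψ q) → Adj p q
Diagonal⇒Adj′ p q d = let q' , ψ≡ , p~q' = Diagonal⇒Adj p d in subst (Adj p) (ψ-injective ψ≡) p~q'

adj-pt : ∀ {u i u' i'} → Stepℕ u u' → Stepℕ (i + i + odd₀₁ u) (i' + i' + odd₀₁ u') →
  Adj (pt u i) (pt u' i')
adj-pt {u} {i} {u'} {i'} su sv = Diagonal⇒Adj′ (pt u i) (pt u' i')
  (subst₂ Diagonal (sym (ψ-pt u i)) (sym (ψ-pt u' i')) (Stepℕ⇒Step su , Stepℕ⇒Step sv))

adj-pt⁻ : ∀ u i u' i' → Adj (pt u i) (pt u' i') →
  Stepℕ u u' × Stepℕ (i + i + odd₀₁ u) (i' + i' + odd₀₁ u')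
adj-pt⁻ u i u' i' p~q with subst₂ Diagonal (ψ-pt u i) (ψ-pt u' i') (Adj⇒Diagonal (pt u i) (pt u' i') p~q)
... | su , sv = Step⇒Stepℕ su , Step⇒Stepℕ sv

adj-next : ∀ u i → Adj (pt u i) (pt (suc u) i)
adj-next u i = adj-pt (inj₂ (ℕ.+-comm 1 u)) (go (odd₀₁-cases u))
  where
  go : odd₀₁ u ≡ 0 × odd₀₁ (suc u) ≡ 1 ⊎ odd₀₁ u ≡ 1 × odd₀₁ (suc u) ≡ 0 →
    Stepℕ (i + i + odd₀₁ u) (i + i + odd₀₁ (suc u))
  go (inj₁ (eq , eq')) rewrite eq | eq' = inj₂ (cong (_+ 1) (sym (ℕ.+-identityʳ (i + i))))
  go (inj₂ (eq , eq')) rewrite eq | eq' = inj₁ (cong (_+ 1) (sym (ℕ.+-identityʳ (i + i))))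

double-suc : ∀ i → suc i + suc i + 0 ≡ i + i + 1 + 1
double-suc = ℕ-Ring.solve-∀

adj-next-even : ∀ u i → odd₀₁ u ≡ 0 → Adj (pt u (suc i)) (pt (suc u) i)
adj-next-even u i u-even = adj-pt (inj₂ (ℕ.+-comm 1 u)) (go (odd₀₁-cases u))
  where
  go : odd₀₁ u ≡ 0 × odd₀₁ (suc u) ≡ 1 ⊎ odd₀₁ u ≡ 1 × odd₀₁ (suc u) ≡ 0 →
    Stepℕ (suc i + suc i + odd₀₁ u) (i + i + odd₀₁ (suc u))
  go (inj₁ (eq , eq')) rewrite eq | eq' = inj₁ (double-suc i)
  go (inj₂ (eq , _)) = contradiction (trans (sym u-even) eq) λ ()

adj-next-odd : ∀ u i → odd₀₁ u ≡ 1 → Adj (pt u i) (pt (suc u) (suc i))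
adj-next-odd u i u-odd = adj-pt (inj₂ (ℕ.+-comm 1 u)) (go (odd₀₁-cases u))
  where
  go : odd₀₁ u ≡ 0 × odd₀₁ (suc u) ≡ 1 ⊎ odd₀₁ u ≡ 1 × odd₀₁ (suc u) ≡ 0 →
    Stepℕ (i + i + odd₀₁ u) (suc i + suc i + odd₀₁ (suc u))
  go (inj₂ (eq , eq')) rewrite eq | eq' = inj₂ (double-suc i)
  go (inj₁ (eq , _)) = contradiction (trans (sym u-odd) eq) λ ()

Stepℕ-suc : ∀ {u u'} → Stepℕ u u' → u ≡ suc u' ⊎ u' ≡ suc u
Stepℕ-suc {u' = u'} (inj₁ eq) = inj₁ (trans eq (ℕ.+-comm u' 1))
Stepℕ-suc {u} (inj₂ eq) = inj₂ (trans eq (ℕ.+-comm u 1))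

odd₀₁-step : ∀ {u u'} → u ≡ suc u' ⊎ u' ≡ suc u → odd₀₁ u ≡ 0 × odd₀₁ u' ≡ 1 ⊎ odd₀₁ u ≡ 1 × odd₀₁ u' ≡ 0
odd₀₁-step {u} (inj₂ refl) = odd₀₁-cases u
odd₀₁-step {u' = u'} (inj₁ refl) with odd₀₁-cases u'
... | inj₁ (eq , eq') = inj₂ (eq' , eq)
... | inj₂ (eq , eq') = inj₁ (eq' , eq)

-- Point `i` of an even line has `v = 2i`, between the points `i − 1` and `i` of the adjacent odd
-- lines at `2i ∓ 1`.
adj-even⁻ : ∀ u i u' i' → odd₀₁ u ≡ 0 → Adj (pt u i) (pt u' i') →
  (u ≡ suc u' ⊎ u' ≡ suc u) × (i ≡ i' ⊎ i ≡ suc i')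
adj-even⁻ u i u' i' u-even p~q with adj-pt⁻ u i u' i' p~q
... | su , sv with Stepℕ-suc su
... | near with odd₀₁-step near
... | inj₂ (eq , _) = contradiction (trans (sym u-even) eq) λ ()
... | inj₁ (eq , eq') rewrite eq | eq' = near , go sv
  where
  go : Stepℕ (i + i + 0) (i' + i' + 1) → i ≡ i' ⊎ i ≡ suc i'
  go (inj₁ h) = inj₂ (double-injectiveℕ (ℕ.+-cancelʳ-≡ 0 _ _ (trans h (sym (double-suc i')))))
  go (inj₂ h) = inj₁ (double-injectiveℕ (sym (trans (ℕ.+-cancelʳ-≡ 1 _ _ h) (ℕ.+-identityʳ (i + i)))))

adj-odd⁻ : ∀ u i u' i' → odd₀₁ u ≡ 1 → Adj (pt u i) (pt u' i') →
  (u ≡ suc u' ⊎ u' ≡ suc u) × (i' ≡ i ⊎ i' ≡ suc i)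
adj-odd⁻ u i u' i' u-odd p~q with Stepℕ-suc (proj₁ (adj-pt⁻ u i u' i' p~q))
... | near with odd₀₁-step near
... | inj₁ (eq , _) = contradiction (trans (sym u-odd) eq) λ ()
... | inj₂ (_ , u'-even) = near , proj₂ (adj-even⁻ u' i' u i u'-even (Adj-sym (pt u i) (pt u' i') p~q))

row : ℕ → ℕ → List Pt
row u l = map (pt u) (upTo l)

rows : (ℕ → ℕ) → ℕ → List Pt
rows ℓ zero = []
rows ℓ (suc ρ) = rows ℓ ρ ++ row ρ (ℓ ρ)

total : (ℕ → ℕ) → ℕ → ℕ
total ℓ zero = 0
total ℓ (suc ρ) = total ℓ ρ + ℓ ρ

shape : (ℕ → ℕ) → ℕ → ℕ → List Pt
shape ℓ ρ j = rows ℓ ρ ++ row ρ j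

data InShape (ℓ : ℕ → ℕ) (ρ j u i : ℕ) : Set where
  body : u < ρ → i < ℓ u → InShape ℓ ρ j u i
  last : u ≡ ρ → i < j → InShape ℓ ρ j u i

∈-row⁺ : ∀ {u l i} → i < l → pt u i ∈ row u l
∈-row⁺ {u} i<l = ∈-map⁺ (pt u) (∈-upTo⁺ i<l)

∈-row⁻ : ∀ {u l p} → p ∈ row u l → ∃[ i ] (i < l × p ≡ pt u i)
∈-row⁻ {u} p∈ = let i , i∈ , eq = ∈-map⁻ (pt u) p∈ in i , ∈-upTo⁻ i∈ , eq

∈-rows⁺ : ∀ {ℓ ρ u i} → u < ρ → i < ℓ u → pt u i ∈ rows ℓ ρ
∈-rows⁺ {ℓ} {suc ρ} {u} u<1+ρ i<ℓ with u ℕ.≟ ρ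
... | yes refl = ∈-++⁺ʳ (rows ℓ ρ) (∈-row⁺ i<ℓ)
... | no u≢ρ = ∈-++⁺ˡ (∈-rows⁺ (ℕ.≤∧≢⇒< (ℕ.≤-pred u<1+ρ) u≢ρ) i<ℓ)

∈-rows⁻ : ∀ {ℓ} ρ {p} → p ∈ rows ℓ ρ → ∃[ u ] ∃[ i ] (u < ρ × i < ℓ u × p ≡ pt u i)
∈-rows⁻ {ℓ} (suc ρ) p∈ with ∈-++⁻ (rows ℓ ρ) p∈
... | inj₁ p∈ˡ = let u , i , u<ρ , i<ℓ , eq = ∈-rows⁻ ρ p∈ˡ in u , i , ℕ.m<n⇒m<1+n u<ρ , i<ℓ , eq
... | inj₂ p∈ʳ = let i , i<ℓ , eq = ∈-row⁻ p∈ʳ in ρ , i , ℕ.n<1+n ρ , i<ℓ , eq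

∈-shape⁺ : ∀ {ℓ ρ j u i} → InShape ℓ ρ j u i → pt u i ∈ shape ℓ ρ j
∈-shape⁺ (body u<ρ i<ℓ) = ∈-++⁺ˡ (∈-rows⁺ u<ρ i<ℓ)
∈-shape⁺ {ℓ} {ρ} (last refl i<j) = ∈-++⁺ʳ (rows ℓ ρ) (∈-row⁺ i<j)

∈-shape⁻ : ∀ {ℓ ρ j p} → p ∈ shape ℓ ρ j → ∃[ u ] ∃[ i ] (InShape ℓ ρ j u i × p ≡ pt u i)
∈-shape⁻ {ℓ} {ρ} p∈ with ∈-++⁻ (rows ℓ ρ) p∈
... | inj₁ p∈ˡ = let u , i , u<ρ , i<ℓ , eq = ∈-rows⁻ ρ p∈ˡ in u , i , body u<ρ i<ℓ , eq
... | inj₂ p∈ʳ = let i , i<j , eq = ∈-row⁻ p∈ʳ in ρ , i , last refl i<j , eq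

row-! : ∀ u l → Unique (row u l)
row-! u l = Unique.map⁺ (λ eq → proj₂ (pt-injective {u} {u' = u} eq)) (Unique.upTo⁺ l)

rows-++-! : ∀ {ℓ} ρ l → Unique (rows ℓ ρ) → Unique (rows ℓ ρ ++ row ρ l)
rows-++-! {ℓ} ρ l rows! = Unique.++⁺ rows! (row-! ρ l) disjoint
  where
  disjoint : ∀ {p} → ¬ (p ∈ rows ℓ ρ × p ∈ row ρ l)
  disjoint (p∈ , p∈') with ∈-rows⁻ ρ p∈ | ∈-row⁻ p∈'
  ... | u , i , u<ρ , _ , refl | i' , _ , eq = ℕ.<⇒≢ u<ρ (proj₁ (pt-injective {u} {i} eq))

rows-! : ∀ ℓ ρ → Unique (rows ℓ ρ)
rows-! ℓ zero = []
rows-! ℓ (suc ρ) = rows-++-! ρ (ℓ ρ) (rows-! ℓ ρ)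

length-row : ∀ u l → length (row u l) ≡ l
length-row u l = trans (length-map (pt u) (upTo l)) (length-upTo l)

length-rows : ∀ ℓ ρ → length (rows ℓ ρ) ≡ total ℓ ρ
length-rows ℓ zero = refl
length-rows ℓ (suc ρ) = trans (length-++ (rows ℓ ρ)) (cong₂ _+_ (length-rows ℓ ρ) (length-row ρ (ℓ ρ)))

length-shape : ∀ ℓ ρ j → length (shape ℓ ρ j) ≡ total ℓ ρ + j
length-shape ℓ ρ j = trans (length-++ (rows ℓ ρ)) (cong₂ _+_ (length-rows ℓ ρ) (length-row ρ j))

shapeSet : (ℕ → ℕ) → ℕ → ℕ → FinSet
shapeSet ℓ ρ j = finset (shape ℓ ρ j) (rows-++-! ρ j (rows-! ℓ ρ))

-- Upper bounds for the boundaries of strips and zigzags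

up : Pt → Pt
up (x , y) = x , y ℤ.+ 1ℤ

up-injective : ∀ {p q} → up p ≡ up q → p ≡ q
up-injective {x , y} {x' , y'} eq = cong₂ _,_ (cong proj₁ eq)
  (trans (sym (x+1-1≡x y)) (trans (cong (λ z → z ℤ.- 1ℤ) (cong proj₂ eq)) (x+1-1≡x y')))

ψ-up : ∀ p → ψ (up p) ≡ (proj₁ (ψ p) ℤ.+ 1ℤ , proj₂ (ψ p) ℤ.+ 1ℤ)
ψ-up (x , y) = cong₂ _,_ (e₁ x y) (e₂ x y)
  where
  e₁ : ∀ x y → y ℤ.+ 1ℤ ℤ.- x ≡ y ℤ.- x ℤ.+ 1ℤ
  e₁ = ℤ-Ring.solve-∀
  e₂ : ∀ x y → y ℤ.+ 1ℤ ℤ.+ x ≡ y ℤ.+ x ℤ.+ 1ℤ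
  e₂ = ℤ-Ring.solve-∀

up-pt : ∀ u i → up (pt u i) ≡ pt (suc u) (i + odd₀₁ u)
up-pt u i = ψ-injective (trans (ψ-up (pt u i)) (trans (cong (λ (s , t) → s ℤ.+ 1ℤ , t ℤ.+ 1ℤ) (ψ-pt u i))
  (trans (cong₂ (λ s t → + s , + t) (ℕ.+-comm u 1) (go (odd₀₁-cases u))) (sym (ψ-pt (suc u) (i + odd₀₁ u))))))
  where
  e : ∀ i → i + i + 1 + 1 ≡ i + 1 + (i + 1) + 0
  e = ℕ-Ring.solve-∀
  e' : ∀ i → i + i + 0 + 1 ≡ i + 0 + (i + 0) + 1
  e' = ℕ-Ring.solve-∀
  go : odd₀₁ u ≡ 0 × odd₀₁ (suc u) ≡ 1 ⊎ odd₀₁ u ≡ 1 × odd₀₁ (suc u) ≡ 0 →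
    i + i + odd₀₁ u + 1 ≡ i + odd₀₁ u + (i + odd₀₁ u) + odd₀₁ (suc u)
  go (inj₁ (eq , eq')) rewrite eq | eq' = e' i
  go (inj₂ (eq , eq')) rewrite eq | eq' = e i

-- A neighbour can have `u = −1` or `v = −1`, outside the range of `pt`; `up` adds one to both
-- coordinates and brings it back. The resulting line has the parity of `u` again, so no case
-- distinction on parity arises.
up-adj-pt : ∀ u i q → Adj (pt u i) q →
  ∃[ u' ] ∃[ i' ] ((u' ≡ u ⊎ u' ≡ 2 + u) × (i' ≡ i ⊎ i' ≡ suc i) × up q ≡ pt u' i')
up-adj-pt u i q p~q = go (proj₁ d) (proj₂ d)
  where
  v : ℕ
  v = i + i + odd₀₁ u
  d : Diagonal (+ u , + v) (ψ q)
  d = subst (λ z → Diagonal z (ψ q)) (ψ-pt u i) (Adj⇒Diagonal (pt u i) q p~q)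
  at : ∀ u' i' {s t} → proj₁ (ψ q) ≡ s → proj₂ (ψ q) ≡ t → s ℤ.+ 1ℤ ≡ + u' → t ℤ.+ 1ℤ ≡ + (i' + i' + odd₀₁ u') →
    up q ≡ pt u' i'
  at u' i' eu ev eu' ev' = ψ-injective (trans (ψ-up q) (trans
    (cong₂ _,_ (trans (cong (ℤ._+ 1ℤ) eu) eu') (trans (cong (ℤ._+ 1ℤ) ev) ev')) (sym (ψ-pt u' i'))))
  e : ∀ i o → i + i + o + 1 + 1 ≡ suc i + suc i + o
  e = ℕ-Ring.solve-∀
  e₂ : u + 1 + 1 ≡ 2 + u
  e₂ = trans (ℕ.+-assoc u 1 1) (ℕ.+-comm u 2)
  go : Step (+ u) (proj₁ (ψ q)) → Step (+ v) (proj₂ (ψ q)) → _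
  go (inj₁ eu) (inj₁ ev) = u , i , inj₁ refl , inj₁ refl , at u i eu ev (x-1+1≡x (+ u)) (x-1+1≡x (+ v))
  go (inj₁ eu) (inj₂ ev) = u , suc i , inj₁ refl , inj₂ refl ,
    at u (suc i) eu ev (x-1+1≡x (+ u)) (cong +_ (e i (odd₀₁ u)))
  go (inj₂ eu) (inj₁ ev) = 2 + u , i , inj₂ refl , inj₁ refl ,
    at (2 + u) i eu ev (cong +_ e₂) (x-1+1≡x (+ v))
  go (inj₂ eu) (inj₂ ev) = 2 + u , suc i , inj₂ refl , inj₂ refl ,
    at (2 + u) (suc i) eu ev (cong +_ e₂) (cong +_ (e i (odd₀₁ u)))

-- The first two bounds make room for the shifted neighbours of the `i`-th point of line `u` (see
-- `up-adj-pt`), the third for the shifted point itself (see `up-pt`).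
Grows : (ℕ → ℕ) → (ℕ → ℕ) → Set
Grows ℓ ℓ' = ∀ u {i} → i < ℓ u → suc i < ℓ' u × suc i < ℓ' (2 + u) × i + odd₀₁ u < ℓ' (suc u)

-- Moved up by one, the closed neighbourhood of a shape lies in a shape of the same kind.
boundary-upper-bound : ∀ {ℓ ℓ' ρ j b} → j ≤ ℓ ρ → Grows ℓ ℓ' → HasCard (InBoundary (shapeSet ℓ ρ j)) b →
  b + (total ℓ ρ + j) ≤ total ℓ' (2 + ρ) + suc j
boundary-upper-bound {ℓ} {ℓ'} {ρ} {j} {b} j≤ grows (L , L! , |L|≡ , L⇔) = begin
  b + (total ℓ ρ + j)               ≡⟨ cong₂ _+_ |L|≡ (length-shape ℓ ρ j) ⟨
  length L + length A                 ≡⟨ length-++ L ⟨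
  length (L ++ A)                       ≡⟨ length-map up (L ++ A) ⟨
  length (map up (L ++ A))              ≤⟨ length-mono-⊆ (Unique.map⁺ up-injective N!) sub ⟩
  length (shape ℓ' (2 + ρ) (suc j))   ≡⟨ length-shape ℓ' (2 + ρ) (suc j) ⟩
  total ℓ' (2 + ρ) + suc j          ∎
  where
  open ℕ.≤-Reasoning
  A = shape ℓ ρ j
  N! : Unique (L ++ A)
  N! = Unique.++⁺ L! (unique (shapeSet ℓ ρ j)) λ (x∈L , x∈A) → proj₁ (Equivalence.to (L⇔ _) x∈L) x∈A
  in-row : ∀ {u i} → InShape ℓ ρ j u i → u ≤ ρ × i < ℓ u
  in-row (body u<ρ i<ℓ) = ℕ.<⇒≤ u<ρ , i<ℓ
  in-row (last refl i<j) = ℕ.≤-refl , ℕ.<-≤-trans i<j j≤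
  sub-A : ∀ {u i} → InShape ℓ ρ j u i → InShape ℓ' (2 + ρ) (suc j) (suc u) (i + odd₀₁ u)
  sub-A {u} h = let u≤ρ , i<ℓ = in-row h in body (s≤s (s≤s u≤ρ)) (proj₂ (proj₂ (grows u i<ℓ)))
  le : ∀ {i i'} → i' ≡ i ⊎ i' ≡ suc i → i' ≤ suc i
  le (inj₁ refl) = ℕ.n≤1+n _
  le (inj₂ refl) = ℕ.≤-refl
  sub-L : ∀ {u i u' i'} → InShape ℓ ρ j u i → (u' ≡ u ⊎ u' ≡ 2 + u) → (i' ≡ i ⊎ i' ≡ suc i) →
    InShape ℓ' (2 + ρ) (suc j) u' i'
  sub-L {u} h (inj₁ refl) i'≡ = let u≤ρ , i<ℓ = in-row h in
    body (ℕ.m≤n⇒m≤1+n (s≤s u≤ρ)) (ℕ.≤-<-trans (le i'≡) (proj₁ (grows u i<ℓ)))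
  sub-L {u} (body u<ρ i<ℓ) (inj₂ refl) i'≡ =
    body (s≤s (s≤s u<ρ)) (ℕ.≤-<-trans (le i'≡) (proj₁ (proj₂ (grows u i<ℓ))))
  -- Line `2 + ρ` is reached from the incomplete line only, which becomes longer by one point there.
  sub-L (last refl i<j) (inj₂ refl) (inj₁ refl) = last refl (ℕ.m<n⇒m<1+n i<j)
  sub-L (last refl i<j) (inj₂ refl) (inj₂ refl) = last refl (s≤s i<j)
  sub : map up (L ++ A) ⊆ shape ℓ' (2 + ρ) (suc j)
  sub x∈ with ∈-map⁻ up x∈
  ... | q , q∈ , refl with ∈-++⁻ L q∈
  sub x∈ | q , q∈ , refl | inj₂ q∈A with ∈-shape⁻ q∈A
  ... | u , i , h , refl = subst (_∈ _) (sym (up-pt u i)) (∈-shape⁺ (sub-A h))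
  sub x∈ | q , q∈ , refl | inj₁ q∈L with Equivalence.to (L⇔ q) q∈L
  ... | _ , v , v∈ , q~v with ∈-shape⁻ v∈
  ... | u , i , h , refl with up-adj-pt u i q (Adj-sym q (pt u i) q~v)
  ... | u' , i' , u'≡ , i'≡ , eq = subst (_∈ _) (sym eq) (∈-shape⁺ (sub-L h u'≡ i'≡))

odd₀₁≤1 : ∀ u → odd₀₁ u ≤ 1
odd₀₁≤1 u with odd₀₁-cases u
... | inj₁ (eq , _) rewrite eq = z≤n
... | inj₂ (eq , _) rewrite eq = s≤s z≤n

strip late-strip zigzag : ℕ → ℕ → ℕ
strip h u = h
late-strip h zero = 0
late-strip h (suc u) = h
zigzag h u = h + odd₀₁ (suc u)

i+odd< : ∀ {i h} u → i < h → i + odd₀₁ u < suc h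
i+odd< {i} u i<h = ℕ.≤-trans (s≤s (ℕ.≤-trans (ℕ.+-monoʳ-≤ i (odd₀₁≤1 u)) (ℕ.≤-reflexive (ℕ.+-comm i 1)))) (s≤s i<h)

strip-grows : ∀ h → Grows (strip h) (strip (suc h))
strip-grows h u i<h = s≤s i<h , s≤s i<h , i+odd< u i<h

late-strip-grows : ∀ h → Grows (late-strip h) (late-strip (suc h))
late-strip-grows h (suc u) i<h = s≤s i<h , s≤s i<h , i+odd< (suc u) i<h

zigzag-grows : ∀ h → Grows (zigzag h) (zigzag (suc h))
zigzag-grows h u {i} i<ℓ = s≤s i<ℓ , s≤s i<ℓ ,
  ℕ.+-monoˡ-≤ (odd₀₁ u) (ℕ.≤-trans i<ℓ (ℕ.≤-trans (ℕ.+-monoʳ-≤ h (odd₀₁≤1 (suc u))) (ℕ.≤-reflexive (ℕ.+-comm h 1))))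

total-strip : ∀ h ρ → total (strip h) ρ ≡ ρ * h
total-strip h zero = refl
total-strip h (suc ρ) = trans (cong (_+ h) (total-strip h ρ)) (ℕ.+-comm (ρ * h) h)

total-late-strip : ∀ h ρ → total (late-strip h) (suc ρ) ≡ ρ * h
total-late-strip h zero = refl
total-late-strip h (suc ρ) = trans (cong (_+ h) (total-late-strip h ρ)) (ℕ.+-comm (ρ * h) h)

total-zigzag : ∀ h r → total (zigzag h) (r * 2) ≡ r * (2 * h + 1)
total-zigzag h zero = refl
total-zigzag h (suc r) rewrite total-zigzag h r | odd₀₁-*2 r | odd₀₁-1+*2 r = e h r
  where
  e : ∀ h r → r * (2 * h + 1) + (h + 1) + (h + 0) ≡ suc r * (2 * h + 1)
  e = ℕ-Ring.solve-∀

strip-boundary : ∀ h ρ j {b} → j ≤ h → HasCard (InBoundary (shapeSet (strip h) ρ j)) b → b ≤ ρ + 2 * h + 3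
strip-boundary h ρ j {b} j≤h ∂ = ℕ.+-cancelʳ-≤ (ρ * h + j) _ _ (begin
  b + (ρ * h + j)                            ≡⟨ cong (λ t → b + (t + j)) (total-strip h ρ) ⟨
  b + (total (strip h) ρ + j)                  ≤⟨ boundary-upper-bound j≤h (strip-grows h) ∂ ⟩
  total (strip (suc h)) (2 + ρ) + suc j        ≡⟨ cong (_+ suc j) (total-strip (suc h) (2 + ρ)) ⟩
  (2 + ρ) * suc h + suc j                    ≡⟨ e h ρ j ⟩
  ρ + 2 * h + 3 + (ρ * h + j)          ∎)
  where
  open ℕ.≤-Reasoning
  e : ∀ h ρ j → (2 + ρ) * suc h + suc j ≡ ρ + 2 * h + 3 + (ρ * h + j)
  e = ℕ-Ring.solve-∀

late-strip-boundary : ∀ h ρ j {b} → j ≤ h → HasCard (InBoundary (shapeSet (late-strip h) (suc ρ) j)) b →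
  b ≤ ρ + 2 * h + 3
late-strip-boundary h ρ j {b} j≤h ∂ = ℕ.+-cancelʳ-≤ (ρ * h + j) _ _ (begin
  b + (ρ * h + j)                            ≡⟨ cong (λ t → b + (t + j)) (total-late-strip h ρ) ⟨
  b + (total (late-strip h) (suc ρ) + j)       ≤⟨ boundary-upper-bound j≤h (late-strip-grows h) ∂ ⟩
  total (late-strip (suc h)) (3 + ρ) + suc j   ≡⟨ cong (_+ suc j) (total-late-strip (suc h) (2 + ρ)) ⟩
  (2 + ρ) * suc h + suc j                    ≡⟨ e h ρ j ⟩
  ρ + 2 * h + 3 + (ρ * h + j)          ∎)
  where
  open ℕ.≤-Reasoning
  e : ∀ h ρ j → (2 + ρ) * suc h + suc j ≡ ρ + 2 * h + 3 + (ρ * h + j)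
  e = ℕ-Ring.solve-∀

zigzag-boundary : ∀ h r j {b} → j ≤ h + 1 → HasCard (InBoundary (shapeSet (zigzag h) (r * 2) j)) b →
  b ≤ 2 * h + 2 * r + 4
zigzag-boundary h r j {b} j≤ ∂ = ℕ.+-cancelʳ-≤ (r * (2 * h + 1) + j) _ _ (begin
  b + (r * (2 * h + 1) + j)                    ≡⟨ cong (λ t → b + (t + j)) (total-zigzag h r) ⟨
  b + (total (zigzag h) (r * 2) + j)               ≤⟨ boundary-upper-bound (subst (λ t → j ≤ h + t) (sym (odd₀₁-1+*2 r)) j≤) (zigzag-grows h) ∂ ⟩
  total (zigzag (suc h)) (suc r * 2) + suc j         ≡⟨ cong (_+ suc j) (total-zigzag (suc h) (suc r)) ⟩
  suc r * (2 * suc h + 1) + suc j                ≡⟨ e h r j ⟩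
  2 * h + 2 * r + 4 + (r * (2 * h + 1) + j) ∎)
  where
  open ℕ.≤-Reasoning
  e : ∀ h r j → suc r * (2 * suc h + 1) + suc j ≡ 2 * h + 2 * r + 4 + (r * (2 * h + 1) + j)
  e = ℕ-Ring.solve-∀

-- Leaves

-- Isolated points count as leaves.
Leaf : (Pt → Set) → Pt → Set
Leaf S p = S p × (∀ q q' → S q → S q' → Adj p q → Adj p q' → q ≡ q')

Leaf-congruent : ∀ {S T} ((φ , _) : Congruent S T) → ∀ {p} → Leaf S p → Leaf T (fun φ p)
Leaf-congruent {S} {T} (φ , S⇔T) {p} (p∈ , unique-nbr) = Equivalence.to (S⇔T p) p∈ , λ q q' q∈ q'∈ p~q p~q' →
  trans (sym (fun-inv φ q)) (trans (cong (fun φ)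
    (unique-nbr (inv φ q) (inv φ q') (pull q∈) (pull q'∈) (pull-adj p~q) (pull-adj p~q'))) (fun-inv φ q'))
  where
  pull : ∀ {q} → T q → S (inv φ q)
  pull {q} q∈ = Equivalence.from (S⇔T (inv φ q)) (subst T (sym (fun-inv φ q)) q∈)
  pull-adj : ∀ {q} → Adj (fun φ p) q → Adj p (inv φ q)
  pull-adj {q} p~q = Equivalence.from (adj φ p (inv φ q)) (subst (Adj (fun φ p)) (sym (fun-inv φ q)) p~q)

-- One-sided bounds are enough to tell two sets apart and avoid an exact count of leaves.
ThreeLeaves AtMostTwoLeaves : (Pt → Set) → Set
ThreeLeaves S = ∃[ a ] ∃[ b ] ∃[ c ] (Leaf S a × Leaf S b × Leaf S c × a ≢ b × a ≢ c × b ≢ c)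
AtMostTwoLeaves S = ∃[ a ] ∃[ b ] (∀ p → Leaf S p → p ≡ a ⊎ p ≡ b)

fun-injective : ∀ φ {p q} → fun φ p ≡ fun φ q → p ≡ q
fun-injective φ {p} {q} eq = trans (sym (inv-fun φ p)) (trans (cong (inv φ) eq) (inv-fun φ q))

leaves-differ : ∀ {S T} → ThreeLeaves S → AtMostTwoLeaves T → ¬ Congruent S T
leaves-differ (a , b , c , la , lb , lc , a≢b , a≢c , b≢c) (x , y , only) S≅T@(φ , _)
  with only _ (Leaf-congruent S≅T la) | only _ (Leaf-congruent S≅T lb) | only _ (Leaf-congruent S≅T lc)
... | inj₁ ax | inj₁ bx | _ = a≢b (fun-injective φ (trans ax (sym bx)))
... | inj₂ ay | inj₂ by | _ = a≢b (fun-injective φ (trans ay (sym by)))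
... | inj₁ ax | inj₂ _ | inj₁ cx = a≢c (fun-injective φ (trans ax (sym cx)))
... | inj₁ _ | inj₂ by | inj₂ cy = b≢c (fun-injective φ (trans by (sym cy)))
... | inj₂ _ | inj₁ bx | inj₁ cx = b≢c (fun-injective φ (trans bx (sym cx)))
... | inj₂ ay | inj₁ _ | inj₂ cy = a≢c (fun-injective φ (trans ay (sym cy)))

adj-prev : ∀ u i → Adj (pt (suc u) i) (pt u i)
adj-prev u i = Adj-sym (pt u i) (pt (suc u) i) (adj-next u i)

adj-prev-even : ∀ u i → odd₀₁ u ≡ 0 → Adj (pt (suc u) i) (pt u (suc i))
adj-prev-even u i u-even = Adj-sym (pt u (suc i)) (pt (suc u) i) (adj-next-even u i u-even)

adj-prev-odd : ∀ u i → odd₀₁ u ≡ 1 → Adj (pt (suc u) (suc i)) (pt u i)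
adj-prev-odd u i u-odd = Adj-sym (pt u i) (pt (suc u) (suc i)) (adj-next-odd u i u-odd)

shape-leaf : ∀ {ℓ ρ j u i} u₀ i₀ → InShape ℓ ρ j u i →
  (∀ {u' i'} → InShape ℓ ρ j u' i' → Adj (pt u i) (pt u' i') → u' ≡ u₀ × i' ≡ i₀) →
  Leaf (_∈ shape ℓ ρ j) (pt u i)
shape-leaf {ℓ} {ρ} {j} {u} {i} u₀ i₀ h only = ∈-shape⁺ h , λ q q' q∈ q'∈ p~q p~q' →
  trans (at q∈ p~q) (sym (at q'∈ p~q'))
  where
  at : ∀ {q} → q ∈ shape ℓ ρ j → Adj (pt u i) q → q ≡ pt u₀ i₀
  at q∈ p~q with ∈-shape⁻ q∈
  ... | u' , i' , h' , refl with only h' p~q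
  ... | refl , refl = refl

InShape⇒≤ : ∀ {ℓ ρ j u i} → InShape ℓ ρ j u i → u ≤ ρ
InShape⇒≤ (body u<ρ _) = ℕ.<⇒≤ u<ρ
InShape⇒≤ (last refl _) = ℕ.≤-refl

InShape-body : ∀ {ℓ ρ j u i} → u < ρ → InShape ℓ ρ j u i → i < ℓ u
InShape-body u<ρ (body _ i<ℓ) = i<ℓ
InShape-body u<ρ (last refl _) = contradiction refl (ℕ.<⇒≢ u<ρ)

InShape-last : ∀ {ℓ ρ j i} → InShape ℓ ρ j ρ i → i < j
InShape-last (body ρ<ρ _) = contradiction refl (ℕ.<⇒≢ ρ<ρ)
InShape-last (last _ i<j) = i<j

first-leaf : ∀ ℓ ρ j → 0 < ρ → 0 < ℓ 0 → Leaf (_∈ shape ℓ ρ j) (pt 0 0)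
first-leaf ℓ ρ j 0<ρ 0<ℓ = shape-leaf 1 0 (body 0<ρ 0<ℓ) λ {u'} {i'} _ p~q → go (adj-even⁻ 0 0 u' i' refl p~q)
  where
  go : ∀ {u' i'} → (0 ≡ suc u' ⊎ u' ≡ 1) × (0 ≡ i' ⊎ 0 ≡ suc i') → u' ≡ 1 × i' ≡ 0
  go (inj₂ refl , inj₁ refl) = refl , refl

last-leaf : ∀ {ℓ j} r → 0 < j → Leaf (_∈ shape ℓ (suc r * 2) j) (pt (suc r * 2) 0)
last-leaf {ℓ} {j} r 0<j = shape-leaf (suc (r * 2)) 0 (last refl 0<j)
  λ {u'} {i'} h p~q → go h (adj-even⁻ (suc r * 2) 0 u' i' (odd₀₁-*2 (suc r)) p~q)
  where
  go : ∀ {u' i'} → InShape ℓ (suc r * 2) j u' i' →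
    (suc r * 2 ≡ suc u' ⊎ u' ≡ suc (suc r * 2)) × (0 ≡ i' ⊎ 0 ≡ suc i') → u' ≡ suc (r * 2) × i' ≡ 0
  go _ (inj₁ refl , inj₁ refl) = refl , refl
  go h (inj₂ refl , inj₁ refl) = contradiction (InShape⇒≤ h) ℕ.1+n≰n

zigzag-three-leaves : ∀ h r {j} → 0 < j → ThreeLeaves (_∈ shape (zigzag (suc h)) (suc r * 2) j)
zigzag-three-leaves h r {j} 0<j = pt 0 0 , pt 0 (suc h) , pt (suc r * 2) 0 ,
  first-leaf (zigzag (suc h)) (suc r * 2) j (s≤s z≤n) (s≤s z≤n) ,
  shape-leaf 1 h (body (s≤s z≤n) (s≤s (ℕ.≤-reflexive (ℕ.+-comm 1 h)))) (λ {u'} {i'} i p~q → go i (adj-even⁻ 0 (suc h) u' i' refl p~q)) ,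
  last-leaf r 0<j ,
  (λ eq → contradiction (proj₂ (pt-injective {0} {0} {0} {suc h} eq)) λ ()) ,
  (λ eq → contradiction (proj₁ (pt-injective {0} {0} {suc r * 2} {0} eq)) λ ()) ,
  (λ eq → contradiction (proj₁ (pt-injective {0} {suc h} {suc r * 2} {0} eq)) λ ())
  where
  go : ∀ {u' i'} → InShape (zigzag (suc h)) (suc r * 2) j u' i' →
    (0 ≡ suc u' ⊎ u' ≡ 1) × (suc h ≡ i' ⊎ suc h ≡ suc i') → u' ≡ 1 × i' ≡ h
  go i (inj₂ refl , inj₁ refl) =
    contradiction (InShape-body (s≤s (s≤s z≤n)) i) (ℕ.≤⇒≯ (ℕ.≤-reflexive (ℕ.+-identityʳ (suc h))))
  go _ (inj₂ refl , inj₂ refl) = refl , refl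

strip-three-leaves : ∀ h r {j} → 0 < j → j ≤ h → ThreeLeaves (_∈ shape (strip (suc h)) (suc r * 2) j)
strip-three-leaves h r {j} 0<j j≤h = pt 0 0 , pt (suc (r * 2)) h , pt (suc r * 2) 0 ,
  first-leaf (strip (suc h)) (suc r * 2) j (s≤s z≤n) (s≤s z≤n) ,
  shape-leaf (r * 2) h (body (ℕ.n<1+n _) (ℕ.n<1+n h))
    (λ {u'} {i'} i p~q → go i (adj-odd⁻ (suc (r * 2)) h u' i' (odd₀₁-1+*2 r) p~q)) ,
  last-leaf r 0<j ,
  (λ eq → contradiction (proj₁ (pt-injective {0} {0} {suc (r * 2)} {h} eq)) λ ()) ,
  (λ eq → contradiction (proj₁ (pt-injective {0} {0} {suc r * 2} {0} eq)) λ ()) ,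
  (λ eq → contradiction (proj₁ (pt-injective {suc (r * 2)} {h} {suc r * 2} {0} eq)) (ℕ.m≢1+n+m _ {0}))
  where
  go : ∀ {u' i'} → InShape (strip (suc h)) (suc r * 2) j u' i' →
    (suc (r * 2) ≡ suc u' ⊎ u' ≡ suc (suc (r * 2))) × (i' ≡ h ⊎ i' ≡ suc h) → u' ≡ r * 2 × i' ≡ h
  go _ (inj₁ refl , inj₁ refl) = refl , refl
  go i (inj₁ refl , inj₂ refl) = contradiction (InShape-body (ℕ.m<n⇒m<1+n (ℕ.n<1+n _)) i) (ℕ.<-irrefl refl)
  go i (inj₂ refl , inj₁ refl) = contradiction (InShape-last i) (ℕ.≤⇒≯ j≤h)
  go i (inj₂ refl , inj₂ refl) = contradiction (InShape-last i) (ℕ.≤⇒≯ (ℕ.m≤n⇒m≤1+n j≤h))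

not-leaf : ∀ {ℓ ρ j} u i {u₁ i₁ u₂ i₂} → InShape ℓ ρ j u₁ i₁ → InShape ℓ ρ j u₂ i₂ →
  Adj (pt u i) (pt u₁ i₁) → Adj (pt u i) (pt u₂ i₂) → (u₁ ≡ u₂ → i₁ ≡ i₂ → ⊥) →
  ¬ Leaf (_∈ shape ℓ ρ j) (pt u i)
not-leaf _ _ {u₁ = u₁} {i₁} {u₂} {i₂} h₁ h₂ p~q₁ p~q₂ distinct (_ , unique-nbr) =
  let u≡ , i≡ = pt-injective {u₁} {i₁} {u₂} {i₂} (unique-nbr _ _ (∈-shape⁺ h₁) (∈-shape⁺ h₂) p~q₁ p~q₂)
  in distinct u≡ i≡

module _ (ℓ : ℕ → ℕ) (h t j : ℕ) (0<j : 0 < j) (j≤1+h : j ≤ suc h) where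
  private
    ρ = suc (suc t * 2)
    odd-ρ : odd₀₁ ρ ≡ 1
    odd-ρ = odd₀₁-1+*2 (suc t)

  -- A point after a full line has two neighbours on that line, unless it is the first point of an
  -- even line or the last possible point of an odd one. These have one neighbour on the line before
  -- and one on the line after. As the incomplete line `ρ` is odd, the only exception is its own far
  -- end `pt ρ h`.
  interior-leaf : ∀ {u i} → (∀ k → u ≤ k → ℓ k ≡ suc h) → InShape ℓ ρ j (suc u) i →
    Leaf (_∈ shape ℓ ρ j) (pt (suc u) i) → pt (suc u) i ≡ pt ρ h
  interior-leaf {u} {i} full i∈ leaf with odd₀₁-cases u
  interior-leaf {u} {zero} full i∈ leaf | inj₂ (u-odd , u+1-even) = contradiction leaf (not-leaf (suc u) 0
    (body (InShape⇒≤ i∈) (subst (0 <_) (sym (full u ℕ.≤-refl)) (s≤s z≤n)))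
    -- An even line is not the line `ρ`, so a next line exists; `0 < j` makes it nonempty even if it
    -- is `ρ`.
    (next (ℕ.≤∧≢⇒< (InShape⇒≤ i∈) λ { refl → contradiction (trans (sym odd-ρ) u+1-even) λ () }))
    (adj-prev u 0) (adj-next (suc u) 0) λ eq _ → ℕ.m≢1+n+m u {1} eq)
    where
    next : suc u < ρ → InShape ℓ ρ j (2 + u) 0
    next lt with ℕ.m≤n⇒m<n∨m≡n lt
    ... | inj₁ lt' = body lt' (subst (0 <_) (sym (full (2 + u) (ℕ.m≤n+m u 2))) (s≤s z≤n))
    ... | inj₂ refl = last refl 0<j
  interior-leaf {u} {suc i} full i∈ leaf | inj₂ (u-odd , u+1-even) = contradiction leaf (not-leaf (suc u) (suc i)
    (body (InShape⇒≤ i∈) (subst (i <_) (sym (full u ℕ.≤-refl)) (ℕ.<⇒≤ i+1<)))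
    (body (InShape⇒≤ i∈) (subst (suc i <_) (sym (full u ℕ.≤-refl)) i+1<))
    (adj-prev-odd u i u-odd) (adj-prev u (suc i)) λ _ → (ℕ.m≢1+n+m _ {0}))
    where
    i+1< : suc i < suc h
    i+1< = subst (suc i <_) (full (suc u) (ℕ.n≤1+n u)) (InShape-body
      (ℕ.≤∧≢⇒< (InShape⇒≤ i∈) λ { refl → contradiction (trans (sym odd-ρ) u+1-even) λ () }) i∈)
  interior-leaf {u} {i} full i∈ leaf | inj₁ (u-even , u+1-odd) with i ℕ.<? h
  ... | yes i<h = contradiction leaf (not-leaf (suc u) i
    (body (InShape⇒≤ i∈) (subst (i <_) (sym (full u ℕ.≤-refl)) (ℕ.m<n⇒m<1+n i<h)))
    (body (InShape⇒≤ i∈) (subst (suc i <_) (sym (full u ℕ.≤-refl)) (s≤s i<h)))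
    (adj-prev u i) (adj-prev-even u i u-even) λ _ → (ℕ.m≢1+n+m _ {0}))
  ... | no i≮h = go i∈
    where
    go : InShape ℓ ρ j (suc u) i → pt (suc u) i ≡ pt ρ h
    go (last refl i<j) = cong (pt ρ) (ℕ.≤-antisym (ℕ.≤-pred (ℕ.≤-trans i<j j≤1+h)) (ℕ.≮⇒≥ i≮h))
    go (body lt i<ℓ) = contradiction leaf (not-leaf (suc u) i
      (body (InShape⇒≤ i∈) (subst (i <_) (sym (full u ℕ.≤-refl)) i<))
      (body (ℕ.≤∧≢⇒< lt (λ { refl → contradiction (trans (sym odd-ρ) u-even) λ () }))
            (subst (i <_) (sym (full (2 + u) (ℕ.m≤n+m u 2))) i<))
      (adj-prev u i) (adj-next (suc u) i) λ eq _ → ℕ.m≢1+n+m u {1} eq)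
      where
      i< : i < suc h
      i< = subst (i <_) (full (suc u) (ℕ.n≤1+n u)) i<ℓ

strip-two-leaves : ∀ h t {j} → 0 < j → j ≤ suc h → AtMostTwoLeaves (_∈ shape (strip (suc h)) (suc (suc t * 2)) j)
strip-two-leaves h t {j} 0<j j≤1+h = pt 0 0 , pt ρ h , λ p leaf → go p (∈-shape⁻ (proj₁ leaf)) leaf
  where
  ρ = suc (suc t * 2)
  S = _∈ shape (strip (suc h)) ρ j
  go : ∀ p → ∃[ u ] ∃[ i ] (InShape (strip (suc h)) ρ j u i × p ≡ pt u i) → Leaf S p → p ≡ pt 0 0 ⊎ p ≡ pt ρ h
  go _ (zero , zero , _ , refl) _ = inj₁ refl
  go _ (zero , suc i , i∈ , refl) leaf = contradiction leaf (not-leaf {strip (suc h)} {ρ} {j} 0 (suc i)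
    (body (s≤s (s≤s z≤n)) (ℕ.<⇒≤ (InShape-body (s≤s z≤n) i∈))) (body (s≤s (s≤s z≤n)) (InShape-body (s≤s z≤n) i∈))
    (adj-next-even 0 i refl) (adj-next 0 (suc i)) λ _ → (ℕ.m≢1+n+m _ {0}))
  go _ (suc u , i , i∈ , refl) leaf = inj₂ (interior-leaf (strip (suc h)) h t j 0<j j≤1+h (λ _ _ → refl) i∈ leaf)

late-strip-two-leaves : ∀ h t {j} → 0 < j → j ≤ suc h →
  AtMostTwoLeaves (_∈ shape (late-strip (suc h)) (suc (suc t * 2)) j)
late-strip-two-leaves h t {j} 0<j j≤1+h = pt 1 h , pt ρ h , λ p leaf → go p (∈-shape⁻ (proj₁ leaf)) leaf
  where
  ρ = suc (suc t * 2)
  S = _∈ shape (late-strip (suc h)) ρ j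
  go : ∀ p → ∃[ u ] ∃[ i ] (InShape (late-strip (suc h)) ρ j u i × p ≡ pt u i) → Leaf S p → p ≡ pt 1 h ⊎ p ≡ pt ρ h
  go _ (zero , i , i∈ , refl) _ = contradiction (InShape-body (s≤s z≤n) i∈) λ ()
  go _ (suc zero , i , i∈ , refl) leaf with i ℕ.<? h
  ... | yes i<h = contradiction leaf (not-leaf {late-strip (suc h)} {ρ} {j} 1 i
    (body (s≤s (s≤s (s≤s z≤n))) (ℕ.m<n⇒m<1+n i<h)) (body (s≤s (s≤s (s≤s z≤n))) (s≤s i<h))
    (adj-next 1 i) (adj-next-odd 1 i refl) λ _ → (ℕ.m≢1+n+m _ {0}))
  ... | no i≮h = inj₁ (cong (pt 1) (ℕ.≤-antisym (ℕ.≤-pred (InShape-body (s≤s (s≤s z≤n)) i∈)) (ℕ.≮⇒≥ i≮h)))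
  go _ (suc (suc u) , i , i∈ , refl) leaf = inj₂ (interior-leaf (late-strip (suc h)) h t j 0<j j≤1+h {suc u} (λ { (suc k) _ → refl }) i∈ leaf)

-- Minimal sets

card-≤-congruent : ∀ A C → Congruent (_∈ₛ A) (_∈ₛ C) → card A ≤ card C
card-≤-congruent A C (φ , A⇔C) = subst (_≤ card C) (length-map (fun φ) (elems A))
  (length-mono-⊆ (Unique.map⁺ (fun-injective φ) (unique A)) sub)
  where
  sub : map (fun φ) (elems A) ⊆ elems C
  sub q∈ with ∈-map⁻ (fun φ) q∈
  ... | p , p∈ , refl = Equivalence.to (A⇔C p) p∈

card-congruent : ∀ A C → Congruent (_∈ₛ A) (_∈ₛ C) → card A ≡ card C
card-congruent A C A≅C = ℕ.≤-antisym (card-≤-congruent A C A≅C)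
  (card-≤-congruent C A (Congruent-sym (_∈ₛ A) (_∈ₛ C) A≅C))

boundary-congruent : ∀ A C {m} → Congruent (_∈ₛ A) (_∈ₛ C) → HasCard (InBoundary A) m → HasCard (InBoundary C) m
boundary-congruent A C (φ , A⇔C) (L , L! , |L|≡ , L⇔) =
  map (fun φ) L , Unique.map⁺ (fun-injective φ) L! , trans (length-map (fun φ) L) |L|≡ , λ u → mk⇔ (to u) (from u)
  where
  to : ∀ u → u ∈ map (fun φ) L → InBoundary C u
  to u u∈ with ∈-map⁻ (fun φ) u∈
  ... | v , v∈ , refl with Equivalence.to (L⇔ v) v∈
  ... | v∉A , w , w∈A , v~w = (λ v∈C → v∉A (Equivalence.from (A⇔C v) v∈C)) ,
    fun φ w , Equivalence.to (A⇔C w) w∈A , Equivalence.to (adj φ v w) v~w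
  from : ∀ u → InBoundary C u → u ∈ map (fun φ) L
  from u (u∉C , w , w∈C , u~w) = subst (_∈ map (fun φ) L) (fun-inv φ u) (∈-map⁺ (fun φ)
    (Equivalence.from (L⇔ (inv φ u))
      ((λ v∈A → u∉C (subst (_∈ₛ C) (fun-inv φ u) (Equivalence.to (A⇔C _) v∈A))) ,
       inv φ w , Equivalence.from (A⇔C _) (subst (_∈ₛ C) (sym (fun-inv φ w)) w∈C) ,
       Equivalence.from (adj φ (inv φ u) (inv φ w)) (subst₂ Adj (sym (fun-inv φ u)) (sym (fun-inv φ w)) u~w))))

-- By boundary-lower-bound, every set of n points then has more than c + 2 boundary points.
Threshold : ℕ → ℕ → Set
Threshold n c = c * c + 4 < 8 * n

BoundaryAtMost : FinSet → ℕ → Set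
BoundaryAtMost A B = ∀ b → HasCard (InBoundary A) b → b ≤ B

threshold-minimal : ∀ {c} A → 1 ≤ card A → Threshold (card A) c → BoundaryAtMost A (suc c + 2) → Minimal A
threshold-minimal {c} A 1≤ thr ∂A≤ C |C|≡ m n ∂A ∂C = ℕ.≮⇒≥ λ n<m → contradiction
  (boundary-lower-bound {C} ∂C {c} (subst (1 ≤_) (sym |C|≡) 1≤) (ℕ.≤-pred (ℕ.≤-trans n<m (∂A≤ m ∂A))))
  (ℕ.<⇒≱ (subst (λ t → c * c + 4 < 8 * t) (sym |C|≡) thr))

minimal-boundary : ∀ {B} A S → card S ≡ card A → BoundaryAtMost S B → Minimal A → BoundaryAtMost A B
minimal-boundary A S |S|≡ ∂S≤ A-min b ∂A =
  let n , ∂S = boundary S in ℕ.≤-trans (A-min S |S|≡ b n ∂A ∂S) (∂S≤ n ∂S)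

-- `set` is any convenient set of the right size with a small boundary, not `P` itself. Applying
-- `rigid` to `set` makes it congruent to `P`, and size and boundary bound are then transported from
-- it.
record Rigid (P : Pt → Set) : Set where
  field
    set       : FinSet
    {c}       : ℕ
    nonempty  : 1 ≤ card set
    threshold : Threshold (card set) c
    bounded   : BoundaryAtMost set (suc c + 2)
    rigid     : ∀ C → card C ≡ card set → BoundaryAtMost C (suc c + 2) → Congruent (_∈ₛ C) P

rigid-congruent : ∀ {P} (R : Rigid P) A → card A ≡ card (Rigid.set R) → Minimal A → Congruent (_∈ₛ A) P
rigid-congruent R A |A|≡ A-min = rigid A |A|≡ (minimal-boundary A set (sym |A|≡) bounded A-min)
  where open Rigid R

rigid-unique : ∀ {P} (R : Rigid P) A → Congruent (_∈ₛ A) P → UniquelyMinimal A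
rigid-unique {P} R A A≅P = A-min , λ C C-min |C|≡ → Congruent-trans (_∈ₛ C) P (_∈ₛ A)
  (rigid-congruent R C (trans |C|≡ |A|≡) C-min) (Congruent-sym (_∈ₛ A) P A≅P)
  where
  open Rigid R
  A≅set : Congruent (_∈ₛ A) (_∈ₛ set)
  A≅set = Congruent-trans (_∈ₛ A) P (_∈ₛ set) A≅P (Congruent-sym (_∈ₛ set) P (rigid set refl bounded))
  |A|≡ : card A ≡ card set
  |A|≡ = card-congruent A set A≅set
  A-min : Minimal A
  A-min = threshold-minimal A (subst (1 ≤_) (sym |A|≡) nonempty) (subst (λ t → Threshold t c) (sym |A|≡) threshold)
    λ b ∂A → bounded b (boundary-congruent A set A≅set ∂A)

record Ambiguous (n : ℕ) : Set where
  field
    S T       : FinSet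
    {c}       : ℕ
    |S|≡      : card S ≡ n
    |T|≡      : card T ≡ n
    threshold : Threshold n c
    S-bounded : BoundaryAtMost S (suc c + 2)
    T-bounded : BoundaryAtMost T (suc c + 2)
    differ    : ¬ Congruent (_∈ₛ S) (_∈ₛ T)

ambiguous-not-unique : ∀ A → 1 ≤ card A → Ambiguous (card A) → ¬ UniquelyMinimal A
ambiguous-not-unique A 1≤ amb (_ , A-unique) = differ (Congruent-trans (_∈ₛ S) (_∈ₛ A) (_∈ₛ T)
  (A-unique S (minimal S |S|≡ S-bounded) |S|≡)
  (Congruent-sym (_∈ₛ T) (_∈ₛ A) (A-unique T (minimal T |T|≡ T-bounded) |T|≡)))
  where
  open Ambiguous amb
  minimal : ∀ C → card C ≡ card A → BoundaryAtMost C (suc c + 2) → Minimal C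
  minimal C |C|≡ = threshold-minimal C (subst (1 ≤_) (sym |C|≡) 1≤) (subst (λ t → Threshold t c) (sym |C|≡) threshold)

threshold-by : ∀ n c d → suc (c * c + 4) + d ≡ 8 * n → Threshold n c
threshold-by n c d eq = subst (suc (c * c + 4) ≤_) eq (ℕ.m≤m+n _ d)

-- Sizes of strips and zigzags, and rigidity of the boxes

card-strip : ∀ h ρ j → card (shapeSet (strip h) ρ j) ≡ ρ * h + j
card-strip h ρ j = trans (length-shape (strip h) ρ j) (cong (_+ j) (total-strip h ρ))

card-late-strip : ∀ h ρ j → card (shapeSet (late-strip h) (suc ρ) j) ≡ ρ * h + j
card-late-strip h ρ j = trans (length-shape (late-strip h) (suc ρ) j) (cong (_+ j) (total-late-strip h ρ))

card-zigzag : ∀ h r j → card (shapeSet (zigzag h) (r * 2) j) ≡ r * (2 * h + 1) + j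
card-zigzag h r j = trans (length-shape (zigzag h) (r * 2) j) (cong (_+ j) (total-zigzag h r))

-- The size `k² + (k + 1)²` of `B(2k,2k)`, in the form produced by `card-zigzag` for a last line of
-- `k + 1` points.
square-card : ℕ → ℕ
square-card k = k * (2 * k + 1) + suc k

8square-card : ∀ k → 8 * square-card k ≡ (4 * k + 2) * (4 * k + 2) + 4
8square-card = e
  where
  e : ∀ k → 8 * (k * (2 * k + 1) + suc k) ≡ (4 * k + 2) * (4 * k + 2) + 4
  e = ℕ-Ring.solve-∀

length-1 : ∀ {A : Set} (xs : List A) → length xs ≡ 1 → ∃[ x ] xs ≡ x ∷ []
length-1 (x ∷ []) refl = x , refl

square-rigid : ∀ k → Rigid (InB (2 * k) (2 * k))
square-rigid k = record
  { set = S ; c = 4 * k + 1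
  ; nonempty = subst (1 ≤_) (sym (card-zigzag k k (suc k))) (ℕ.≤-trans (s≤s z≤n) (ℕ.m≤n+m (suc k) _))
  ; threshold = subst (λ n → Threshold n (4 * k + 1)) (sym (card-zigzag k k (suc k))) (threshold-by (square-card k) (4 * k + 1) (8 * k + 2) (e₁ k))
  ; bounded = λ b ∂S → ℕ.≤-trans (zigzag-boundary k k (suc k) (ℕ.≤-reflexive (ℕ.+-comm 1 k)) ∂S) (ℕ.≤-reflexive (e₂ k))
  ; rigid = λ C |C|≡ ∂C≤ → rigid k C (trans |C|≡ (card-zigzag k k (suc k)))
      (λ b ∂C → ℕ.≤-trans (∂C≤ b ∂C) (ℕ.≤-reflexive (e₃ k)))
  }
  where
  S = shapeSet (zigzag k) (k * 2) (suc k)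
  e₁ : ∀ k → suc ((4 * k + 1) * (4 * k + 1) + 4) + (8 * k + 2) ≡ 8 * (k * (2 * k + 1) + suc k)
  e₁ = ℕ-Ring.solve-∀
  e₂ : ∀ k → 2 * k + 2 * k + 4 ≡ suc (4 * k + 1) + 2
  e₂ = ℕ-Ring.solve-∀
  e₃ : ∀ k → suc (4 * k + 1) + 2 ≡ 4 * k + 2 + 2
  e₃ = ℕ-Ring.solve-∀
  rigid : ∀ k C → card C ≡ square-card k → BoundaryAtMost C (4 * k + 2 + 2) →
    Congruent (_∈ₛ C) (InB (2 * k) (2 * k))
  -- A single point is treated apart, since the extremal argument needs three points and `c ≥ 5`.
  rigid zero (finset xs _) |C|≡1 _ with length-1 xs |C|≡1
  ... | r , refl = singleton-congruent r
  rigid (suc k) C |C|≡ ∂C≤ = square-congruent {elems C} {suc k}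
    (boundary-extremal-box {C} (proj₂ (boundary C)) (∂C≤ _ (proj₂ (boundary C)))
      (subst (3 ≤_) (sym |C|≡) (ℕ.≤-trans (ℕ.m≤m+n 3 _) (ℕ.≤-reflexive (e₄ k))))
      (ℕ.≤-trans (ℕ.m≤m+n 5 _) (ℕ.≤-reflexive (e₅ k)))
      (ℕ.≤-trans (ℕ.≤-trans (ℕ.m≤m+n _ 4) (ℕ.≤-reflexive (sym 8n≡))) (ℕ.m≤m+n _ 1)))
    8n≡
    where
    8n≡ : 8 * card C ≡ (4 * suc k + 2) * (4 * suc k + 2) + 4
    8n≡ = trans (cong (8 *_) |C|≡) (8square-card (suc k))
    e₄ : ∀ k → 3 + (2 + 2 * k + k * (2 * suc k + 1) + k) ≡ suc k * (2 * suc k + 1) + suc (suc k)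
    e₄ = ℕ-Ring.solve-∀
    e₅ : ∀ k → 5 + (4 * k + 1) ≡ 4 * suc k + 2
    e₅ = ℕ-Ring.solve-∀

half : ∀ K → ∃[ k ] (K ≡ k * 2 ⊎ K ≡ suc (k * 2))
half zero = 0 , inj₁ refl
half (suc K) with half K
... | k , inj₁ refl = k , inj₂ refl
... | k , inj₂ refl = suc k , inj₁ refl

-- `B(K,K+1)` has `K + 1` values of `u` and `K + 2` of `v`. One of these numbers is even, so exactly
-- half of the pairs have equal parities; doubling avoids the division.
IsRectangleCard : ℕ → ℕ → Set
IsRectangleCard K n = 2 * n ≡ (K + 1) * (K + 2)

-- A strip whose last line is complete too. The number of lines is the odd one of `K + 1` and
-- `K + 2`, and half of the even one is the length of a line.
rectangle-set : ∀ K → 1 ≤ K → ∃[ S ] (IsRectangleCard K (card S) × BoundaryAtMost S (2 * K + 5))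
rectangle-set K 1≤K with half K
... | k , inj₁ refl = shapeSet (strip (suc k)) (k * 2) (suc k) ,
  trans (cong (2 *_) (card-strip (suc k) (k * 2) (suc k))) (e₁ k) ,
  λ b ∂S → ℕ.≤-trans (strip-boundary (suc k) (k * 2) (suc k) ℕ.≤-refl ∂S) (ℕ.≤-reflexive (e₂ k))
  where
  e₁ : ∀ k → 2 * (k * 2 * suc k + suc k) ≡ (k * 2 + 1) * (k * 2 + 2)
  e₁ = ℕ-Ring.solve-∀
  e₂ : ∀ k → k * 2 + 2 * suc k + 3 ≡ 2 * (k * 2) + 5
  e₂ = ℕ-Ring.solve-∀
... | k , inj₂ refl = shapeSet (strip (suc k)) (suc k * 2) (suc k) ,
  trans (cong (2 *_) (card-strip (suc k) (suc k * 2) (suc k))) (e₁ k) ,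
  λ b ∂S → ℕ.≤-trans (strip-boundary (suc k) (suc k * 2) (suc k) ℕ.≤-refl ∂S) (ℕ.≤-reflexive (e₂ k))
  where
  e₁ : ∀ k → 2 * (suc k * 2 * suc k + suc k) ≡ (suc (k * 2) + 1) * (suc (k * 2) + 2)
  e₁ = ℕ-Ring.solve-∀
  e₂ : ∀ k → suc k * 2 + 2 * suc k + 3 ≡ 2 * suc (k * 2) + 5
  e₂ = ℕ-Ring.solve-∀

rectangle-rigid : ∀ K → 1 ≤ K → ∃[ R ] IsRectangleCard K (card (Rigid.set {InB K (K + 1)} R))
rectangle-rigid (suc K') 1≤K with rectangle-set (suc K') 1≤K
... | S , |S|≡ , ∂S≤ = record
  { set = S ; c = 2 * K + 2
  ; nonempty = ℕ.≤-trans (s≤s z≤n) (three S |S|≡)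
  ; threshold = threshold-by (card S) (2 * K + 2) (4 * K' + 3) (trans (e₁ K') (sym (8n≡ S |S|≡)))
  ; bounded = λ b ∂S → ℕ.≤-trans (∂S≤ b ∂S) (ℕ.≤-reflexive (e₃ K))
  ; rigid = λ C |C|≡ ∂C≤ → let |C|≡' = trans (cong (2 *_) |C|≡) |S|≡ in
      rectangle-congruent {elems C} {K} (boundary-extremal-box {C} (proj₂ (boundary C))
        (ℕ.≤-trans (∂C≤ _ (proj₂ (boundary C))) (ℕ.≤-reflexive (e₄ K)))
        (three C |C|≡')
        (ℕ.≤-trans (ℕ.m≤m+n 5 (2 * K')) (ℕ.≤-reflexive (e₅ K')))
        -- Here `(2K + 3)² = 8n + 1`, the limit of what the extremal argument permits.
        (ℕ.≤-reflexive (trans (e₆ K) (cong (_+ 1) (sym (8n≡ C |C|≡'))))))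
  } , |S|≡
  where
  K = suc K'
  8n≡ : ∀ C → IsRectangleCard K (card C) → 8 * card C ≡ 4 * ((K + 1) * (K + 2))
  8n≡ C h = trans (ℕ.*-assoc 4 2 (card C)) (cong (4 *_) h)
  e₁ : ∀ K' → suc ((2 * suc K' + 2) * (2 * suc K' + 2) + 4) + (4 * K' + 3) ≡ 4 * ((suc K' + 1) * (suc K' + 2))
  e₁ = ℕ-Ring.solve-∀
  e₂ : ∀ K' → 2 * 3 + (5 * K' + K' * K') ≡ (suc K' + 1) * (suc K' + 2)
  e₂ = ℕ-Ring.solve-∀
  e₃ : ∀ K → 2 * K + 5 ≡ suc (2 * K + 2) + 2
  e₃ = ℕ-Ring.solve-∀
  e₄ : ∀ K → suc (2 * K + 2) + 2 ≡ 2 * K + 3 + 2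
  e₄ = ℕ-Ring.solve-∀
  e₅ : ∀ K' → 5 + 2 * K' ≡ 2 * suc K' + 3
  e₅ = ℕ-Ring.solve-∀
  e₆ : ∀ K → (2 * K + 3) * (2 * K + 3) ≡ 4 * ((K + 1) * (K + 2)) + 1
  e₆ = ℕ-Ring.solve-∀
  three : ∀ C → IsRectangleCard K (card C) → 3 ≤ card C
  three C h = ℕ.*-cancelˡ-≤ 2 (ℕ.≤-trans (ℕ.m≤m+n 6 _) (ℕ.≤-reflexive (trans (e₂ K') (sym h))))

-- M(c − 1) < n ≤ M(c) for c = 4k+4, 4k+1, 4k+2, 4k+3, where M(c) = ⌊(c² + 4) / 8⌋ is the largest
-- size of a set with c + 2 boundary points.
data Range (n : ℕ) : Set where
  range₀ : ∀ k j → j ≤ k → n ≡ suc (k * 2) * suc k + suc j → Range n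
  range₁ : ∀ k j → j < k → n ≡ k * 2 * k + suc j → Range n
  range₂ : ∀ k j → j ≤ k → n ≡ suc (k * 2) * k + suc j → Range n
  range₃ : ∀ k j → j < k → n ≡ k * 2 * suc k + suc (suc j) → Range n

-- The ranges follow one another cyclically, `k` increasing after `range₀`; each begins right after
-- the end of the one before.
range-suc : ∀ {n} → Range n → Range (suc n)
range-suc (range₀ k j j≤k refl) with ℕ.m≤n⇒m<n∨m≡n j≤k
... | inj₁ j<k = range₀ k (suc j) j<k (sym (ℕ.+-suc (suc (k * 2) * suc k) (suc j)))
... | inj₂ refl = range₁ (suc k) 0 (s≤s z≤n) (e k)
  where
  e : ∀ k → suc (suc (k * 2) * suc k + suc k) ≡ suc k * 2 * suc k + 1
  e = ℕ-Ring.solve-∀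
range-suc (range₁ k j j<k refl) with ℕ.m≤n⇒m<n∨m≡n j<k
... | inj₁ 1+j<k = range₁ k (suc j) 1+j<k (sym (ℕ.+-suc (k * 2 * k) (suc j)))
... | inj₂ refl = range₂ (suc j) 0 z≤n (e j)
  where
  e : ∀ j → suc (suc j * 2 * suc j + suc j) ≡ suc (suc j * 2) * suc j + 1
  e = ℕ-Ring.solve-∀
range-suc (range₂ k j j≤k refl) with ℕ.m≤n⇒m<n∨m≡n j≤k
... | inj₁ j<k = range₂ k (suc j) j<k (sym (ℕ.+-suc (suc (k * 2) * k) (suc j)))
-- For `k = 0` the range `range₃` is empty, so `range₀` follows at once.
range-suc (range₂ zero .zero _ refl) | inj₂ refl = range₀ 0 0 z≤n refl
range-suc (range₂ (suc k) .(suc k) _ refl) | inj₂ refl = range₃ (suc k) 0 (s≤s z≤n) (e k)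
  where
  e : ∀ k → suc (suc (suc k * 2) * suc k + suc (suc k)) ≡ suc k * 2 * suc (suc k) + 2
  e = ℕ-Ring.solve-∀
range-suc (range₃ k j j<k refl) with ℕ.m≤n⇒m<n∨m≡n j<k
... | inj₁ 1+j<k = range₃ k (suc j) 1+j<k (sym (ℕ.+-suc (k * 2 * suc k) (suc (suc j))))
... | inj₂ refl = range₀ (suc j) 0 z≤n (e j)
  where
  e : ∀ j → suc (suc j * 2 * suc (suc j) + suc (suc j)) ≡ suc (suc j * 2) * suc (suc j) + 1
  e = ℕ-Ring.solve-∀

range : ∀ n → Range (suc n)
range zero = range₂ 0 0 z≤n refl
range (suc n) = range-suc (range n)

-- Classification of the sizes

data Kind (n : ℕ) : Set where
  square    : ∀ k → n ≡ square-card k → Kind n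
  rectangle : ∀ K → 1 ≤ K → IsRectangleCard K n → Kind n
  ambiguous : Ambiguous n → Kind n

-- The domino and a diagonal pair have the same number of leaves, but only the domino has an edge.
ambiguous-2 : Ambiguous 2
ambiguous-2 = record
  { S = shapeSet (strip 1) 1 1 ; T = shapeSet (zigzag 1) 0 2 ; c = 3
  ; |S|≡ = refl ; |T|≡ = refl
  ; threshold = threshold-by 2 3 2 refl
  ; S-bounded = λ b → strip-boundary 1 1 1 ℕ.≤-refl
  ; T-bounded = λ b → zigzag-boundary 1 0 2 ℕ.≤-refl
  ; differ = λ (φ , S⇔T) → no-edge (∈-shape⁻ {zigzag 1} {0} {2} (Equivalence.to (S⇔T (pt 0 0)) (here refl)))
      (∈-shape⁻ {zigzag 1} {0} {2} (Equivalence.to (S⇔T (pt 1 0)) (there (here refl))))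
      (Equivalence.to (adj φ (pt 0 0) (pt 1 0)) (adj-next 0 0))
  }
  where
  no-edge : ∀ {p q} → ∃[ u ] ∃[ i ] (InShape (zigzag 1) 0 2 u i × p ≡ pt u i) →
    ∃[ u ] ∃[ i ] (InShape (zigzag 1) 0 2 u i × q ≡ pt u i) → Adj p q → ⊥
  no-edge (_ , i , last refl _ , refl) (_ , i' , last refl _ , refl) p~q
    with adj-even⁻ 0 i 0 i' refl p~q
  ... | inj₁ () , _
  ... | inj₂ () , _

-- The zigzag gains `t + 1` points on its longer lines, the strip `t + 2` on its additional line;
-- hence `2 + j` against `suc j` points on the last lines. In `ambiguous₂` the two gains agree.
ambiguous₀ : ∀ t j → j ≤ suc t → Ambiguous (suc (suc t * 2) * suc (suc t) + suc j)
ambiguous₀ t j j≤ = record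
  { S = shapeSet (zigzag (2 + t)) (suc t * 2) (2 + j)
  ; T = shapeSet (strip (2 + t)) (suc (suc t * 2)) (suc j)
  ; c = 4 * t + 7
  ; |S|≡ = trans (card-zigzag (2 + t) (suc t) (2 + j)) (e₁ t j)
  ; |T|≡ = card-strip (2 + t) (suc (suc t * 2)) (suc j)
  ; threshold = threshold-by (suc (suc t * 2) * suc (suc t) + suc j) (4 * t + 7) (2 + 8 * j) (e₂ t j)
  ; S-bounded = λ b ∂ → ℕ.≤-trans (zigzag-boundary (2 + t) (suc t) (2 + j)
      (s≤s (s≤s (ℕ.≤-trans j≤ (ℕ.≤-reflexive (ℕ.+-comm 1 t))))) ∂) (ℕ.≤-reflexive (e₃ t))
  ; T-bounded = λ b ∂ → ℕ.≤-trans (strip-boundary (2 + t) (suc (suc t * 2)) (suc j) (s≤s j≤) ∂) (ℕ.≤-reflexive (e₄ t))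
  ; differ = leaves-differ (zigzag-three-leaves (suc t) t (s≤s z≤n)) (strip-two-leaves (suc t) t (s≤s z≤n) (s≤s j≤))
  }
  where
  e₁ : ∀ t j → suc t * (2 * (2 + t) + 1) + (2 + j) ≡ suc (suc t * 2) * suc (suc t) + suc j
  e₁ = ℕ-Ring.solve-∀
  e₂ : ∀ t j → suc ((4 * t + 7) * (4 * t + 7) + 4) + (2 + 8 * j) ≡ 8 * (suc (suc t * 2) * suc (suc t) + suc j)
  e₂ = ℕ-Ring.solve-∀
  e₃ : ∀ t → 2 * (2 + t) + 2 * suc t + 4 ≡ suc (4 * t + 7) + 2
  e₃ = ℕ-Ring.solve-∀
  e₄ : ∀ t → suc (suc t * 2) + 2 * (2 + t) + 3 ≡ suc (4 * t + 7) + 2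
  e₄ = ℕ-Ring.solve-∀

-- The same strip starting on an even or on an odd line. The bound `suc j ≤ h` leaves a point
-- missing on the last line; with a complete last line the size would be that of a rectangle in the
-- cases `ambiguous₁` and `ambiguous₃`.
ambiguous-strip : ∀ h r j {c} → suc j ≤ h →
  Threshold (suc r * 2 * suc h + suc j) c → suc r * 2 + 2 * suc h + 3 ≡ suc c + 2 →
  Ambiguous (suc r * 2 * suc h + suc j)
ambiguous-strip h r j {c} j<h thr c≡ = record
  { S = shapeSet (strip (suc h)) (suc r * 2) (suc j)
  ; T = shapeSet (late-strip (suc h)) (suc (suc r * 2)) (suc j)
  ; c = c
  ; |S|≡ = card-strip (suc h) (suc r * 2) (suc j)
  ; |T|≡ = card-late-strip (suc h) (suc r * 2) (suc j)
  ; threshold = thr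
  ; S-bounded = λ b ∂ → ℕ.≤-trans (strip-boundary (suc h) (suc r * 2) (suc j) j≤ ∂) (ℕ.≤-reflexive c≡)
  ; T-bounded = λ b ∂ → ℕ.≤-trans (late-strip-boundary (suc h) (suc r * 2) (suc j) j≤ ∂) (ℕ.≤-reflexive c≡)
  ; differ = leaves-differ (strip-three-leaves h r (s≤s z≤n) j<h) (late-strip-two-leaves h r (s≤s z≤n) j≤)
  }
  where
  j≤ : suc j ≤ suc h
  j≤ = ℕ.m≤n⇒m≤1+n j<h

ambiguous₁ : ∀ k j → suc j < suc k → Ambiguous (suc k * 2 * suc k + suc j)
ambiguous₁ k j (s≤s j<k) = ambiguous-strip k k j {4 * suc k} j<k
  (threshold-by (suc k * 2 * suc k + suc j) (4 * suc k) (3 + 8 * j) (e₁ k j)) (e₂ k)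
  where
  e₁ : ∀ k j → suc (4 * suc k * (4 * suc k) + 4) + (3 + 8 * j) ≡ 8 * (suc k * 2 * suc k + suc j)
  e₁ = ℕ-Ring.solve-∀
  e₂ : ∀ k → suc k * 2 + 2 * suc k + 3 ≡ suc (4 * suc k) + 2
  e₂ = ℕ-Ring.solve-∀

ambiguous₃ : ∀ k j → suc j < suc k → Ambiguous (suc k * 2 * suc (suc k) + suc (suc j))
ambiguous₃ k j 1+j<1+k = ambiguous-strip (suc k) k (suc j) {4 * suc k + 2} 1+j<1+k
  (threshold-by (suc k * 2 * suc (suc k) + suc (suc j)) (4 * suc k + 2) (7 + 8 * j) (e₁ k j)) (e₂ k)
  where
  e₁ : ∀ k j → suc ((4 * suc k + 2) * (4 * suc k + 2) + 4) + (7 + 8 * j)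
    ≡ 8 * (suc k * 2 * suc (suc k) + suc (suc j))
  e₁ = ℕ-Ring.solve-∀
  e₂ : ∀ k → suc k * 2 + 2 * suc (suc k) + 3 ≡ suc (4 * suc k + 2) + 2
  e₂ = ℕ-Ring.solve-∀

ambiguous₂ : ∀ k j → j < suc k → Ambiguous (suc (suc k * 2) * suc k + suc j)
ambiguous₂ k j j< = record
  { S = shapeSet (zigzag (suc k)) (suc k * 2) (suc j)
  ; T = shapeSet (strip (suc k)) (suc (suc k * 2)) (suc j)
  ; c = 4 * suc k + 1
  ; |S|≡ = trans (card-zigzag (suc k) (suc k) (suc j)) (e₁ k j)
  ; |T|≡ = card-strip (suc k) (suc (suc k * 2)) (suc j)
  ; threshold = threshold-by (suc (suc k * 2) * suc k + suc j) (4 * suc k + 1) (2 + 8 * j) (e₂ k j)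
  ; S-bounded = λ b ∂ → ℕ.≤-trans (zigzag-boundary (suc k) (suc k) (suc j) (ℕ.≤-trans j< (ℕ.m≤m+n _ 1)) ∂) (ℕ.≤-reflexive (e₃ k))
  ; T-bounded = λ b ∂ → ℕ.≤-trans (strip-boundary (suc k) (suc (suc k * 2)) (suc j) j< ∂) (ℕ.≤-reflexive (e₄ k))
  ; differ = leaves-differ (zigzag-three-leaves k k (s≤s z≤n)) (strip-two-leaves k k (s≤s z≤n) j<)
  }
  where
  e₁ : ∀ k j → suc k * (2 * suc k + 1) + suc j ≡ suc (suc k * 2) * suc k + suc j
  e₁ = ℕ-Ring.solve-∀
  e₂ : ∀ k j → suc ((4 * suc k + 1) * (4 * suc k + 1) + 4) + (2 + 8 * j) ≡ 8 * (suc (suc k * 2) * suc k + suc j)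
  e₂ = ℕ-Ring.solve-∀
  e₃ : ∀ k → 2 * suc k + 2 * suc k + 4 ≡ suc (4 * suc k + 1) + 2
  e₃ = ℕ-Ring.solve-∀
  e₄ : ∀ k → suc (suc k * 2) + 2 * suc k + 3 ≡ suc (4 * suc k + 1) + 2
  e₄ = ℕ-Ring.solve-∀

-- In `range₁`, `range₂` and `range₃` only the greatest size, for which the last line becomes
-- complete, belongs to a box. In `range₀` every size is ambiguous.
kind : ∀ {n} → Range n → Kind n
kind (range₀ zero zero _ refl) = ambiguous ambiguous-2
kind (range₀ (suc t) j j≤ refl) = ambiguous (ambiguous₀ t j j≤)
kind (range₁ (suc k) j j<k refl) with ℕ.m≤n⇒m<n∨m≡n j<k
... | inj₁ 1+j<k = ambiguous (ambiguous₁ k j 1+j<k)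
... | inj₂ refl = rectangle (suc (k * 2)) (s≤s z≤n) (e k)
  where
  e : ∀ k → 2 * (suc k * 2 * suc k + suc k) ≡ (suc (k * 2) + 1) * (suc (k * 2) + 2)
  e = ℕ-Ring.solve-∀
kind (range₂ k j j≤k refl) with ℕ.m≤n⇒m<n∨m≡n j≤k
kind (range₂ (suc k) j _ refl) | inj₁ j<k = ambiguous (ambiguous₂ k j j<k)
kind (range₂ k .k _ refl) | inj₂ refl = square k (e k)
  where
  e : ∀ k → suc (k * 2) * k + suc k ≡ k * (2 * k + 1) + suc k
  e = ℕ-Ring.solve-∀
kind (range₃ (suc k) j j<k refl) with ℕ.m≤n⇒m<n∨m≡n j<k
... | inj₁ 1+j<k = ambiguous (ambiguous₃ k j 1+j<k)
... | inj₂ refl = rectangle (suc k * 2) (s≤s z≤n) (e k)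
  where
  e : ∀ k → 2 * (suc k * 2 * suc (suc k) + suc (suc k)) ≡ (suc k * 2 + 1) * (suc k * 2 + 2)
  e = ℕ-Ring.solve-∀

classify : ∀ {n} → 0 < n → Kind n
classify {suc n} _ = kind (range n)

theorem8p8 : ∀ (A : FinSet) → 0 < card A →
    UniquelyMinimal A ⇔
      (∃[ n ] (Congruent (_∈ₛ A) (InB (2 * n) (2 * n)) ⊎ Congruent (_∈ₛ A) (InB n (n + 1))))
theorem8p8 A 0<A = mk⇔ (to (classify 0<A)) from
  where
  to : Kind (card A) → UniquelyMinimal A →
    ∃[ n ] (Congruent (_∈ₛ A) (InB (2 * n) (2 * n)) ⊎ Congruent (_∈ₛ A) (InB n (n + 1)))
  to (square k |A|≡) (A-min , _) = k , inj₁ (rigid-congruent (square-rigid k) A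
    (trans |A|≡ (sym (card-zigzag k k (suc k)))) A-min)
  to (rectangle K 1≤K |A|≡) (A-min , _) = let R , |S|≡ = rectangle-rigid K 1≤K in
    K , inj₂ (rigid-congruent R A (ℕ.*-cancelˡ-≡ _ _ 2 (trans |A|≡ (sym |S|≡))) A-min)
  to (ambiguous amb) A-unique = contradiction A-unique (ambiguous-not-unique A 0<A amb)
  from : ∃[ n ] (Congruent (_∈ₛ A) (InB (2 * n) (2 * n)) ⊎ Congruent (_∈ₛ A) (InB n (n + 1))) →
    UniquelyMinimal A
  from (n , inj₁ A≅B) = rigid-unique (square-rigid n) A A≅B
  -- `B(0,1)` is the single point `B(0,0)`; `rectangle-rigid` begins at `K = 1`.
  from (zero , inj₂ A≅B) = rigid-unique (square-rigid 0) A
    (Congruent-trans (_∈ₛ A) (InB 0 1) (InB 0 0) A≅B (Congruent-reflexive _ _ InB-0-1⇔InB-0-0))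
  from (suc n , inj₂ A≅B) = rigid-unique (proj₁ (rectangle-rigid (suc n) (s≤s z≤n))) A A≅B
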